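{- Let $G$ be a connected graph of order $n\geq 11$ that is $1$-binding (i.e. $bind(G)\geq 1$). If $$\rho(G)\geq\rho(K_1\vee(K_{n-4}\cup K_2\cup K_1)),$$ then $G$ has an $H$-factor for each set-valued function $H:V(G)\longrightarrow\{\{1\},\{0,2\}\}$ with $|H^{ -1}(1)|$ even, unless $G=K_1\vee(K_{n-4}\cup K_2\cup K_1)$ (up to isomorphism).
   Context: All graphs are finite, undirected, without loops or multiple edges. $K_m$ is the complete graph of order $m$. $G_1\cup G_2$ denotes the disjoint union of vertex-disjoint graphs, and $G_1\vee G_2$ denotes the join, obtained from $G_1\cup G_2$ by joining each vertex of $G_1$ to each vertex of $G_2$ by an edge. For $S\subseteq V(G)$, $N_G(S)$ denotes the set of neighbors of $S$ in $G$, that is, $N_G(S)=\bigcup_{v\in S}N_G(v)$. The binding number of $G$ is $$bind(G)=\min\left\{\frac{|N_G(S)|}{|S|}:\emptyset\neq S\subseteq V(G),\ N_G(S)\neq V(G)\right\}.$$ For a positive real number $r$, $G$ is $r$-binding if $bind(G)\geq r$. $\rho(G)$ denotes the adjacency spectral radius of $G$, i.e. the largest eigenvalue of its adjacency matrix $A(G)$. For a function $H:V(G)\longrightarrow\{\{1\},\{0,2\}\}$ (so each $H(v)$ equals $\{1\}$ or $\{0,2\}$), let $H^{ -1}(1)=\{v\in V(G): H(v)=\{1\}\}$. An $H$-factor of $G$ is a spanning subgraph $F$ of $G$ such that $d_F(v)\in H(v)$ for each $v\in V(G)$, where $d_F(v)$ is the degree of $v$ in $F$. -}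

module Defs where

open import Algebra.Bundles using (CommutativeMonoid)
import Algebra.Properties.CommutativeSemigroup as CommutativeSemigroup
open import Data.Bool.Base using (Bool; true; false; if_then_else_)
open import Data.Fin.Base using (Fin; splitAt)
open import Data.Fin.Properties as Fin using ()
open import Data.Fin.Subset using (Subset; Nonempty; ⊤; ⋃; ∣_∣)
open import Data.Fin.Subset.Properties using (_∈?_; x∈p⇒∣p-x∣<∣p∣)
open import Data.Integer.Base using (+_)
open import Data.List.Base using (List; []; _∷_; map; filter; allFin)
open import Data.List.Membership.Propositional using (_∈_)
open import Data.Nat.Base as ℕ using (ℕ)
import Data.Nat.Properties as ℕ
open import Data.Product.Base using (_×_; _,_; proj₁; proj₂; ∃-syntax; Σ-syntax)
open import Data.Rational.Base as ℚ using (ℚ; 0ℚ; 1ℚ; ½)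
import Data.Rational.Properties as ℚ
open import Data.Sum.Base using (_⊎_; inj₁; inj₂)
open import Data.Vec.Base using (tabulate)
open import Data.Vec.Functional using (Vector; foldr)
open import Function.Bundles using (_↔_; Inverse)
open import Relation.Binary.Construct.Closure.ReflexiveTransitive using (Star)
open import Relation.Binary.PropositionalEquality
open import Relation.Nullary using (¬_; yes; no; contradiction)

------------------------------------------------------------------------
-- Real numbers, as Cauchy sequences of rationals.  Equality is the setoid
-- equality _≈_ (the difference tends to 0), never _≡_.

CauchySeq : (ℕ → ℚ) → Set
CauchySeq s = ∀ ε → 0ℚ ℚ.< ε →
  ∃[ N ] (∀ m n → N ℕ.≤ m → N ℕ.≤ n → ℚ.∣ s m ℚ.- s n ∣ ℚ.≤ ε)

record ℝ : Set where
  constructor mkℝ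
  field
    seq    : ℕ → ℚ
    cauchy : CauchySeq seq

open ℝ public

infix 4 _≈_ _≤_
infixl 6 _+_
infixl 7 _*_

_≈_ : ℝ → ℝ → Set
x ≈ y = ∀ ε → 0ℚ ℚ.< ε →
  ∃[ N ] (∀ n → N ℕ.≤ n → ℚ.∣ seq x n ℚ.- seq y n ∣ ℚ.≤ ε)

_≤_ : ℝ → ℝ → Set
x ≤ y = ∀ ε → 0ℚ ℚ.< ε →
  ∃[ N ] (∀ n → N ℕ.≤ n → seq x n ℚ.≤ seq y n ℚ.+ ε)

fromℚ : ℚ → ℝ
fromℚ q .seq    _     = q
fromℚ q .cauchy ε 0<ε = 0 , λ _ _ _ _ →
  ℚ.≤-trans (ℚ.≤-reflexive (cong ℚ.∣_∣ (ℚ.+-inverseʳ q))) (ℚ.<⇒≤ 0<ε)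

0ℝ 1ℝ : ℝ
0ℝ = fromℚ 0ℚ
1ℝ = fromℚ 1ℚ

_+_ : ℝ → ℝ → ℝ
(x + y) .seq    n     = seq x n ℚ.+ seq y n
(x + y) .cauchy ε 0<ε = N₁ ℕ.⊔ N₂ , close
  where
  ε/2 : ℚ
  ε/2 = ½ ℚ.* ε

  0<ε/2 : 0ℚ ℚ.< ε/2
  0<ε/2 = subst (ℚ._< ε/2) (ℚ.*-zeroʳ ½) (ℚ.*-monoʳ-<-pos ½ 0<ε)

  N₁ N₂ : ℕ
  N₁ = proj₁ (cauchy x ε/2 0<ε/2)
  N₂ = proj₁ (cauchy y ε/2 0<ε/2)

  regroup : ∀ a b c d → (a ℚ.+ b) ℚ.- (c ℚ.+ d) ≡ (a ℚ.- c) ℚ.+ (b ℚ.- d)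
  regroup a b c d = trans (cong ((a ℚ.+ b) ℚ.+_) (ℚ.neg-distrib-+ c d))
                          (interchange a b (ℚ.- c) (ℚ.- d))
    where
    open CommutativeSemigroup
      (CommutativeMonoid.commutativeSemigroup ℚ.+-0-commutativeMonoid)

  halves : ε/2 ℚ.+ ε/2 ≡ ε
  halves = trans (sym (ℚ.*-distribʳ-+ ε ½ ½)) (ℚ.*-identityˡ ε)

  open ℚ.≤-Reasoning

  close : ∀ m n → N₁ ℕ.⊔ N₂ ℕ.≤ m → N₁ ℕ.⊔ N₂ ℕ.≤ n →
          ℚ.∣ (seq x m ℚ.+ seq y m) ℚ.- (seq x n ℚ.+ seq y n) ∣ ℚ.≤ ε
  close m n N≤m N≤n = begin
    ℚ.∣ (seq x m ℚ.+ seq y m) ℚ.- (seq x n ℚ.+ seq y n) ∣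
      ≡⟨ cong ℚ.∣_∣ (regroup (seq x m) (seq y m) (seq x n) (seq y n)) ⟩
    ℚ.∣ (seq x m ℚ.- seq x n) ℚ.+ (seq y m ℚ.- seq y n) ∣
      ≤⟨ ℚ.∣p+q∣≤∣p∣+∣q∣ (seq x m ℚ.- seq x n) (seq y m ℚ.- seq y n) ⟩
    ℚ.∣ seq x m ℚ.- seq x n ∣ ℚ.+ ℚ.∣ seq y m ℚ.- seq y n ∣
      ≤⟨ ℚ.+-mono-≤
           (proj₂ (cauchy x ε/2 0<ε/2) m n
             (ℕ.m⊔n≤o⇒m≤o N₁ N₂ N≤m) (ℕ.m⊔n≤o⇒m≤o N₁ N₂ N≤n))
           (proj₂ (cauchy y ε/2 0<ε/2) m n
             (ℕ.m⊔n≤o⇒n≤o N₁ N₂ N≤m) (ℕ.m⊔n≤o⇒n≤o N₁ N₂ N≤n)) ⟩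
    ε/2 ℚ.+ ε/2
      ≡⟨ halves ⟩
    ε ∎

p≡p-q+q : ∀ p q → p ≡ (p ℚ.- q) ℚ.+ q
p≡p-q+q p q = begin
  p                     ≡⟨ ℚ.+-identityʳ p ⟨
  p ℚ.+ 0ℚ              ≡⟨ cong (p ℚ.+_) (ℚ.+-inverseˡ q) ⟨
  p ℚ.+ (ℚ.- q ℚ.+ q)   ≡⟨ ℚ.+-assoc p (ℚ.- q) q ⟨
  (p ℚ.- q) ℚ.+ q       ∎
  where open ≡-Reasoning

eventuallyBounded : (x : ℝ) →
  Σ[ B ∈ ℚ ] (ℚ.Positive B ×
    ∃[ N ] (∀ n → N ℕ.≤ n → ℚ.∣ seq x n ∣ ℚ.≤ B))
eventuallyBounded x = B , B-pos , N , bound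
  where
  0<1 : 0ℚ ℚ.< 1ℚ
  0<1 = ℚ.positive⁻¹ 1ℚ

  N : ℕ
  N = proj₁ (cauchy x 1ℚ 0<1)

  B : ℚ
  B = 1ℚ ℚ.+ ℚ.∣ seq x N ∣

  B-pos : ℚ.Positive B
  B-pos = ℚ.pos+nonNeg⇒pos 1ℚ ℚ.∣ seq x N ∣
            {{ℚ.nonNegative (ℚ.0≤∣p∣ (seq x N))}}

  open ℚ.≤-Reasoning

  bound : ∀ n → N ℕ.≤ n → ℚ.∣ seq x n ∣ ℚ.≤ B
  bound n N≤n = begin
    ℚ.∣ seq x n ∣
      ≡⟨ cong ℚ.∣_∣ (p≡p-q+q (seq x n) (seq x N)) ⟩
    ℚ.∣ (seq x n ℚ.- seq x N) ℚ.+ seq x N ∣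
      ≤⟨ ℚ.∣p+q∣≤∣p∣+∣q∣ (seq x n ℚ.- seq x N) (seq x N) ⟩
    ℚ.∣ seq x n ℚ.- seq x N ∣ ℚ.+ ℚ.∣ seq x N ∣
      ≤⟨ ℚ.+-monoˡ-≤ ℚ.∣ seq x N ∣
           (proj₂ (cauchy x 1ℚ 0<1) n N N≤n ℕ.≤-refl) ⟩
    B ∎

_*_ : ℝ → ℝ → ℝ
(x * y) .seq    n     = seq x n ℚ.* seq y n
(x * y) .cauchy ε 0<ε with eventuallyBounded x | eventuallyBounded y
... | Bx , Bx-pos , Nx , ∣x∣≤Bx | By , By-pos , Ny , ∣y∣≤By = N , close
  where
  instance
    _ = Bx-pos
    _ = By-pos

    B-pos : ℚ.Positive (Bx ℚ.+ By)
    B-pos = ℚ.pos+pos⇒pos Bx By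

    B-nonZero : ℚ.NonZero (Bx ℚ.+ By)
    B-nonZero = ℚ.pos⇒nonZero (Bx ℚ.+ By)

    1/B-pos : ℚ.Positive (ℚ.1/ (Bx ℚ.+ By))
    1/B-pos = ℚ.1/pos⇒pos (Bx ℚ.+ By)

  δ : ℚ
  δ = ε ℚ.* ℚ.1/ (Bx ℚ.+ By)

  0<δ : 0ℚ ℚ.< δ
  0<δ = subst (ℚ._< δ) (ℚ.*-zeroˡ (ℚ.1/ (Bx ℚ.+ By)))
          (ℚ.*-monoˡ-<-pos (ℚ.1/ (Bx ℚ.+ By)) 0<ε)

  N₁ N₂ N : ℕ
  N₁ = proj₁ (cauchy x δ 0<δ)
  N₂ = proj₁ (cauchy y δ 0<δ)
  N  = (Nx ℕ.⊔ Ny) ℕ.⊔ (N₁ ℕ.⊔ N₂)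

  regroup : ∀ a b c d →
    a ℚ.* b ℚ.- c ℚ.* d ≡ a ℚ.* (b ℚ.- d) ℚ.+ (a ℚ.- c) ℚ.* d
  regroup a b c d = begin
    a ℚ.* b ℚ.- c ℚ.* d
      ≡⟨ cong (λ t → a ℚ.* t ℚ.- c ℚ.* d) (p≡p-q+q b d) ⟩
    a ℚ.* ((b ℚ.- d) ℚ.+ d) ℚ.- c ℚ.* d
      ≡⟨ cong (ℚ._- c ℚ.* d) (ℚ.*-distribˡ-+ a (b ℚ.- d) d) ⟩
    (a ℚ.* (b ℚ.- d) ℚ.+ a ℚ.* d) ℚ.- c ℚ.* d
      ≡⟨ ℚ.+-assoc (a ℚ.* (b ℚ.- d)) (a ℚ.* d) (ℚ.- (c ℚ.* d)) ⟩
    a ℚ.* (b ℚ.- d) ℚ.+ (a ℚ.* d ℚ.- c ℚ.* d)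
      ≡⟨ cong (λ t → a ℚ.* (b ℚ.- d) ℚ.+ (a ℚ.* d ℚ.+ t)) (ℚ.neg-distribˡ-* c d) ⟩
    a ℚ.* (b ℚ.- d) ℚ.+ (a ℚ.* d ℚ.+ ℚ.- c ℚ.* d)
      ≡⟨ cong (a ℚ.* (b ℚ.- d) ℚ.+_) (ℚ.*-distribʳ-+ d a (ℚ.- c)) ⟨
    a ℚ.* (b ℚ.- d) ℚ.+ (a ℚ.- c) ℚ.* d ∎
    where open ≡-Reasoning

  rebalance : ∀ a b c → a ℚ.* c ℚ.+ c ℚ.* b ≡ c ℚ.* (a ℚ.+ b)
  rebalance a b c = trans (cong (ℚ._+ c ℚ.* b) (ℚ.*-comm a c))
                          (sym (ℚ.*-distribˡ-+ c a b))

  δB≡ε : δ ℚ.* (Bx ℚ.+ By) ≡ ε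
  δB≡ε = trans (ℚ.*-assoc ε (ℚ.1/ (Bx ℚ.+ By)) (Bx ℚ.+ By))
        (trans (cong (ε ℚ.*_) (ℚ.*-inverseˡ (Bx ℚ.+ By)))
               (ℚ.*-identityʳ ε))

  ∣*∣-mono : ∀ p q {B C} → ℚ.Positive B → ℚ.∣ p ∣ ℚ.≤ B → ℚ.∣ q ∣ ℚ.≤ C →
             ℚ.∣ p ℚ.* q ∣ ℚ.≤ B ℚ.* C
  ∣*∣-mono p q {B} {C} B>0 p≤B q≤C = begin
    ℚ.∣ p ℚ.* q ∣          ≡⟨ ℚ.∣p*q∣≡∣p∣*∣q∣ p q ⟩
    ℚ.∣ p ∣ ℚ.* ℚ.∣ q ∣    ≤⟨ ℚ.*-monoʳ-≤-nonNeg ℚ.∣ q ∣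
                                {{ℚ.nonNegative (ℚ.0≤∣p∣ q)}} p≤B ⟩
    B ℚ.* ℚ.∣ q ∣          ≤⟨ ℚ.*-monoˡ-≤-nonNeg B
                                {{ℚ.pos⇒nonNeg B {{B>0}}}} q≤C ⟩
    B ℚ.* C                ∎
    where open ℚ.≤-Reasoning

  ≥Nx : ∀ {n} → N ℕ.≤ n → Nx ℕ.≤ n
  ≥Nx h = ℕ.m⊔n≤o⇒m≤o Nx Ny (ℕ.m⊔n≤o⇒m≤o (Nx ℕ.⊔ Ny) (N₁ ℕ.⊔ N₂) h)

  ≥Ny : ∀ {n} → N ℕ.≤ n → Ny ℕ.≤ n
  ≥Ny h = ℕ.m⊔n≤o⇒n≤o Nx Ny (ℕ.m⊔n≤o⇒m≤o (Nx ℕ.⊔ Ny) (N₁ ℕ.⊔ N₂) h)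

  ≥N₁ : ∀ {n} → N ℕ.≤ n → N₁ ℕ.≤ n
  ≥N₁ h = ℕ.m⊔n≤o⇒m≤o N₁ N₂ (ℕ.m⊔n≤o⇒n≤o (Nx ℕ.⊔ Ny) (N₁ ℕ.⊔ N₂) h)

  ≥N₂ : ∀ {n} → N ℕ.≤ n → N₂ ℕ.≤ n
  ≥N₂ h = ℕ.m⊔n≤o⇒n≤o N₁ N₂ (ℕ.m⊔n≤o⇒n≤o (Nx ℕ.⊔ Ny) (N₁ ℕ.⊔ N₂) h)

  open ℚ.≤-Reasoning

  close : ∀ m n → N ℕ.≤ m → N ℕ.≤ n →
          ℚ.∣ seq x m ℚ.* seq y m ℚ.- seq x n ℚ.* seq y n ∣ ℚ.≤ ε
  close m n N≤m N≤n = begin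
    ℚ.∣ seq x m ℚ.* seq y m ℚ.- seq x n ℚ.* seq y n ∣
      ≡⟨ cong ℚ.∣_∣ (regroup (seq x m) (seq y m) (seq x n) (seq y n)) ⟩
    ℚ.∣ seq x m ℚ.* (seq y m ℚ.- seq y n) ℚ.+ (seq x m ℚ.- seq x n) ℚ.* seq y n ∣
      ≤⟨ ℚ.∣p+q∣≤∣p∣+∣q∣ (seq x m ℚ.* (seq y m ℚ.- seq y n))
                         ((seq x m ℚ.- seq x n) ℚ.* seq y n) ⟩
    ℚ.∣ seq x m ℚ.* (seq y m ℚ.- seq y n) ∣ ℚ.+ ℚ.∣ (seq x m ℚ.- seq x n) ℚ.* seq y n ∣
      ≤⟨ ℚ.+-mono-≤
           (∣*∣-mono (seq x m) (seq y m ℚ.- seq y n) Bx-pos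
             (∣x∣≤Bx m (≥Nx N≤m))
             (proj₂ (cauchy y δ 0<δ) m n (≥N₂ N≤m) (≥N₂ N≤n)))
           (∣*∣-mono (seq x m ℚ.- seq x n) (seq y n) (ℚ.positive 0<δ)
             (proj₂ (cauchy x δ 0<δ) m n (≥N₁ N≤m) (≥N₁ N≤n))
             (∣y∣≤By n (≥Ny N≤n))) ⟩
    Bx ℚ.* δ ℚ.+ δ ℚ.* By
      ≡⟨ rebalance Bx By δ ⟩
    δ ℚ.* (Bx ℚ.+ By)
      ≡⟨ δB≡ε ⟩
    ε ∎

sum : ∀ {n} → Vector ℝ n → ℝ
sum = foldr _+_ 0ℝ

Matrix : ℕ → Set
Matrix n = Fin n → Fin n → ℝ

infixr 7 _·ᵥ_

_·ᵥ_ : ∀ {n} → Matrix n → Vector ℝ n → Vector ℝ n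
(A ·ᵥ x) i = sum (λ j → A i j * x j)

IsEigenvalue : ∀ {n} → Matrix n → ℝ → Set
IsEigenvalue {n} A μ = Σ[ x ∈ Vector ℝ n ]
  (¬ (∀ i → x i ≈ 0ℝ)) × (∀ i → (A ·ᵥ x) i ≈ μ * x i)

------------------------------------------------------------------------
-- Simple graphs on the vertex set Fin n

record Graph (n : ℕ) : Set where
  field
    adj     : Fin n → Fin n → Bool
    adj-sym : ∀ u v → adj u v ≡ adj v u
    no-loop : ∀ v → adj v v ≡ false

open Graph public

Adj : ∀ {n} → Graph n → Fin n → Fin n → Set
Adj G u v = adj G u v ≡ true

Connected : ∀ {n} → Graph n → Set
Connected G = ∀ u v → Star (Adj G) u v

infix 4 _≅_

_≅_ : ∀ {m n} → Graph m → Graph n → Set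
_≅_ {m} {n} G G′ = Σ[ f ∈ Fin m ↔ Fin n ]
  (∀ u v → adj G u v ≡ adj G′ (Inverse.to f u) (Inverse.to f v))

K : ∀ n → Graph n
K n .adj u v with u Fin.≟ v
... | yes _ = false
... | no  _ = true
K n .adj-sym u v with u Fin.≟ v | v Fin.≟ u
... | yes _   | yes _   = refl
... | no  _   | no  _   = refl
... | yes u≡v | no  v≢u = contradiction (sym u≡v) v≢u
... | no  u≢v | yes v≡u = contradiction (sym v≡u) u≢v
K n .no-loop v with v Fin.≟ v
... | yes _   = refl
... | no  v≢v = contradiction refl v≢v

infixr 6 _∪_
infixr 5 _∨_

-- In Fin (m + n), the first m vertices are those of the left graph.
-- `between` says whether vertices on different sides are adjacent.

module _ {m n} (between : Bool) (G₁ : Graph m) (G₂ : Graph n) where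

  edge : Fin m ⊎ Fin n → Fin m ⊎ Fin n → Bool
  edge (inj₁ u) (inj₁ v) = adj G₁ u v
  edge (inj₂ u) (inj₂ v) = adj G₂ u v
  edge (inj₁ _) (inj₂ _) = between
  edge (inj₂ _) (inj₁ _) = between

  edge-sym : ∀ u v → edge u v ≡ edge v u
  edge-sym (inj₁ u) (inj₁ v) = adj-sym G₁ u v
  edge-sym (inj₂ u) (inj₂ v) = adj-sym G₂ u v
  edge-sym (inj₁ _) (inj₂ _) = refl
  edge-sym (inj₂ _) (inj₁ _) = refl

  edge-irrefl : ∀ v → edge v v ≡ false
  edge-irrefl (inj₁ v) = no-loop G₁ v
  edge-irrefl (inj₂ v) = no-loop G₂ v

  combine : Graph (m ℕ.+ n)
  combine .adj     u v = edge (splitAt m u) (splitAt m v)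
  combine .adj-sym u v = edge-sym (splitAt m u) (splitAt m v)
  combine .no-loop v   = edge-irrefl (splitAt m v)

_∪_ : ∀ {m n} → Graph m → Graph n → Graph (m ℕ.+ n)
_∪_ = combine false

_∨_ : ∀ {m n} → Graph m → Graph n → Graph (m ℕ.+ n)
_∨_ = combine true

neighbours : ∀ {n} → Graph n → Fin n → Subset n
neighbours G v = tabulate (adj G v)

neighboursOf : ∀ {n} → Graph n → Subset n → Subset n
neighboursOf {n} G S = ⋃ (map (neighbours G) (filter (_∈? S) (allFin n)))

degree : ∀ {n} → Graph n → Fin n → ℕ
degree G v = ∣ neighbours G v ∣

------------------------------------------------------------------------
-- Binding number

bindingRatio : ∀ {n} → Graph n → (S : Subset n) → Nonempty S → ℚ
bindingRatio G S (_ , x∈S) = (+ ∣ neighboursOf G S ∣) ℚ./ ∣ S ∣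
  where
  instance
    ∣S∣≢0 : ℕ.NonZero ∣ S ∣
    ∣S∣≢0 = ℕ.>-nonZero (ℕ.m<n⇒0<n (x∈p⇒∣p-x∣<∣p∣ x∈S))

record IsBindingNumber {n} (G : Graph n) (b : ℚ) : Set where
  field
    attained   : Σ[ S ∈ Subset n ] Σ[ S≢∅ ∈ Nonempty S ]
                   (neighboursOf G S ≢ ⊤ × b ≡ bindingRatio G S S≢∅)
    lowerBound : ∀ S (S≢∅ : Nonempty S) → neighboursOf G S ≢ ⊤ →
                   b ℚ.≤ bindingRatio G S S≢∅

_-Binding_ : ∀ {n} → ℝ → Graph n → Set
r -Binding G = ∃[ b ] (IsBindingNumber G b × r ≤ fromℚ b)

------------------------------------------------------------------------
-- Spectral radius

adjacencyMatrix : ∀ {n} → Graph n → Matrix n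
adjacencyMatrix G u v = if adj G u v then 1ℝ else 0ℝ

-- `ρ(G) = ρ`: every adjacency matrix is real symmetric, so its spectrum is
-- real and ranging over real eigenvalues loses nothing.

record IsSpectralRadius {n} (G : Graph n) (ρ : ℝ) : Set where
  field
    isEigenvalue : IsEigenvalue (adjacencyMatrix G) ρ
    isLargest    : ∀ μ → IsEigenvalue (adjacencyMatrix G) μ → μ ≤ ρ

------------------------------------------------------------------------
-- H-factors

data DegreeSet : Set where
  ⟨1⟩ ⟨0,2⟩ : DegreeSet

⟦_⟧ : DegreeSet → List ℕ
⟦ ⟨1⟩ ⟧   = 1 ∷ []
⟦ ⟨0,2⟩ ⟧ = 0 ∷ 2 ∷ []

is⟨1⟩ : DegreeSet → Bool
is⟨1⟩ ⟨1⟩   = true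
is⟨1⟩ ⟨0,2⟩ = false

H⁻¹⟨1⟩ : ∀ {n} → (Fin n → DegreeSet) → Subset n
H⁻¹⟨1⟩ H = tabulate (λ v → is⟨1⟩ (H v))

record Factor {n} (G : Graph n) (H : Fin n → DegreeSet) : Set where
  field
    F        : Graph n
    subgraph : ∀ u v → Adj F u v → Adj G u v
    degrees  : ∀ v → degree F v ∈ ⟦ H v ⟧

{-# OPTIONS --safe #-}
-- A Hamiltonian path yields all the factors at once: walk along it and keep an
-- edge exactly when an odd number of ⟨1⟩-vertices has been passed.  Adding an
-- edge between vertices of degree sum at least n - 1 does not create
-- traceability (Bondy-Chvátal), so G may be replaced by its closure.  In a closed
-- non-traceable graph either there are many vertices of low degree, and an
-- explicit positive X with A X ≤ (n - 4) X exists, or all but three vertices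
-- form a clique.  In the latter case 1-binding, i.e. Hall's condition for
-- neighbourhoods, leaves only subgraphs of K₁ ∨ (K_{n-4} ∪ K₂ ∪ K₁) and cliques
-- with three pendant vertices at distinct neighbours.
--
-- On the spectral side, K₁ ∨ (K_{n-4} ∪ K₂ ∪ K₁) has an eigenvalue μ > n - 4,
-- found by bisection, so ρ(G) ≥ μ.  Pairing |y|, for y an eigenvector of ρ(G),
-- with a positive X such that A X ≤ μ X shows that equality holds in every row:
-- where it is strict y vanishes, and zeros of y spread along edges.  This
-- excludes the graphs with a test vector, the proper connected subgraphs of
-- K₁ ∨ (K_{n-4} ∪ K₂ ∪ K₁), and the cliques with three pendants.
module Submission where

import Defs
open import Data.Bool.Base using (Bool; true; false; if_then_else_; not; _∧_; _xor_)
import Data.Bool.Properties as Bool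
open import Data.Empty using (⊥; ⊥-elim)
open import Data.Fin.Base using (Fin; zero; suc; splitAt; _↑ˡ_; _↑ʳ_)
import Data.Fin.Properties as Fin
open import Data.List.Base as List using (List; []; _∷_; _++_; _ʳ++_; length; lookup; allFin; filter; map)
import Data.List.Properties as List
open import Data.List.Relation.Binary.Permutation.Propositional
  using (_↭_; ↭-refl; ↭-sym; ↭-trans; ↭-reflexive; ↭⇒↭ₛ)
import Data.List.Relation.Binary.Permutation.Propositional.Properties as Perm
import Data.List.Relation.Binary.Permutation.Setoid.Properties as PermS
open import Data.List.Relation.Unary.All as All using (All; []; _∷_)
open import Data.List.Relation.Unary.AllPairs using ([]; _∷_)
open import Data.List.Relation.Unary.Any using (here; there)
open import Data.List.Relation.Unary.Linked using (Linked; []; [-]; _∷_)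
open import Data.List.Relation.Unary.Unique.Propositional using (Unique)
import Data.List.Relation.Unary.Unique.Propositional.Properties as Unique
open import Data.Nat.Base as ℕ using (ℕ; zero; suc)
import Data.Nat.Properties as ℕ
open import Data.Product.Base using (∃; ∃-syntax; _,_; _×_; proj₁; proj₂)
open import Data.Sum.Base as Sum using (_⊎_; inj₁; inj₂)
open import Function.Base using (_∘_; const)
open import Relation.Binary.PropositionalEquality hiding ([_])
open import Relation.Nullary using (¬_; Dec; yes; no; does; contradiction)
open import Relation.Nullary.Decidable using (dec-true; dec-false; dec⇒maybe; _×-dec_; _⊎-dec_; ¬?; decidable-stable)

-- The order of real numbers is undecidable here and eigenvectors are known only through Cauchy
-- sequences, so no Perron vector of G is constructed. Inequalities are proved for the rational
-- terms at one index, and only errors tending to 0 are passed to the limit. This asks for test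
-- vectors that satisfy their inequalities exactly at each index, and for a strictness that is a
-- fixed rational. The closure of G comes with no spectral radius of its own. What passes to it is
-- the absence of objects: a test vector, an embedding or a triple of pendants found in a larger
-- graph is one for G too, as deleting edges only lowers A X and shrinks neighbourhoods. Hence the
-- spectral hypothesis is first turned into the prohibitions of `Good`. A connected graph that
-- properly contains the complete graph on n - 3 vertices has spectral radius above n - 4, so no
-- vector with A X at most (n - 4) X can exclude it. This is why the last two families need weights
-- that depend on μ.

-- Finite sums of natural numbers and Boolean indicators.

module Counting where

  open Defs hiding (_+_; _*_; _≤_; _≈_; sum)
  open import Data.Fin.Subset using (∣_∣)
  open import Data.Nat.Base
  open import Data.Nat.ListAction using () renaming (sum to sumList)
  open import Data.Nat.Properties
  open import Algebra.Properties.Semiring.Sum +-*-semiring public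
    using (sum-cong-≗; ∑-distrib-+; ∑-comm; *-distribˡ-sum; *-distribʳ-sum) renaming (sum to ∑)
  open import Data.Vec.Base using (tabulate)
  open import Function.Base using (id)

  infix 5 _==_

  _==_ : ∀ {n} → Fin n → Fin n → Bool
  i == j = does (i Fin.≟ j)

  ==-refl : ∀ {n} (i : Fin n) → (i == i) ≡ true
  ==-refl i = dec-true (i Fin.≟ i) refl

  ==-≢ : ∀ {n} {i j : Fin n} → i ≢ j → (i == j) ≡ false
  ==-≢ {i = i} {j} = dec-false (i Fin.≟ j)

  𝟙 : Bool → ℕ
  𝟙 true  = 1
  𝟙 false = 0

  𝟙≤1 : ∀ b → 𝟙 b ≤ 1
  𝟙≤1 true  = ≤-refl
  𝟙≤1 false = z≤n

  ∑-mono-≤ : ∀ {n} {f g : Fin n → ℕ} → (∀ i → f i ≤ g i) → ∑ f ≤ ∑ g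
  ∑-mono-≤ {zero}  f≤g = z≤n
  ∑-mono-≤ {suc n} f≤g = +-mono-≤ (f≤g zero) (∑-mono-≤ (f≤g ∘ suc))

  ∑-const : ∀ n c → ∑ {n} (λ _ → c) ≡ n * c
  ∑-const zero    c = refl
  ∑-const (suc n) c = cong (c +_) (∑-const n c)

  ∑-δ : ∀ {n} (i : Fin n) (f : Fin n → ℕ) → ∑ (λ j → 𝟙 (i == j) * f j) ≡ f i
  ∑-δ {suc n} zero f = begin
    f zero + 0 + ∑ {n} (λ _ → 0) ≡⟨ cong₂ _+_ (+-identityʳ _) (trans (∑-const n 0) (*-zeroʳ n)) ⟩
    f zero + 0                   ≡⟨ +-identityʳ _ ⟩
    f zero                       ∎
    where open ≡-Reasoning
  ∑-δ {suc n} (suc i) f = ∑-δ i (f ∘ suc)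

  ∑-𝟙== : ∀ {n} (i : Fin n) → ∑ (λ j → 𝟙 (i == j)) ≡ 1
  ∑-𝟙== i = trans (sum-cong-≗ (λ j → sym (*-identityʳ (𝟙 (i == j))))) (∑-δ i (λ _ → 1))

  term≤∑ : ∀ {n} (f : Fin n → ℕ) i → f i ≤ ∑ f
  term≤∑ f zero    = m≤m+n _ _
  term≤∑ f (suc i) = ≤-trans (term≤∑ (f ∘ suc) i) (m≤n+m _ _)

  ∑<∑⇒∃< : ∀ {n} (f g : Fin n → ℕ) → ∑ f < ∑ g → ∃ λ i → f i < g i
  ∑<∑⇒∃< f g lt with Fin.any? (λ i → f i <? g i)
  ... | yes found = found
  ... | no  none  = contradiction lt (≤⇒≯ (∑-mono-≤ (λ i → ≮⇒≥ (λ fi<gi → none (i , fi<gi)))))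

  ∣tabulate∣ : ∀ {n} (p : Fin n → Bool) → ∣ tabulate p ∣ ≡ ∑ (𝟙 ∘ p)
  ∣tabulate∣ {zero}  p = refl
  ∣tabulate∣ {suc n} p with p zero
  ... | true  = cong suc (∣tabulate∣ (p ∘ suc))
  ... | false = ∣tabulate∣ (p ∘ suc)

  sumList-allFin : ∀ {n} (f : Fin n → ℕ) → sumList (List.map f (allFin n)) ≡ ∑ f
  sumList-allFin f = trans (cong sumList (List.map-tabulate id f)) (go f)
    where
    go : ∀ {n} (f : Fin n → ℕ) → sumList (List.tabulate f) ≡ ∑ f
    go {zero}  f = refl
    go {suc n} f = cong (f zero +_) (go (f ∘ suc))

-- Hamiltonian paths and adding an edge of large degree sum.

module Paths where

  open Defs hiding (_+_; _*_; _≤_; _≈_; sum)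
  open Counting
  open import Data.Bool.Base using () renaming (_∨_ to _or_)
  open import Data.Nat.Base
  open import Data.Nat.ListAction using () renaming (sum to sumList)
  import Data.Nat.ListAction.Properties as ListAction
  open import Data.Nat.Properties
  open import Data.Nat.Tactic.RingSolver using (solve-∀)

  A : ∀ {n} → Graph n → Fin n → Fin n → ℕ
  A G x y = 𝟙 (adj G x y)

  deg : ∀ {n} → Graph n → Fin n → ℕ
  deg G x = ∑ (A G x)

  degree≡deg : ∀ {n} (G : Graph n) x → degree G x ≡ deg G x
  degree≡deg G x = ∣tabulate∣ (adj G x)

  A-sym : ∀ {n} (G : Graph n) x y → A G x y ≡ A G y x
  A-sym G x y = cong 𝟙 (adj-sym G x y)

  A-irrefl : ∀ {n} (G : Graph n) x → A G x x ≡ 0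
  A-irrefl G x = cong 𝟙 (no-loop G x)

  Adj-sym : ∀ {n} (G : Graph n) {x y} → Adj G x y → Adj G y x
  Adj-sym G {x} {y} xy = trans (adj-sym G y x) xy

  Adj⇒≢ : ∀ {n} (G : Graph n) {x y} → Adj G x y → x ≢ y
  Adj⇒≢ G {x} xy refl with () ← trans (sym xy) (no-loop G x)

  ¬Adj⇒≡false : ∀ {n} (G : Graph n) {x y} → ¬ Adj G x y → adj G x y ≡ false
  ¬Adj⇒≡false G = Bool.¬-not

  module _ {n} (G : Graph n) {u v : Fin n} (u≢v : u ≢ v) where

    private
      new : Fin n → Fin n → Bool
      new x y = (u == x) ∧ (v == y) or (v == x) ∧ (u == y)

    addEdge : Graph n
    addEdge .adj     x y = adj G x y or new x y
    addEdge .adj-sym x y = cong₂ _or_ (adj-sym G x y)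
      (trans (Bool.∨-comm ((u == x) ∧ (v == y)) _)
             (cong₂ _or_ (Bool.∧-comm (v == x) _) (Bool.∧-comm (u == x) _)))
    addEdge .no-loop x rewrite no-loop G x with u Fin.≟ x | v Fin.≟ x
    ... | yes refl | yes refl = contradiction refl u≢v
    ... | yes _    | no _     = refl
    ... | no _     | yes _    = refl
    ... | no _     | no _     = refl

    ⊆addEdge : ∀ {x y} → Adj G x y → Adj addEdge x y
    ⊆addEdge {x} {y} xy = cong (_or new x y) xy

    addEdge⁻ : ∀ {x y} → Adj addEdge x y → ¬ Adj G x y → (x ≡ u × y ≡ v) ⊎ (x ≡ v × y ≡ u)
    addEdge⁻ {x} {y} xy ¬xy rewrite ¬Adj⇒≡false G ¬xy
      with u Fin.≟ x | v Fin.≟ y | v Fin.≟ x | u Fin.≟ y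
    ... | yes p | yes q | _     | _     = inj₁ (sym p , sym q)
    ... | no  _ | _     | yes p | yes q = inj₂ (sym p , sym q)
    ... | yes _ | no  _ | yes p | yes q = inj₂ (sym p , sym q)
    ... | yes _ | no _  | yes _ | no _ with () ← xy
    ... | yes _ | no _  | no _  | _ with () ← xy
    ... | no _  | _     | yes _ | no _ with () ← xy
    ... | no _  | _     | no _  | _ with () ← xy

    module _ (uv∉G : adj G u v ≡ false) where

      A-addEdge : ∀ x y → A addEdge x y ≡
        A G x y + (𝟙 (u == x) * 𝟙 (v == y) + 𝟙 (v == x) * 𝟙 (u == y))
      A-addEdge x y with u Fin.≟ x | v Fin.≟ y | v Fin.≟ x | u Fin.≟ y
      ... | yes refl | _        | yes refl | _        = contradiction refl u≢v
      ... | _        | yes refl | _        | yes refl = contradiction refl u≢v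
      ... | yes refl | yes refl | no _     | no _     rewrite uv∉G = refl
      ... | no _     | no _     | yes refl | yes refl rewrite adj-sym G v u | uv∉G = refl
      ... | yes _    | no _     | no _     | yes _    rewrite Bool.∨-identityʳ (adj G x y) = sym (+-identityʳ _)
      ... | yes _    | no _     | no _     | no _     rewrite Bool.∨-identityʳ (adj G x y) = sym (+-identityʳ _)
      ... | no _     | yes _    | no _     | no _     rewrite Bool.∨-identityʳ (adj G x y) = sym (+-identityʳ _)
      ... | no _     | yes _    | yes _    | no _     rewrite Bool.∨-identityʳ (adj G x y) = sym (+-identityʳ _)
      ... | no _     | no _     | yes _    | no _     rewrite Bool.∨-identityʳ (adj G x y) = sym (+-identityʳ _)
      ... | no _     | no _     | no _     | yes _    rewrite Bool.∨-identityʳ (adj G x y) = sym (+-identityʳ _)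
      ... | no _     | no _     | no _     | no _     rewrite Bool.∨-identityʳ (adj G x y) = sym (+-identityʳ _)

      deg-addEdge : ∀ x → deg addEdge x ≡ deg G x + (𝟙 (u == x) + 𝟙 (v == x))
      deg-addEdge x = begin
        deg addEdge x
          ≡⟨ sum-cong-≗ (A-addEdge x) ⟩
        ∑ (λ y → A G x y + (𝟙 (u == x) * 𝟙 (v == y) + 𝟙 (v == x) * 𝟙 (u == y)))
          ≡⟨ ∑-distrib-+ (A G x) _ ⟩
        deg G x + ∑ (λ y → 𝟙 (u == x) * 𝟙 (v == y) + 𝟙 (v == x) * 𝟙 (u == y))
          ≡⟨ cong (deg G x +_) (∑-distrib-+ (λ y → 𝟙 (u == x) * 𝟙 (v == y)) _) ⟩
        deg G x + (∑ (λ y → 𝟙 (u == x) * 𝟙 (v == y)) + ∑ (λ y → 𝟙 (v == x) * 𝟙 (u == y)))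
          ≡⟨ cong (deg G x +_) (cong₂ _+_ (once (𝟙 (u == x)) v) (once (𝟙 (v == x)) u)) ⟩
        deg G x + (𝟙 (u == x) + 𝟙 (v == x)) ∎
        where
        open ≡-Reasoning
        once : ∀ c z → ∑ (λ y → c * 𝟙 (z == y)) ≡ c
        once c z = trans (sym (*-distribˡ-sum c (λ y → 𝟙 (z == y))))
                         (trans (cong (c *_) (∑-𝟙== z)) (*-identityʳ c))

  -- Being a permutation of `allFin n` says at once that the path is spanning and that it repeats no
  -- vertex, so rearranging a path is a chain of permutations.
  HamPath : ∀ {n} → Graph n → Set
  HamPath {n} G = ∃ λ P → Linked (Adj G) P × P ↭ allFin n

  deg-↭ : ∀ {n} (G : Graph n) x {P} → P ↭ allFin n → sumList (map (A G x) P) ≡ deg G x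
  deg-↭ G x P↭ = trans (ListAction.sum-↭ (Perm.map⁺ (A G x) P↭)) (sumList-allFin (A G x))

  -- `ʳ++` reverses its first argument, so the first path is walked backwards and arrives at x,
  -- where the edge to y continues it.
  join : ∀ {n} (G : Graph n) {x y xs ys} → Linked (Adj G) (x ∷ xs) → Adj G x y →
         Linked (Adj G) (y ∷ ys) → Linked (Adj G) ((x ∷ xs) ʳ++ (y ∷ ys))
  join G [-]       xy ys = xy ∷ ys
  join G (xz ∷ zs) xy ys = join G zs (Adj-sym G xz) (xy ∷ ys)

  -- Along a path starting at v, either some consecutive p, q satisfy u ~ p and
  -- v ~ q (or u is adjacent to the last vertex), and the path can be rotated to
  -- start next to u, or each vertex counts at most once among the neighbours.
  module _ {n} (G : Graph n) (u v : Fin n) where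

    rotate : ∀ p M B →
      (∀ {q C} → Adj G v q → Linked (Adj G) (q ∷ C) → Linked (Adj G) ((p ∷ M) ++ q ∷ C)) →
      Linked (Adj G) (p ∷ M) → Linked (Adj G) (p ∷ B) →
      (∃ λ r → ∃ λ R → Adj G u r × Linked (Adj G) (r ∷ R) × r ∷ R ↭ (p ∷ M) ++ B) ⊎
      sumList (map (A G u) (p ∷ B)) + sumList (map (A G v) B) ≤ length B
    rotate p M [] ext pM pB with adj G u p in up
    ... | true  = inj₁ (p , M , up , pM , ↭-reflexive (sym (List.++-identityʳ (p ∷ M))))
    ... | false = inj₂ z≤n
    rotate p M (q ∷ B) ext pM (pq ∷ qB)
      with adj G u p in up | adj G v q in vq
         | rotate q (p ∷ M) B (λ vr rC → Adj-sym G pq ∷ ext vr rC) (Adj-sym G pq ∷ pM) qB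
    ... | true  | true  | _ = inj₁ (p , M ++ q ∷ B , up , ext vq qB , ↭-refl)
    ... | _     | _     | inj₁ (r , R , ur , rR , perm) =
      inj₁ (r , R , ur , rR , ↭-trans perm (↭-sym (Perm.shift q (p ∷ M) B)))
    ... | true  | false | inj₂ le = inj₂ (s≤s le)
    ... | false | false | inj₂ le = inj₂ (m≤n⇒m≤1+n le)
    ... | false | true  | inj₂ le =
      inj₂ (≤-trans (≤-reflexive (+-suc (sumList (map (A G u) (q ∷ B))) _)) (s≤s le))

  module _ {n} (G : Graph n) where

    -- Ore's crossing count, for a spanning path whose edge between s and t has been removed. If
    -- neither piece can be rotated to start next to the end of the other, the two counts of
    -- `rotate` add up to deg s + deg t ≤ |S| + |T| = n - 2.
    bridge : ∀ s t S T → adj G s t ≡ false → n ≤ suc (deg G s + deg G t) →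
      Linked (Adj G) (s ∷ S) → Linked (Adj G) (t ∷ T) → (s ∷ S) ++ (t ∷ T) ↭ allFin n →
      HamPath G
    bridge s t S T st big sS tT perm
      with rotate G s t t [] T (λ tq qC → tq ∷ qC) [-] tT
         | rotate G t s s [] S (λ sq qC → sq ∷ qC) [-] sS
    ... | inj₁ (r , R , sr , rR , rR↭) | _ =
      (s ∷ S) ʳ++ (r ∷ R) , join G sS sr rR ,
      ↭-trans (↭-sym (Perm.++↭ʳ++ (s ∷ S) (r ∷ R))) (↭-trans (Perm.++⁺ˡ (s ∷ S) rR↭) perm)
    ... | _ | inj₁ (r , R , tr , rR , rR↭) =
      (t ∷ T) ʳ++ (r ∷ R) , join G tT tr rR ,
      ↭-trans (↭-sym (Perm.++↭ʳ++ (t ∷ T) (r ∷ R)))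
        (↭-trans (Perm.++⁺ˡ (t ∷ T) rR↭) (↭-trans (Perm.++-comm (t ∷ T) (s ∷ S)) perm))
    ... | inj₂ le₁ | inj₂ le₂ = contradiction big (<⇒≱ small)
      where
      σ : Fin n → List (Fin n) → ℕ
      σ x xs = sumList (map (A G x) xs)

      σ-all : ∀ x → deg G x ≡ σ x (s ∷ S) + σ x (t ∷ T)
      σ-all x = trans (sym (deg-↭ G x perm))
        (trans (cong sumList (List.map-++ (A G x) (s ∷ S) (t ∷ T))) (ListAction.sum-++ (map (A G x) (s ∷ S)) _))

      n≡ : suc (length S) + suc (length T) ≡ n
      n≡ = trans (sym (List.length-++ (s ∷ S)))
          (trans (Perm.↭-length perm) (List.length-tabulate (λ i → i)))

      regroup : ∀ a b c d → (a + b) + (c + d) ≡ (b + d) + (c + a)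
      regroup = solve-∀

      small : suc (deg G s + deg G t) < n
      small = begin-strict
        suc (deg G s + deg G t)
          ≡⟨ cong suc (cong₂ _+_ (trans (σ-all s) (cong (λ z → (z + σ s S) + σ s (t ∷ T)) (A-irrefl G s)))
                                 (trans (σ-all t) (cong (λ z → σ t (s ∷ S) + (z + σ t T)) (A-irrefl G t)))) ⟩
        suc ((σ s S + σ s (t ∷ T)) + (σ t (s ∷ S) + σ t T))
          ≡⟨ cong suc (regroup (σ s S) _ _ _) ⟩
        suc ((σ s (t ∷ T) + σ t T) + (σ t (s ∷ S) + σ s S))
          ≤⟨ s≤s (+-mono-≤ le₁ le₂) ⟩
        suc (length T + length S)
          ≡⟨ cong suc (+-comm (length T) _) ⟩
        suc (length S + length T)
          <⟨ ≤-refl ⟩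
        suc (suc (length S + length T))
          ≡⟨ cong suc (+-suc (length S) (length T)) ⟨
        suc (length S) + suc (length T)
          ≡⟨ n≡ ⟩
        n ∎
        where open ≤-Reasoning

    module _ {u v : Fin n} (u≢v : u ≢ v) where

      private
        G⁺ : Graph n
        G⁺ = addEdge G u≢v

      -- The added edge has p as an end, and p does not occur in the list.
      avoid : ∀ {p xs} → p ≡ u ⊎ p ≡ v → All (p ≢_) xs → Linked (Adj G⁺) xs → Linked (Adj G) xs
      avoid _ _ [] = []
      avoid _ _ [-] = [-]
      avoid {p} p∈ (p≢x ∷ p≢y ∷ p≢) (_∷_ {x} {y} xy ys) with adj G x y Bool.≟ true
      ... | yes xy∈G = xy∈G ∷ avoid p∈ (p≢y ∷ p≢) ys
      ... | no  xy∉G with addEdge⁻ G u≢v xy xy∉G | p∈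
      ...   | inj₁ (refl , refl) | inj₁ refl = contradiction refl p≢x
      ...   | inj₁ (refl , refl) | inj₂ refl = contradiction refl p≢y
      ...   | inj₂ (refl , refl) | inj₁ refl = contradiction refl p≢y
      ...   | inj₂ (refl , refl) | inj₂ refl = contradiction refl p≢x

      -- The prefix is kept reversed, as p ∷ M, so that a cut leaves two paths that start at the two
      -- ends of the removed edge. The first edge outside G must be the added one; since p does not
      -- recur, the remainder lies in G by `avoid`.
      cut : ∀ p M R → Linked (Adj G) (p ∷ M) → Linked (Adj G⁺) (p ∷ R) → Unique (p ∷ R) →
        (∃ λ P → Linked (Adj G) P × P ↭ (p ∷ M) ++ R) ⊎
        (∃ λ s → ∃ λ t → ∃ λ S → ∃ λ T → ((s ≡ u × t ≡ v) ⊎ (s ≡ v × t ≡ u)) ×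
          Linked (Adj G) (s ∷ S) × Linked (Adj G) (t ∷ T) × (s ∷ S) ++ (t ∷ T) ↭ (p ∷ M) ++ R)
      cut p M [] pM _ _ = inj₁ (p ∷ M , pM , ↭-reflexive (sym (List.++-identityʳ (p ∷ M))))
      cut p M (q ∷ R) pM (pq ∷ qR) (p∉ ∷ uniq) with adj G p q Bool.≟ true
      ... | no pq∉G = inj₂ (p , q , M , R , ends , pM , avoid (end ends) p∉ qR , ↭-refl)
        where
        ends : (p ≡ u × q ≡ v) ⊎ (p ≡ v × q ≡ u)
        ends = addEdge⁻ G u≢v pq pq∉G
        end : (p ≡ u × q ≡ v) ⊎ (p ≡ v × q ≡ u) → p ≡ u ⊎ p ≡ v
        end (inj₁ (p≡u , _)) = inj₁ p≡u
        end (inj₂ (p≡v , _)) = inj₂ p≡v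
      ... | yes pq∈G with cut q (p ∷ M) R (Adj-sym G pq∈G ∷ pM) qR uniq
      ...   | inj₁ (P , linked , perm) =
        inj₁ (P , linked , ↭-trans perm (↭-sym (Perm.shift q (p ∷ M) R)))
      ...   | inj₂ (s , t , S , T , ends , sS , tT , perm) =
        inj₂ (s , t , S , T , ends , sS , tT , ↭-trans perm (↭-sym (Perm.shift q (p ∷ M) R)))

      bondyChvátal : adj G u v ≡ false → n ≤ suc (deg G u + deg G v) → HamPath G⁺ → HamPath G
      bondyChvátal uv∉G big ([] , _ , perm) = [] , [] , perm
      bondyChvátal uv∉G big (p ∷ R , linked , perm)
        with cut p [] R [-] linked (PermS.Unique-resp-↭ (setoid (Fin n)) (↭⇒↭ₛ (↭-sym perm)) (Unique.allFin⁺ n))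
      ... | inj₁ (P , linked′ , perm′) = P , linked′ , ↭-trans perm′ perm
      ... | inj₂ (s , t , S , T , inj₁ (refl , refl) , sS , tT , perm′) =
        bridge s t S T uv∉G big sS tT (↭-trans perm′ perm)
      ... | inj₂ (s , t , S , T , inj₂ (refl , refl) , sS , tT , perm′) =
        bridge s t S T (trans (adj-sym G v u) uv∉G)
          (≤-trans big (s≤s (≤-reflexive (+-comm (deg G u) (deg G v))))) sS tT (↭-trans perm′ perm)

-- From a Hamiltonian path to a factor.

module PathFactor where

  open Defs hiding (_+_; _*_; _≤_; _≈_; sum)
  open Counting
  open Paths
  open import Data.Fin.Subset using (∣_∣)
  open import Data.List.Membership.Propositional using (_∈_)
  open import Data.List.Membership.Propositional.Properties using (∈-allFin)
  open import Data.Nat.Base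
  open import Data.Nat.Divisibility using (_∣_; ∣m+n∣m⇒∣n; ∣-refl; ∣⇒≤)
  open import Data.Nat.ListAction using () renaming (sum to sumList)
  import Data.Nat.ListAction.Properties as ListAction
  open import Data.Nat.Properties

  -- The leaving edge has state `s xor is⟨1⟩ h`: a ⟨1⟩-vertex flips the state, which gives degree 1,
  -- and a ⟨0,2⟩-vertex keeps it, which gives degree 0 or 2. The trailing 0 is what
  -- `𝟙 (p == x) * 𝟙 s` leaves behind at x = p.
  closed∈ : ∀ h s → s xor is⟨1⟩ h ≡ false → 𝟙 s + 0 ∈ ⟦ h ⟧
  closed∈ ⟨1⟩   true  _ = here refl
  closed∈ ⟨0,2⟩ false _ = here refl

  open∈ : ∀ h s → s xor is⟨1⟩ h ≡ true → suc (𝟙 s + 0) ∈ ⟦ h ⟧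
  open∈ ⟨1⟩   false _ = here refl
  open∈ ⟨0,2⟩ true  _ = there (here refl)

  module _ {n} (G : Graph n) (H : Fin n → DegreeSet) where

    private
      T : Fin n → Bool
      T x = is⟨1⟩ (H x)

    parityAlong : Bool → List (Fin n) → Bool
    parityAlong s []      = s
    parityAlong s (p ∷ P) = parityAlong (s xor T p) P

    -- No edge leaves the last vertex, so the final state has to be false. Each ⟨1⟩-vertex flips the
    -- state, and s itself is counted like one more flip.
    even⇒parityAlong : ∀ s P → 2 ∣ 𝟙 s + sumList (map (𝟙 ∘ T) P) → parityAlong s P ≡ false
    even⇒parityAlong false []      _  = refl
    even⇒parityAlong true  []      2∣1 with s≤s () ← ∣⇒≤ 2∣1
    even⇒parityAlong s (p ∷ P) 2∣ with s | T p
    ... | false | false = even⇒parityAlong false P 2∣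
    ... | false | true  = even⇒parityAlong true P 2∣
    ... | true  | false = even⇒parityAlong true P 2∣
    ... | true  | true  = even⇒parityAlong false P (∣m+n∣m⇒∣n 2∣ ∣-refl)

    empty : Graph n
    empty .adj _ _     = false
    empty .adj-sym _ _ = refl
    empty .no-loop _   = refl

    deg-empty : ∀ x → deg empty x ≡ 0
    deg-empty _ = trans (∑-const n 0) (*-zeroʳ n)

    -- s says whether the edge entering p is used; the edge leaving p is used
    -- exactly when an odd number of ⟨1⟩-vertices has been passed.
    follow : ∀ s p R → Linked (Adj G) (p ∷ R) → Unique (p ∷ R) → parityAlong s (p ∷ R) ≡ false →
      ∃ λ F → (∀ x y → Adj F x y → Adj G x y) ×
        (∀ {x} → x ∈ p ∷ R → deg F x + 𝟙 (p == x) * 𝟙 s ∈ ⟦ H x ⟧) ×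
        (∀ {x} → All (x ≢_) (p ∷ R) → deg F x ≡ 0)
    follow s p [] _ _ closed = empty , (λ _ _ ()) , inPath , λ {x} _ → deg-empty x
      where
      inPath : ∀ {x} → x ∈ p ∷ [] → deg empty x + 𝟙 (p == x) * 𝟙 s ∈ ⟦ H x ⟧
      inPath (here refl) rewrite deg-empty p | ==-refl p = closed∈ (H p) s closed
    follow s p (q ∷ R) (pq ∷ qR) (p∉ ∷ uniq) closed with s xor T p in out | follow (s xor T p) q R qR uniq closed
    ... | false | F , F⊆G , inPath , offPath = F , F⊆G , inPath′ , λ { (_ ∷ x∉) → offPath x∉ }
      where
      inPath′ : ∀ {x} → x ∈ p ∷ q ∷ R → deg F x + 𝟙 (p == x) * 𝟙 s ∈ ⟦ H x ⟧
      inPath′ (here refl) rewrite offPath p∉ | ==-refl p = closed∈ (H p) s out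
      inPath′ {x} (there x∈) rewrite ==-≢ (All.lookup p∉ x∈) =
        subst (λ z → deg F x + z ∈ ⟦ H x ⟧) (*-zeroʳ (𝟙 (q == x))) (inPath x∈)
    ... | true | F , F⊆G , inPath , offPath = addEdge F p≢q , F⁺⊆G , inPath′ , offPath′
      where
      p≢q : p ≢ q
      p≢q = Adj⇒≢ G pq

      -- p is off the path q ∷ R, so its degree in F is still 0.
      pq∉F : adj F p q ≡ false
      pq∉F with adj F p q | term≤∑ (A F p) q
      ... | false | _ = refl
      ... | true  | le rewrite offPath p∉ with () ← le

      F⁺⊆G : ∀ x y → Adj (addEdge F p≢q) x y → Adj G x y
      F⁺⊆G x y xy with adj F x y Bool.≟ true
      ... | yes xy∈F = F⊆G x y xy∈F
      ... | no  xy∉F with addEdge⁻ F p≢q xy xy∉F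
      ...   | inj₁ (refl , refl) = pq
      ...   | inj₂ (refl , refl) = Adj-sym G pq

      inPath′ : ∀ {x} → x ∈ p ∷ q ∷ R → deg (addEdge F p≢q) x + 𝟙 (p == x) * 𝟙 s ∈ ⟦ H x ⟧
      inPath′ (here refl) rewrite deg-addEdge F p≢q pq∉F p | offPath p∉ | ==-refl p | ==-≢ (≢-sym p≢q) =
        open∈ (H p) s out
      inPath′ {x} (there x∈) rewrite deg-addEdge F p≢q pq∉F x | ==-≢ (All.lookup p∉ x∈) =
        subst (_∈ ⟦ H x ⟧) (trans (cong (deg F x +_) (*-identityʳ (𝟙 (q == x))))
                                  (sym (+-identityʳ _))) (inPath x∈)

      offPath′ : ∀ {x} → All (x ≢_) (p ∷ q ∷ R) → deg (addEdge F p≢q) x ≡ 0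
      offPath′ {x} (x≢p ∷ x≢q ∷ x∉)
        rewrite deg-addEdge F p≢q pq∉F x | ==-≢ (≢-sym x≢p) | ==-≢ (≢-sym x≢q) | offPath (x≢q ∷ x∉) = refl

    hamPath⇒factor : HamPath G → 2 ∣ ∣ H⁻¹⟨1⟩ H ∣ → Factor G H
    hamPath⇒factor ([] , _ , perm) _ = record
      { F        = empty
      ; subgraph = λ _ _ ()
      ; degrees  = λ v → contradiction (Perm.∈-resp-↭ (↭-sym perm) (∈-allFin v)) λ ()
      }
    hamPath⇒factor (p ∷ R , linked , perm) 2∣ = record
      { F        = F
      ; subgraph = F⊆G
      ; degrees  = λ v → subst (_∈ ⟦ H v ⟧)
          (trans (cong (deg F v +_) (*-zeroʳ (𝟙 (p == v)))) (trans (+-identityʳ _) (sym (degree≡deg F v))))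
          (inPath (Perm.∈-resp-↭ (↭-sym perm) (∈-allFin v)))
      }
      where
      even : 2 ∣ sumList (map (𝟙 ∘ T) (p ∷ R))
      even = subst (2 ∣_) (sym (trans (ListAction.sum-↭ (Perm.map⁺ (𝟙 ∘ T) perm))
               (trans (sumList-allFin (𝟙 ∘ T)) (sym (∣tabulate∣ T))))) 2∣

      built = follow false p R linked (PermS.Unique-resp-↭ (setoid (Fin n)) (↭⇒↭ₛ (↭-sym perm)) (Unique.allFin⁺ n))
                (even⇒parityAlong false (p ∷ R) even)
      F = proj₁ built
      F⊆G = proj₁ (proj₂ built)
      inPath : ∀ {x} → x ∈ p ∷ R → deg F x + 𝟙 (p == x) * 0 ∈ ⟦ H x ⟧
      inPath = proj₁ (proj₂ (proj₂ built))

-- Natural number vectors X with A X at most (n - 4) X.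

module TestVectors where

  open Defs hiding (_+_; _*_; _≤_; _≈_; sum)
  open Counting
  open Paths
  open import Data.Nat.Base
  open import Data.Nat.Properties
  open import Data.Nat.Tactic.RingSolver using (solve-∀)

  -- Everything used about the graph, with m = n - 4; supergraphs on the same
  -- vertices inherit it, so it survives the closure.
  record Good {n} (m : ℕ) (G : Graph n) : Set where
    field
      escape : ∀ (S : Fin n → Bool) {x y} → S x ≡ true → S y ≡ false →
        ∃[ s ] ∃[ t ] (S s ≡ true × S t ≡ false × Adj G s t)
      hall : ∀ (S D : Fin n → Bool) → ∑ (𝟙 ∘ D) < ∑ (𝟙 ∘ S) →
        ∃[ s ] ∃[ x ] (S s ≡ true × D x ≡ false × Adj G s x)
      noTestVector : ∀ (X : Fin n → ℕ) → (∀ i → 1 ≤ X i) → (∀ i → ∑ (λ j → A G i j * X j) ≤ m * X i) → ⊥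
      notExtremal : ∀ {c a b d} → c ≢ a → c ≢ b → c ≢ d → a ≢ b → a ≢ d → b ≢ d →
        (∀ {y} → Adj G d y → y ≡ c) → (∀ {y} → Adj G a y → y ≡ b ⊎ y ≡ c) →
        (∀ {y} → Adj G b y → y ≡ a ⊎ y ≡ c) → ⊥
      noThreePendants : ∀ (p c : Fin 3 → Fin n) →
        (∀ {l l′} → p l ≡ p l′ → l ≡ l′) → (∀ {l l′} → c l ≡ c l′ → l ≡ l′) → (∀ l l′ → p l ≢ c l′) →
        (∀ l {y} → Adj G (p l) y → y ≡ c l) → ⊥

  A-mono : ∀ {n} {G G′ : Graph n} → (∀ {x y} → Adj G x y → Adj G′ x y) → ∀ x y → A G x y ≤ A G′ x y
  A-mono {G = G} G⊆G′ x y with adj G x y in xy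
  ... | false = z≤n
  ... | true rewrite G⊆G′ xy = ≤-refl

  Good-mono : ∀ {n m} {G G′ : Graph n} → (∀ {x y} → Adj G x y → Adj G′ x y) → Good m G → Good m G′
  Good-mono {G = G} {G′} ⊆ good = record
    { escape = λ S Sx Sy → let s , t , Ss , St , st = escape S Sx Sy in s , t , Ss , St , ⊆ st
    ; hall = λ S D lt → let s , x , Ss , Dx , sx = hall S D lt in s , x , Ss , Dx , ⊆ sx
    ; noTestVector = λ X 1≤X le → noTestVector X 1≤X
        (λ i → ≤-trans (∑-mono-≤ (λ j → *-monoˡ-≤ (X j) (A-mono {G = G} {G′} ⊆ i j))) (le i))
    ; notExtremal = λ ca cb cd ab ad bd D A B → notExtremal ca cb cd ab ad bd (D ∘ ⊆) (A ∘ ⊆) (B ∘ ⊆)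
    ; noThreePendants = λ p c p-inj c-inj p≢c pend → noThreePendants p c p-inj c-inj p≢c (λ l → pend l ∘ ⊆)
    }
    where open Good good

  ∑-≤ : ∀ {n} (b : ℕ) {f : Fin n → ℕ} → (∀ i → f i ≤ b) → ∑ f ≤ n * b
  ∑-≤ {n} b {f} f≤b = subst (∑ f ≤_) (∑-const n b) (∑-mono-≤ f≤b)

  A+==≤1 : ∀ {n} (G : Graph n) i j → A G i j + 𝟙 (i == j) ≤ 1
  A+==≤1 G i j with i Fin.≟ j
  ... | yes refl rewrite no-loop G i = ≤-refl
  ... | no  _    rewrite +-identityʳ (A G i j) = 𝟙≤1 (adj G i j)

  module _ {n} (G : Graph n) where

    rowSum : (Fin n → ℕ) → Fin n → ℕ
    rowSum X i = ∑ (λ j → A G i j * X j)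

    -- Entrywise, A + I is at most the all-ones matrix.
    rowSum+X≤∑ : ∀ (X : Fin n → ℕ) i → rowSum X i + X i ≤ ∑ X
    rowSum+X≤∑ X i = begin
      rowSum X i + X i
        ≡⟨ cong (rowSum X i +_) (∑-δ i X) ⟨
      rowSum X i + ∑ (λ j → 𝟙 (i == j) * X j)
        ≡⟨ ∑-distrib-+ (λ j → A G i j * X j) _ ⟨
      ∑ (λ j → A G i j * X j + 𝟙 (i == j) * X j)
        ≤⟨ ∑-mono-≤ (λ j → ≤-trans (≤-reflexive (sym (*-distribʳ-+ (X j) (A G i j) _)))
             (≤-trans (*-monoˡ-≤ (X j) (A+==≤1 G i j)) (≤-reflexive (*-identityˡ (X j))))) ⟩
      ∑ X ∎
      where open ≤-Reasoning

    into : (Fin n → Bool) → Fin n → ℕ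
    into D i = ∑ (λ j → A G i j * 𝟙 (D j))

    into≤deg : ∀ D i → into D i ≤ deg G i
    into≤deg D i = ∑-mono-≤ (λ j → ≤-trans (*-monoʳ-≤ (A G i j) (𝟙≤1 (D j))) (≤-reflexive (*-identityʳ _)))

    into≤∑ : ∀ D i → into D i ≤ ∑ (𝟙 ∘ D)
    into≤∑ D i = ∑-mono-≤ (λ j → ≤-trans (*-monoˡ-≤ (𝟙 (D j)) (𝟙≤1 (adj G i j))) (≤-reflexive (*-identityˡ _)))

    into<deg : ∀ D {i x} → Adj G i x → D x ≡ false → into D i < deg G i
    into<deg D {i} {x} ix x∉D = begin
      suc (into D i)
        ≡⟨ trans (cong suc (sym (+-identityʳ _))) (trans (sym (+-suc (into D i) 0)) (cong (into D i +_) (sym (∑-𝟙== x)))) ⟩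
      into D i + ∑ (λ j → 𝟙 (x == j))
        ≡⟨ ∑-distrib-+ (λ j → A G i j * 𝟙 (D j)) _ ⟨
      ∑ (λ j → A G i j * 𝟙 (D j) + 𝟙 (x == j))
        ≤⟨ ∑-mono-≤ le ⟩
      deg G i ∎
      where
      open ≤-Reasoning
      le : ∀ j → A G i j * 𝟙 (D j) + 𝟙 (x == j) ≤ A G i j
      le j with x Fin.≟ j
      ... | yes refl rewrite ix | x∉D = ≤-refl
      ... | no _ rewrite +-identityʳ (A G i j * 𝟙 (D j)) =
        ≤-trans (*-monoʳ-≤ (A G i j) (𝟙≤1 (D j))) (≤-reflexive (*-identityʳ _))

    module _ (D : Fin n → Bool) (b β : ℕ) (X pen : Fin n → ℕ)
      (X+pen : ∀ j → X j + pen j ≡ b + β * 𝟙 (D j)) where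

      -- The test vectors have the form b + β on D minus a penalty: D collects the heavy vertices,
      -- and the penalty makes local corrections. Adding the row of the penalty restores a
      -- two-valued vector, whose rows depend only on the degree and on the number of neighbours in
      -- D.
      rowSum+pen : ∀ i → rowSum X i + rowSum pen i ≡ b * deg G i + β * into D i
      rowSum+pen i = begin
        rowSum X i + rowSum pen i
          ≡⟨ ∑-distrib-+ (λ j → A G i j * X j) _ ⟨
        ∑ (λ j → A G i j * X j + A G i j * pen j)
          ≡⟨ sum-cong-≗ (λ j → trans (sym (*-distribˡ-+ (A G i j) (X j) (pen j)))
               (trans (cong (A G i j *_) (X+pen j)) (expand (A G i j) b β (𝟙 (D j))))) ⟩
        ∑ (λ j → b * A G i j + β * (A G i j * 𝟙 (D j)))
          ≡⟨ ∑-distrib-+ (λ j → b * A G i j) _ ⟩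
        ∑ (λ j → b * A G i j) + ∑ (λ j → β * (A G i j * 𝟙 (D j)))
          ≡⟨ cong₂ _+_ (*-distribˡ-sum b (A G i)) (*-distribˡ-sum β (λ j → A G i j * 𝟙 (D j))) ⟨
        b * deg G i + β * into D i ∎
        where
        open ≡-Reasoning
        expand : ∀ a b β d → a * (b + β * d) ≡ b * a + β * (a * d)
        expand = solve-∀

      -- The alternative for vertices whose degree is not bounded: the row is compared with the
      -- total weight, from which the whole penalty is already missing.
      rowSum+X+pen≤ : ∀ i → (rowSum X i + X i) + ∑ pen ≤ n * b + β * ∑ (𝟙 ∘ D)
      rowSum+X+pen≤ i = begin
        (rowSum X i + X i) + ∑ pen
          ≤⟨ +-monoˡ-≤ (∑ pen) (rowSum+X≤∑ X i) ⟩
        ∑ X + ∑ pen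
          ≡⟨ ∑-distrib-+ X pen ⟨
        ∑ (λ j → X j + pen j)
          ≡⟨ sum-cong-≗ X+pen ⟩
        ∑ (λ j → b + β * 𝟙 (D j))
          ≡⟨ ∑-distrib-+ {n} (λ _ → b) _ ⟩
        ∑ {n} (λ _ → b) + ∑ (λ j → β * 𝟙 (D j))
          ≡⟨ cong₂ _+_ (∑-const n b) (sym (*-distribˡ-sum β (𝟙 ∘ D))) ⟩
        n * b + β * ∑ (𝟙 ∘ D) ∎
        where open ≤-Reasoning

  -- The exceptions are (n, deg u, deg v) = (11, 4, 5) and (12, 5, 5), where
  -- n = 2j + 6 + s + t, deg u = j + 2 and deg v = j + 2 + t.
  gap-bound : ∀ j s t → 1 ≤ j → 7 ≤ 2 * j + 2 + s + t →
    (2 * j + 2 + s + t) * (2 * j + 6) ≤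
      (2 * j + 2 + s + t) * ((j + s + t) * (j + s) + s) + (j + 3 + s) * (j + 2) * t ⊎
    (j ≡ 2 × s ≡ 0 × t ≡ 1) ⊎ (j ≡ 3 × s ≡ 0 × t ≡ 0)
  gap-bound j s t 1≤j 7≤q = go j s t 1≤j 7≤q
    where
    Goal : ℕ → ℕ → ℕ → Set
    Goal j s t = (2 * j + 2 + s + t) * (2 * j + 6) ≤
        (2 * j + 2 + s + t) * ((j + s + t) * (j + s) + s) + (j + 3 + s) * (j + 2) * t ⊎
      (j ≡ 2 × s ≡ 0 × t ≡ 1) ⊎ (j ≡ 3 × s ≡ 0 × t ≡ 0)

    scale : ∀ j s t → 2 * j + 6 ≤ (j + s + t) * (j + s) + s → Goal j s t
    scale j s t le = inj₁ (≤-trans (*-monoʳ-≤ (2 * j + 2 + s + t) le) (m≤m+n _ _))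

    product : ∀ {a b x y z} → a ≤ x → b ≤ y → a * b ≤ x * y + z
    product a≤x b≤y = ≤-trans (*-mono-≤ a≤x b≤y) (m≤m+n _ _)

    go : ∀ j s t → 1 ≤ j → 7 ≤ 2 * j + 2 + s + t → Goal j s t
    go (suc (suc (suc (suc j)))) s t _ _ = scale (4 + j) s t
      (≤-trans (subst (2 * (4 + j) + 6 ≤_) (eq j) (m≤m+n _ (2 + 2 * j)))
        (product {4 + j} {4} (≤-trans (m≤m+n (4 + j) s) (m≤m+n _ t)) (≤-trans (m≤m+n 4 j) (m≤m+n (4 + j) s))))
      where
      eq : ∀ j → (2 * (4 + j) + 6) + (2 + 2 * j) ≡ (4 + j) * 4
      eq = solve-∀
    go 3 (suc s) t _ _ = scale 3 (suc s) t (≤-trans (m≤m+n 12 4) (product {4} {4} (m≤m+n 4 (s + t)) (m≤m+n 4 s)))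
    go 3 0 (suc t) _ _ = scale 3 0 (suc t) (product {4} {3} (m≤m+n 4 t) ≤-refl)
    go 3 0 0 _ _ = inj₂ (inj₂ (refl , refl , refl))
    go 2 (suc s) t _ _ = scale 2 (suc s) t (+-mono-≤ {9} (*-mono-≤ {3} {3 + (s + t)} {3} {3 + s} (m≤m+n 3 (s + t)) (m≤m+n 3 s)) (s≤s z≤n))
    go 2 0 (suc (suc (suc t))) _ _ = scale 2 0 (3 + t) (product {5} {2} (m≤m+n 5 t) ≤-refl)
    go 2 0 2 _ _ = inj₁ (≤ᵇ⇒≤ 80 104 _)
    go 2 0 1 _ _ = inj₂ (inj₁ (refl , refl , refl))
    go 2 0 0 _ le with () ← ≤⇒≤ᵇ le
    go 1 (suc (suc (suc s))) t _ _ = scale 1 (3 + s) t (≤-trans (m≤m+n 8 8) (product {4} {4} (m≤m+n 4 (s + t)) (m≤m+n 4 s)))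
    go 1 2 (suc t) _ _ = scale 1 2 (suc t) (≤-trans (m≤m+n 8 4) (product {4} {3} (m≤m+n 4 t) ≤-refl))
    go 1 2 0 _ le with () ← ≤⇒≤ᵇ le
    go 1 1 (suc (suc t)) _ _ = scale 1 1 (2 + t) (product {4} {2} (m≤m+n 4 t) ≤-refl)
    go 1 1 1 _ le with () ← ≤⇒≤ᵇ le
    go 1 1 0 _ le with () ← ≤⇒≤ᵇ le
    go 1 0 (suc (suc (suc (suc (suc (suc (suc t))))))) _ _ = scale 1 0 (7 + t) (product {8} {1} (m≤m+n 8 t) ≤-refl)
    go 1 0 6 _ _ = inj₁ (≤ᵇ⇒≤ 80 142 _)
    go 1 0 5 _ _ = inj₁ (≤ᵇ⇒≤ 72 114 _)
    go 1 0 4 _ _ = inj₁ (≤ᵇ⇒≤ 64 88 _)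
    go 1 0 3 _ _ = inj₁ (≤ᵇ⇒≤ 56 64 _)
    go 1 0 2 _ le with () ← ≤⇒≤ᵇ le
    go 1 0 1 _ le with () ← ≤⇒≤ᵇ le
    go 1 0 0 _ le with () ← ≤⇒≤ᵇ le

  module _ {n m} (n≡4+m : n ≡ 4 + m) (7≤m : 7 ≤ m) {G : Graph n} (good : Good m G) where

    open Good good

    -- Vertices get weight 24 if low and (8 + t) m otherwise, where t counts their
    -- low neighbours.
    noFourLow : ∀ (ℓ : Fin 4 → Fin n) → (∀ {i j} → ℓ i ≡ ℓ j → i ≡ j) → (∀ i → deg G (ℓ i) ≤ 2) → ⊥
    noFourLow ℓ ℓ-inj low = noTestVector X 1≤X rows
      where
      t : Fin n → ℕ
      t j = ∑ (λ i → A G j (ℓ i))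

      t≤4 : ∀ j → t j ≤ 4
      t≤4 j = ∑-≤ 1 (λ i → 𝟙≤1 (adj G j (ℓ i)))

      L : Fin n → ℕ
      L j = ∑ (λ i → 𝟙 (ℓ i == j))

      L-low : ∀ i → L (ℓ i) ≡ 1
      L-low i = trans (sum-cong-≗ same) (∑-𝟙== i)
        where
        same : ∀ i′ → 𝟙 (ℓ i′ == ℓ i) ≡ 𝟙 (i == i′)
        same i′ with i Fin.≟ i′
        ... | yes refl = cong 𝟙 (==-refl (ℓ i))
        ... | no  i≢i′ = cong 𝟙 (==-≢ (λ eq → i≢i′ (sym (ℓ-inj eq))))

      L-high : ∀ {j} → (∀ i → ℓ i ≢ j) → L j ≡ 0
      L-high ∉ = sum-cong-≗ (λ i → cong 𝟙 (==-≢ (∉ i)))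

      h : ℕ → ℕ → ℕ
      h (suc _) _ = 0
      h zero    t = (8 + t) * m

      Z X : Fin n → ℕ
      Z j = h (L j) (t j)
      X j = L j * 24 + Z j

      ∑-A-L : ∀ j → ∑ (λ j′ → A G j j′ * L j′) ≡ t j
      ∑-A-L j = begin
        ∑ (λ j′ → A G j j′ * L j′)
          ≡⟨ sum-cong-≗ (λ j′ → *-distribˡ-sum (A G j j′) (λ i → 𝟙 (ℓ i == j′))) ⟩
        ∑ (λ j′ → ∑ (λ i → A G j j′ * 𝟙 (ℓ i == j′)))
          ≡⟨ ∑-comm (λ j′ i → A G j j′ * 𝟙 (ℓ i == j′)) ⟩
        ∑ (λ i → ∑ (λ j′ → A G j j′ * 𝟙 (ℓ i == j′)))
          ≡⟨ sum-cong-≗ (λ i → trans (sum-cong-≗ (λ j′ → *-comm (A G j j′) (𝟙 (ℓ i == j′)))) (∑-δ (ℓ i) (A G j))) ⟩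
        t j ∎
        where open ≡-Reasoning

      ∑L : ∑ L ≡ 4
      ∑L = trans (∑-comm (λ j i → 𝟙 (ℓ i == j))) (sum-cong-≗ (λ i → ∑-𝟙== (ℓ i)))

      ∑t≤8 : ∑ t ≤ 8
      ∑t≤8 = subst (_≤ 8) (∑-comm (λ i j → A G j (ℓ i)))
        (∑-≤ 2 (λ i → subst (_≤ 2) (sum-cong-≗ (λ j → A-sym G (ℓ i) j)) (low i)))

      data Kind (j : Fin n) : Set where
        isLow  : ∀ i → ℓ i ≡ j → Kind j
        isHigh : (∀ i → ℓ i ≢ j) → Kind j

      kind : ∀ j → Kind j
      kind j with Fin.any? (λ i → ℓ i Fin.≟ j)
      ... | yes (i , eq) = isLow i eq
      ... | no  none     = isHigh (λ i eq → none (i , eq))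

      X-low : ∀ i → X (ℓ i) ≡ 24
      X-low i rewrite L-low i = refl

      X-high : ∀ {j} → (∀ i → ℓ i ≢ j) → X j ≡ (8 + t j) * m
      X-high ∉ rewrite L-high ∉ = refl

      1≤X : ∀ j → 1 ≤ X j
      1≤X j with kind j
      ... | isLow i refl = subst (1 ≤_) (sym (X-low i)) (s≤s z≤n)
      ... | isHigh ∉     = subst (1 ≤_) (sym (X-high ∉)) (*-mono-≤ {1} {8 + t j} (s≤s z≤n) (≤-trans (s≤s z≤n) 7≤m))

      X≤12m : ∀ j → X j ≤ 12 * m
      X≤12m j with kind j
      ... | isLow i refl = subst (_≤ 12 * m) (sym (X-low i)) (≤-trans (m≤m+n 24 60) (*-monoʳ-≤ 12 7≤m))
      ... | isHigh ∉     = subst (_≤ 12 * m) (sym (X-high ∉)) (*-monoˡ-≤ m (+-monoʳ-≤ 8 (t≤4 j)))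

      -- Each of the four low vertices is lent the 8 m that `Z` denies it. The t sum to at most 8,
      -- since four vertices of degree at most 2 have at most 8 edge ends.
      ∑Z+32m≤ : ∑ Z + 32 * m ≤ (8 * n + 8) * m
      ∑Z+32m≤ = begin
        ∑ Z + 32 * m
          ≡⟨ cong (∑ Z +_) (trans (*-assoc 4 8 m) (trans (cong (_* (8 * m)) (sym ∑L)) (*-distribʳ-sum (8 * m) L))) ⟩
        ∑ Z + ∑ (λ j → L j * (8 * m))
          ≡⟨ ∑-distrib-+ Z _ ⟨
        ∑ (λ j → Z j + L j * (8 * m))
          ≤⟨ ∑-mono-≤ le ⟩
        ∑ (λ j → (8 + t j) * m)
          ≡⟨ *-distribʳ-sum m (λ j → 8 + t j) ⟨
        ∑ (λ j → 8 + t j) * m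
          ≡⟨ cong (_* m) (∑-distrib-+ {n} (λ _ → 8) t) ⟩
        (∑ {n} (λ _ → 8) + ∑ t) * m
          ≤⟨ *-monoˡ-≤ m (+-mono-≤ (≤-reflexive (trans (∑-const n 8) (*-comm n 8))) ∑t≤8) ⟩
        (8 * n + 8) * m ∎
        where
        open ≤-Reasoning
        le : ∀ j → Z j + L j * (8 * m) ≤ (8 + t j) * m
        le j with kind j
        ... | isLow i refl rewrite L-low i = ≤-trans (≤-reflexive (*-identityˡ (8 * m))) (*-monoˡ-≤ m (m≤m+n 8 (t (ℓ i))))
        ... | isHigh ∉ rewrite L-high ∉ = ≤-reflexive (+-identityʳ _)

      rows : ∀ i → rowSum G X i ≤ m * X i
      rows j with kind j
      ... | isLow i refl = begin
        -- Two neighbours of weight at most (8 + 4) m each: this is where the low weight 24 comes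
        -- from.
        rowSum G X (ℓ i)              ≤⟨ ∑-mono-≤ (λ j → *-monoʳ-≤ (A G (ℓ i) j) (X≤12m j)) ⟩
        ∑ (λ j → A G (ℓ i) j * (12 * m)) ≡⟨ *-distribʳ-sum (12 * m) (A G (ℓ i)) ⟨
        deg G (ℓ i) * (12 * m)        ≤⟨ *-monoˡ-≤ (12 * m) (low i) ⟩
        2 * (12 * m)                  ≡⟨ eq m ⟩
        m * 24                        ≡⟨ cong (m *_) (X-low i) ⟨
        m * X (ℓ i)                   ∎
        where
        open ≤-Reasoning
        eq : ∀ m → 2 * (12 * m) ≡ m * 24
        eq = solve-∀
      -- With a m in place of the base weight 8 m, a row with t = 0 would be bounded by a m² + (8 -
      -- a) m, to be compared with a m²; hence a = 8. For larger t the contribution 24 t of the low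
      -- neighbours is absorbed by t (m² + m), as m ≥ 7.
      ... | isHigh ∉ = +-cancelʳ-≤ ((8 + t j) * m + 32 * m) (rowSum G X j) (m * X j) (begin
        rowSum G X j + ((8 + t j) * m + 32 * m)
          ≡⟨ cong₂ (λ r z → r + (z + 32 * m)) row-split (sym Zj) ⟩
        (t j * 24 + rowSum G Z j) + (Z j + 32 * m)
          ≡⟨ shuffle (t j * 24) (rowSum G Z j) (Z j) (32 * m) ⟩
        t j * 24 + ((rowSum G Z j + Z j) + 32 * m)
          ≤⟨ +-monoʳ-≤ (t j * 24) (≤-trans (+-monoˡ-≤ (32 * m) (rowSum+X≤∑ G Z j)) ∑Z+32m≤) ⟩
        t j * 24 + (8 * n + 8) * m
          ≤⟨ +-monoˡ-≤ _ (*-monoʳ-≤ (t j) (≤-trans (m≤m+n 24 32) (+-mono-≤ (*-mono-≤ 7≤m 7≤m) 7≤m))) ⟩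
        t j * (m * m + m) + (8 * n + 8) * m
          ≡⟨ trans (cong (λ n → t j * (m * m + m) + (8 * n + 8) * m) n≡4+m) (eq (t j) m) ⟩
        m * ((8 + t j) * m) + ((8 + t j) * m + 32 * m)
          ≡⟨ cong (λ x → m * x + ((8 + t j) * m + 32 * m)) (X-high ∉) ⟨
        m * X j + ((8 + t j) * m + 32 * m) ∎)
        where
        open ≤-Reasoning
        Zj : Z j ≡ (8 + t j) * m
        Zj rewrite L-high ∉ = refl
        row-split : rowSum G X j ≡ t j * 24 + rowSum G Z j
        row-split = trans (sum-cong-≗ (λ j′ → expand (A G j j′) (L j′) (Z j′)))
          (trans (∑-distrib-+ (λ j′ → (A G j j′ * L j′) * 24) _)
            (cong (_+ rowSum G Z j) (trans (sym (*-distribʳ-sum 24 (λ j′ → A G j j′ * L j′))) (cong (_* 24) (∑-A-L j)))))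
          where
          expand : ∀ a l z → a * (l * 24 + z) ≡ (a * l) * 24 + a * z
          expand = solve-∀
        shuffle : ∀ a b c d → (a + b) + (c + d) ≡ a + ((b + c) + d)
        shuffle = solve-∀
        eq : ∀ t m → t * (m * m + m) + (8 * (4 + m) + 8) * m ≡ m * ((8 + t) * m) + ((8 + t) * m + 32 * m)
        eq = solve-∀

    -- A row can be certified in two ways: by its degree and its neighbours in D, which suits
    -- vertices of bounded degree, or by the total weight, which suits vertices that may be adjacent
    -- to everything. In both forms the penalty stands on the larger side, where it helps.
    penalised : ∀ D b β (pen : Fin n → ℕ) → (∀ j → pen j < b + β * 𝟙 (D j)) →
      let X i = b + β * 𝟙 (D i) ∸ pen i in
      (∀ i → b * deg G i + β * into G D i ≤ m * X i + rowSum G pen i ⊎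
             n * b + β * ∑ (𝟙 ∘ D) ≤ m * X i + (X i + ∑ pen)) → ⊥
    penalised D b β pen pen< bounds = noTestVector X (λ j → m<n⇒0<n∸m (pen< j)) rows
      where
      X : Fin n → ℕ
      X j = b + β * 𝟙 (D j) ∸ pen j
      X+pen : ∀ j → X j + pen j ≡ b + β * 𝟙 (D j)
      X+pen j = m∸n+n≡m (<⇒≤ (pen< j))
      rows : ∀ i → rowSum G X i ≤ m * X i
      rows i with bounds i
      ... | inj₁ row = +-cancelʳ-≤ (rowSum G pen i) _ _
        (≤-trans (≤-reflexive (rowSum+pen G D b β X pen X+pen i)) row)
      ... | inj₂ total = +-cancelʳ-≤ (X i + ∑ pen) _ _
        (≤-trans (≤-reflexive (sym (+-assoc (rowSum G X i) (X i) (∑ pen))))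
          (≤-trans (rowSum+X+pen≤ G D b β X pen X+pen i) total))

    -- Without penalties the two certificates split along D: degrees off D, total weight on D. Both
    -- exceptional orders fall back on this when some neighbour of u has small degree.
    twoLevel : ∀ D b β h s → 1 ≤ b → ∑ (𝟙 ∘ D) ≤ h → (∀ {i} → D i ≡ false → deg G i ≤ s) →
      b * s + β * h ≤ m * b → n * b + β * h ≤ m * (b + β) + (b + β) → ⊥
    twoLevel D b β h s 1≤b D≤h off off≤ on≤ = penalised D b β (λ _ → 0) (λ _ → ≤-trans 1≤b (m≤m+n b _)) bounds
      where
      bounds : ∀ i → b * deg G i + β * into G D i ≤ m * (b + β * 𝟙 (D i)) + rowSum G (λ _ → 0) i ⊎
        n * b + β * ∑ (𝟙 ∘ D) ≤ m * (b + β * 𝟙 (D i)) + (b + β * 𝟙 (D i) + ∑ {n} (λ _ → 0))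
      bounds i with D i in Di
      ... | false = inj₁ (≤-trans (+-mono-≤ (*-monoʳ-≤ b (off Di)) (*-monoʳ-≤ β (≤-trans (into≤∑ G D i) D≤h)))
        (≤-trans off≤ (≤-trans (*-monoʳ-≤ m (m≤m+n b _)) (m≤m+n _ _))))
      ... | true rewrite *-identityʳ β = inj₂ (≤-trans (+-monoʳ-≤ (n * b) (*-monoʳ-≤ β D≤h))
        (≤-trans on≤ (+-monoʳ-≤ (m * (b + β)) (m≤m+n (b + β) _))))

    module _ {u v : Fin n} (u≢v : u ≢ v) (uv : adj G u v ≡ false)
      (v-far : ∀ {w} → adj G v w ≡ false → v ≢ w → deg G w ≤ deg G u)
      (u-far : ∀ {w} → adj G u w ≡ false → u ≢ w → deg G w ≤ deg G v)
      (closed : ∀ {x y} → x ≢ y → adj G x y ≡ false → 2 + (deg G x + deg G y) ≤ n) where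

      W : Fin n → Bool
      W j = not (adj G v j) ∧ not (v == j)

      W⇒ : ∀ {j} → W j ≡ true → deg G j ≤ deg G u
      W⇒ {j} Wj with adj G v j in vj | v Fin.≟ j
      ... | false | no v≢j = v-far vj v≢j

      u∈W : W u ≡ true
      u∈W rewrite adj-sym G v u | uv | ==-≢ (≢-sym u≢v) = refl

      ∑W : (∑ (𝟙 ∘ W) + deg G v) + 1 ≡ n
      ∑W = begin
        (∑ (𝟙 ∘ W) + deg G v) + 1
          ≡⟨ cong₂ _+_ (sym (∑-distrib-+ (𝟙 ∘ W) (A G v))) (sym (∑-𝟙== v)) ⟩
        ∑ (λ j → 𝟙 (W j) + A G v j) + ∑ (λ j → 𝟙 (v == j))
          ≡⟨ ∑-distrib-+ (λ j → 𝟙 (W j) + A G v j) _ ⟨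
        ∑ (λ j → (𝟙 (W j) + A G v j) + 𝟙 (v == j))
          ≡⟨ sum-cong-≗ one ⟩
        ∑ {n} (λ _ → 1)
          ≡⟨ trans (∑-const n 1) (*-identityʳ n) ⟩
        n ∎
        where
        open ≡-Reasoning
        one : ∀ j → (𝟙 (W j) + A G v j) + 𝟙 (v == j) ≡ 1
        one j with v Fin.≟ j
        ... | yes refl rewrite no-loop G v = refl
        ... | no  _ with adj G v j
        ...   | true  = refl
        ...   | false = refl

      off-W : ∀ {i} → adj G u i ≡ false → W i ≡ false → deg G i ≤ deg G v
      off-W {i} ui Wi with u Fin.≟ i
      ... | no u≢i = u-far ui u≢i
      ... | yes refl with () ← trans (sym u∈W) Wi

      -- Weights c on W, c + γ + β on the other neighbours of u, c + γ elsewhere.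
      threeLevel : ∀ c γ β → 1 ≤ c → (c + γ + β) * deg G u ≤ m * c →
        (c + γ) * deg G v + β * deg G u ≤ m * (c + γ) →
        n * (c + γ) + β * deg G u ≤ m * (c + γ + β) + (c + γ + β) + γ * ∑ (𝟙 ∘ W) → ⊥
      threeLevel c γ β 1≤c W≤ R≤ D≤ = penalised (adj G u) (c + γ) β pen pen< bounds
        where
        gap : Bool → ℕ → ℕ
        gap true  a = γ + β * a
        gap false a = 0
        pen X : Fin n → ℕ
        pen j = gap (W j) (A G u j)
        X j   = c + γ + β * A G u j ∸ pen j

        pen< : ∀ j → pen j < c + γ + β * A G u j
        pen< j rewrite +-assoc c γ (β * A G u j) with W j
        ... | true  = +-monoˡ-≤ _ 1≤c
        ... | false = ≤-trans 1≤c (m≤m+n c _)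

        ∑pen : γ * ∑ (𝟙 ∘ W) ≤ ∑ pen
        ∑pen = subst (_≤ ∑ pen) (sym (*-distribˡ-sum γ (𝟙 ∘ W))) (∑-mono-≤ le)
          where
          le : ∀ j → γ * 𝟙 (W j) ≤ pen j
          le j with W j
          ... | true  = ≤-trans (≤-reflexive (*-identityʳ γ)) (m≤m+n γ _)
          ... | false = ≤-reflexive (*-zeroʳ γ)

        bounds : ∀ i → (c + γ) * deg G i + β * into G (adj G u) i ≤ m * X i + rowSum G pen i ⊎
          n * (c + γ) + β * deg G u ≤ m * X i + (X i + ∑ pen)
        bounds i with W i in Wi | adj G u i in ui
        ... | true | b = inj₁ (≤-trans (+-monoʳ-≤ ((c + γ) * deg G i) (*-monoʳ-≤ β (into≤deg G (adj G u) i)))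
          (≤-trans (≤-reflexive (sym (*-distribʳ-+ (deg G i) (c + γ) β)))
            (≤-trans (*-monoʳ-≤ (c + γ + β) (W⇒ Wi))
              (≤-trans W≤ (≤-trans (≤-reflexive (cong (m *_) (sym Xi))) (m≤m+n _ _))))))
          where
          Xi : c + γ + β * 𝟙 b ∸ (γ + β * 𝟙 b) ≡ c
          Xi = trans (cong (_∸ (γ + β * 𝟙 b)) (+-assoc c γ _)) (m+n∸n≡m c (γ + β * 𝟙 b))
        ... | false | false = inj₁ (≤-trans
          (+-mono-≤ (*-monoʳ-≤ (c + γ) (off-W ui Wi)) (*-monoʳ-≤ β (into≤∑ G (adj G u) i)))
          (≤-trans R≤ (≤-trans (*-monoʳ-≤ m (m≤m+n (c + γ) _)) (m≤m+n _ _))))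
        ... | false | true rewrite *-identityʳ β = inj₂ (≤-trans D≤
          (≤-trans (≤-reflexive (+-assoc (m * (c + γ + β)) (c + γ + β) _))
            (+-monoʳ-≤ (m * (c + γ + β)) (+-monoʳ-≤ (c + γ + β) ∑pen))))

      N∖ : Fin n → Fin n → Bool
      N∖ z j = adj G u j ∧ not (z == j)

      ∑N∖ : ∀ {z} → Adj G u z → ∑ (𝟙 ∘ N∖ z) + 1 ≡ deg G u
      ∑N∖ {z} uz = trans (cong (∑ (𝟙 ∘ N∖ z) +_) (sym (∑-𝟙== z)))
        (trans (sym (∑-distrib-+ (𝟙 ∘ N∖ z) _)) (sum-cong-≗ eq))
        where
        eq : ∀ j → 𝟙 (N∖ z j) + 𝟙 (z == j) ≡ A G u j
        eq j with z Fin.≟ j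
        ... | yes refl rewrite uz = refl
        ... | no  _ with adj G u j
        ...   | true  = refl
        ...   | false = refl

      off-N∖ : ∀ {z s} → deg G z ≤ s → deg G u ≤ s → deg G v ≤ s → ∀ {i} → N∖ z i ≡ false → deg G i ≤ s
      off-N∖ {z} z≤ u≤ v≤ {i} Ni with u Fin.≟ i
      ... | yes refl = u≤
      ... | no  u≢i with adj G u i in ui | z Fin.≟ i
      ...   | false | _        = ≤-trans (u-far ui u≢i) v≤
      ...   | true  | yes refl = z≤

      -- If s were adjacent to all of N(u), it would have more than deg u neighbours.
      small : (∀ {z} → Adj G u z → 6 ≤ deg G z) → ∀ {s x} → adj G u s ≡ false → adj G u x ≡ false → Adj G s x →
        deg G s ≤ deg G u → deg G s + 8 ≤ n
      small N≥6 {s} {x} us ux sx s≤u with deg G s + 8 ≤? n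
      ... | yes le = le
      ... | no  nle = contradiction (≤-trans (into<deg G (adj G u) sx ux) s≤u) (≤⇒≯ (∑-mono-≤ le))
        where
        le : ∀ j → A G u j ≤ A G s j * 𝟙 (adj G u j)
        le j with adj G u j in uj
        ... | false = z≤n
        ... | true with adj G s j in sj
        ...   | true  = ≤-refl
        ...   | false = contradiction (≤-trans (≤-trans (≤-reflexive (+-comm (deg G s) 8)) (≤-trans (≤-reflexive (eq (deg G s))) (+-monoʳ-≤ 2 (+-monoʳ-≤ (deg G s) (N≥6 uj))))) (closed s≢j sj)) nle
          where
          eq : ∀ a → 8 + a ≡ 2 + (a + 6)
          eq = solve-∀
          s≢j : s ≢ j
          s≢j refl with () ← trans (sym us) uj

      private
        ∑-penalty : ∀ p q (S T : Fin n → Bool) →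
          ∑ (λ j → p * 𝟙 (S j) + q * 𝟙 (T j)) ≡ p * ∑ (𝟙 ∘ S) + q * ∑ (𝟙 ∘ T)
        ∑-penalty p q S T = trans (∑-distrib-+ (λ j → p * 𝟙 (S j)) _)
          (sym (cong₂ _+_ (*-distribˡ-sum p (𝟙 ∘ S)) (*-distribˡ-sum q (𝟙 ∘ T))))

        penalty≤ : ∀ p q a b → p * 𝟙 a + q * 𝟙 b ≤ p + q
        penalty≤ p q a b = +-mono-≤ (≤-trans (*-monoʳ-≤ p (𝟙≤1 a)) (≤-reflexive (*-identityʳ p)))
                                    (≤-trans (*-monoʳ-≤ q (𝟙≤1 b)) (≤-reflexive (*-identityʳ q)))

      -- Order 11. If some z next to u has degree at most 5, only the three other neighbours of u
      -- need be heavy, and weights 3 and 5 suffice. Otherwise degrees separate W from N(u), and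
      -- Hall for |W| = 5 > 4 gives s in W with a neighbour outside N(u), so deg s ≤ 3 by `small`.
      -- The weights 8 at s, 12 on the rest of W, 21 on N(u) and 14 elsewhere meet all four bounds
      -- with equality.
      exceptionA : deg G u ≡ 4 → deg G v ≡ 5 → ∑ (𝟙 ∘ W) ≡ 5 → m ≡ 7 → ⊥
      exceptionA k≡ d≡ w≡ m≡ with Fin.any? (λ z → (adj G u z Bool.≟ true) ×-dec (deg G z ≤? 5))
      ... | yes (z , uz , z≤5) = twoLevel (N∖ z) 3 2 3 5 (s≤s z≤n)
          (≤-reflexive (+-cancelʳ-≡ 1 _ _ (trans (∑N∖ uz) k≡)))
          (off-N∖ z≤5 (subst (_≤ 5) (sym k≡) (n≤1+n 4)) (≤-reflexive d≡))
          (subst (λ m → 21 ≤ m * 3) (sym m≡) ≤-refl)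
          (subst₂ (λ n m → n * 3 + 6 ≤ m * 5 + 5) (sym (trans n≡4+m (cong (4 +_) m≡))) (sym m≡) (n≤1+n 39))
      ... | no none with hall W (adj G u) (subst₂ _<_ (sym k≡) (sym w≡) ≤-refl)
      ...   | s , x , Ws , ux , sx = penalised (adj G u) 14 7 pen pen<
          (λ i → subst (λ m → row m i ⊎ total m i) (sym m≡) (bounds i))
        where
        n≡11 : n ≡ 11
        n≡11 = trans n≡4+m (cong (4 +_) m≡)
        N≥6 : ∀ {z} → Adj G u z → 6 ≤ deg G z
        N≥6 {z} uz = ≰⇒> (λ z≤5 → none (z , uz , z≤5))
        W-off : ∀ {j} → W j ≡ true → adj G u j ≡ false
        W-off {j} Wj with adj G u j in uj
        ... | false = refl
        ... | true  = contradiction (≤-trans (N≥6 uj) (subst (deg G j ≤_) k≡ (W⇒ Wj))) λ { (s≤s (s≤s (s≤s (s≤s ())))) }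
        s≤3 : deg G s ≤ 3
        s≤3 = +-cancelʳ-≤ 8 (deg G s) 3 (subst (deg G s + 8 ≤_) n≡11 (small N≥6 (W-off Ws) ux sx (W⇒ Ws)))
        pen X : Fin n → ℕ
        pen j = 4 * 𝟙 (s == j) + 2 * 𝟙 (W j)
        X j   = 14 + 7 * A G u j ∸ pen j
        pen< : ∀ j → pen j < 14 + 7 * A G u j
        pen< j = s≤s (≤-trans (penalty≤ 4 2 (s == j) (W j)) (m≤m+n 6 _))
        row total : ℕ → Fin n → Set
        row m i   = 14 * deg G i + 7 * into G (adj G u) i ≤ m * X i + rowSum G pen i
        total m i = n * 14 + 7 * deg G u ≤ m * X i + (X i + ∑ pen)
        bounds : ∀ i → row 7 i ⊎ total 7 i
        bounds i with s Fin.≟ i | W i in Wi | adj G u i in ui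
        ... | yes refl | false | _ with () ← trans (sym Ws) Wi
        ... | _        | true  | true with () ← trans (sym (W-off Wi)) ui
        ... | yes refl | true  | false = inj₁ (≤-trans
          (+-mono-≤ (*-monoʳ-≤ 14 s≤3) (*-monoʳ-≤ 7 (≤-pred (≤-trans (into<deg G (adj G u) sx ux) s≤3)))) (m≤m+n 56 _))
        ... | no _ | true | false = inj₁ (≤-trans
          (+-mono-≤ (*-monoʳ-≤ 14 i≤4) (*-monoʳ-≤ 7 (≤-trans (into≤deg G (adj G u) i) i≤4))) (m≤m+n 84 _))
          where
          i≤4 : deg G i ≤ 4
          i≤4 = subst (deg G i ≤_) k≡ (W⇒ Wi)
        ... | no _ | false | false = inj₁ (≤-trans
          (+-mono-≤ (*-monoʳ-≤ 14 (subst (deg G i ≤_) d≡ (off-W ui Wi)))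
                    (*-monoʳ-≤ 7 (subst (into G (adj G u) i ≤_) k≡ (into≤∑ G (adj G u) i)))) (m≤m+n 98 _))
        ... | no _ | false | true = inj₂ (≤-reflexive (trans (cong₂ (λ n k → n * 14 + 7 * k) n≡11 k≡)
          (cong (λ p → 147 + (21 + p)) (sym (trans (∑-penalty 4 2 (s ==_) W) (cong₂ (λ x y → 4 * x + 2 * y) (∑-𝟙== s) w≡))))))

      -- Order 12. A neighbour of u of degree at most 5 again allows two levels, now 4 and 7.
      -- Otherwise Hall for the seven vertices outside N(u) gives an edge s x among them, and both
      -- ends have degree at most 4. The weights are 24 at s and x, 56 on N(u) and 35 elsewhere; s
      -- and x each profit from the other being light, as 35 * 4 + 21 * 3 = 8 * 24 + 11.
      exceptionB : deg G u ≡ 5 → deg G v ≡ 5 → m ≡ 8 → ⊥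
      exceptionB k≡ d≡ m≡ with Fin.any? (λ z → (adj G u z Bool.≟ true) ×-dec (deg G z ≤? 5))
      ... | yes (z , uz , z≤5) = twoLevel (N∖ z) 4 3 4 5 (s≤s z≤n)
          (≤-reflexive (+-cancelʳ-≡ 1 _ _ (trans (∑N∖ uz) k≡)))
          (off-N∖ z≤5 (≤-reflexive k≡) (≤-reflexive d≡))
          (subst (λ m → 32 ≤ m * 4) (sym m≡) ≤-refl)
          (subst₂ (λ n m → n * 4 + 12 ≤ m * 7 + 7) (sym (trans n≡4+m (cong (4 +_) m≡))) (sym m≡) (m≤m+n 60 3))
      ... | no none with hall (not ∘ adj G u) (adj G u) (subst₂ _<_ (sym k≡) (sym ∑notN) (m≤m+n 6 1))
        where
        ∑notN : ∑ (𝟙 ∘ not ∘ adj G u) ≡ 7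
        ∑notN = +-cancelʳ-≡ 5 _ _ (begin
          ∑ (𝟙 ∘ not ∘ adj G u) + 5                 ≡⟨ cong (∑ (𝟙 ∘ not ∘ adj G u) +_) k≡ ⟨
          ∑ (𝟙 ∘ not ∘ adj G u) + deg G u           ≡⟨ ∑-distrib-+ (𝟙 ∘ not ∘ adj G u) _ ⟨
          ∑ (λ j → 𝟙 (not (adj G u j)) + A G u j)   ≡⟨ sum-cong-≗ (λ j → one (adj G u j)) ⟩
          ∑ {n} (λ _ → 1)                           ≡⟨ trans (∑-const n 1) (trans (*-identityʳ n) (trans n≡4+m (cong (4 +_) m≡))) ⟩
          12                                        ∎)
          where
          open ≡-Reasoning
          one : ∀ b → 𝟙 (not b) + 𝟙 b ≡ 1
          one true  = refl
          one false = refl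
      ...   | s , x , s∉ , ux , sx = penalised (adj G u) 35 21 pen pen<
          (λ i → subst (λ m → row m i ⊎ total m i) (sym m≡) (bounds i))
        where
        n≡12 : n ≡ 12
        n≡12 = trans n≡4+m (cong (4 +_) m≡)
        us : adj G u s ≡ false
        us = Bool.not-injective s∉
        N≥6 : ∀ {z} → Adj G u z → 6 ≤ deg G z
        N≥6 {z} uz = ≰⇒> (λ z≤5 → none (z , uz , z≤5))
        off≤5 : ∀ {i} → adj G u i ≡ false → deg G i ≤ 5
        off≤5 {i} ui with u Fin.≟ i
        ... | yes refl = ≤-reflexive k≡
        ... | no  u≢i  = subst (deg G i ≤_) d≡ (u-far ui u≢i)
        pen X : Fin n → ℕ
        pen j = 11 * 𝟙 (s == j) + 11 * 𝟙 (x == j)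
        X j   = 35 + 21 * A G u j ∸ pen j
        pen< : ∀ j → pen j < 35 + 21 * A G u j
        pen< j = s≤s (≤-trans (penalty≤ 11 11 (s == j) (x == j)) (m≤m+n 22 _))
        row total : ℕ → Fin n → Set
        row m i   = 35 * deg G i + 21 * into G (adj G u) i ≤ m * X i + rowSum G pen i
        total m i = n * 35 + 21 * deg G u ≤ m * X i + (X i + ∑ pen)
        touching : ∀ {i j} → adj G u i ≡ false → adj G u j ≡ false → Adj G i j → pen j ≡ 11 →
          35 * deg G i + 21 * into G (adj G u) i ≤ 192 + rowSum G pen i
        touching {i} {j} ui uj ij pen≡ = ≤-trans
          (+-mono-≤ (*-monoʳ-≤ 35 i≤4) (*-monoʳ-≤ 21 (≤-pred (≤-trans (into<deg G (adj G u) ij uj) i≤4))))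
          (+-monoʳ-≤ 192 (subst (_≤ rowSum G pen i) (cong₂ (λ b p → 𝟙 b * p) ij pen≡) (term≤∑ (λ j → A G i j * pen j) j)))
          where
          i≤4 : deg G i ≤ 4
          i≤4 = +-cancelʳ-≤ 8 (deg G i) 4
            (subst (deg G i + 8 ≤_) n≡12 (small N≥6 ui uj ij (subst (deg G i ≤_) (sym k≡) (off≤5 ui))))
        pen-s : pen s ≡ 11
        pen-s rewrite ==-refl s | ==-≢ (≢-sym (Adj⇒≢ G sx)) = refl
        pen-x : pen x ≡ 11
        pen-x rewrite ==-refl x | ==-≢ (Adj⇒≢ G sx) = refl
        bounds : ∀ i → row 8 i ⊎ total 8 i
        bounds i with s Fin.≟ i | x Fin.≟ i | adj G u i in ui
        ... | yes refl | yes refl | _ with () ← trans (sym sx) (no-loop G s)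
        ... | yes refl | no _     | true  with () ← trans (sym us) ui
        ... | no _     | yes refl | true  with () ← trans (sym ux) ui
        ... | yes refl | no _     | false = inj₁ (touching us ux sx pen-x)
        ... | no _     | yes refl | false = inj₁ (touching ux us (Adj-sym G sx) pen-s)
        ... | no _     | no _     | false = inj₁ (≤-trans
          (+-mono-≤ (*-monoʳ-≤ 35 (off≤5 ui)) (*-monoʳ-≤ 21 (≤-trans (into≤deg G (adj G u) i) (off≤5 ui)))) (m≤m+n 280 _))
        ... | no _     | no _     | true  = inj₂ (≤-trans (≤-reflexive (cong₂ (λ n k → n * 35 + 21 * k) n≡12 k≡))
          (≤-trans (n≤1+n 525) (≤-reflexive (cong (λ p → 448 + (56 + p))
            (sym (trans (∑-penalty 11 11 (s ==_) (x ==_)) (cong₂ (λ x y → 11 * x + 11 * y) (∑-𝟙== s) (∑-𝟙== x))))))))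

      -- The differences j = deg u - 2, t = deg v - deg u and s = |W| - deg u - 1 are natural
      -- numbers, the last because the graph is closed and n = |W| + deg v + 1. In terms of them the
      -- conditions of `threeLevel` become polynomial inequalities without subtraction.
      noHighPair : 3 ≤ deg G u → deg G u ≤ deg G v → ⊥
      noHighPair 3≤k k≤d = impossible (gap-bound j s t 1≤j (subst (7 ≤_) m≡ 7≤m))
        where
        k d w j s t e : ℕ
        k = deg G u
        d = deg G v
        w = ∑ (𝟙 ∘ W)
        j = k ∸ 2
        t = d ∸ k
        s = w ∸ suc k

        1≤j : 1 ≤ j
        1≤j = ∸-monoˡ-≤ 2 3≤k

        k≡ : k ≡ j + 2
        k≡ = sym (m∸n+n≡m (≤-trans (n≤1+n 2) 3≤k))

        d≡ : d ≡ j + 2 + t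
        d≡ = trans (sym (m+[n∸m]≡n k≤d)) (cong (_+ t) k≡)

        k<w : suc k ≤ w
        k<w = +-cancelʳ-≤ (d + 1) (suc k) w (begin
          suc k + (d + 1)   ≡⟨ eq k d ⟩
          2 + (k + d)       ≤⟨ closed u≢v uv ⟩
          n                 ≡⟨ ∑W ⟨
          (w + d) + 1       ≡⟨ +-assoc w d 1 ⟩
          w + (d + 1)       ∎)
          where
          open ≤-Reasoning
          eq : ∀ k d → suc k + (d + 1) ≡ 2 + (k + d)
          eq = solve-∀

        w≡ : w ≡ j + 3 + s
        w≡ = trans (sym (m+[n∸m]≡n k<w)) (trans (cong (λ k → suc k + s) k≡) (eq j s))
          where
          eq : ∀ j s → suc (j + 2) + s ≡ j + 3 + s
          eq = solve-∀

        m≡ : m ≡ 2 * j + 2 + s + t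
        m≡ = +-cancelˡ-≡ 4 _ _ (trans (sym n≡4+m) (trans (sym ∑W) (trans (cong₂ (λ w d → (w + d) + 1) w≡ d≡) (eq j s t))))
          where
          eq : ∀ j s t → (j + 3 + s + (j + 2 + t)) + 1 ≡ 4 + (2 * j + 2 + s + t)
          eq = solve-∀

        e = 2 * j + 2 + s

        impossible : (2 * j + 2 + s + t) * (2 * j + 6) ≤
            (2 * j + 2 + s + t) * ((j + s + t) * (j + s) + s) + (j + 3 + s) * (j + 2) * t ⊎
          (j ≡ 2 × s ≡ 0 × t ≡ 1) ⊎ (j ≡ 3 × s ≡ 0 × t ≡ 0) → ⊥
        impossible (inj₂ (inj₁ (j≡ , s≡ , t≡))) = exceptionA (trans k≡ (cong (_+ 2) j≡))
          (trans d≡ (cong₂ (λ j t → j + 2 + t) j≡ t≡)) (trans w≡ (cong₂ (λ j s → j + 3 + s) j≡ s≡))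
          (trans m≡ (cong₂ (λ a t → a + t) (cong₂ (λ j s → 2 * j + 2 + s) j≡ s≡) t≡))
        impossible (inj₂ (inj₂ (j≡ , s≡ , t≡))) = exceptionB (trans k≡ (cong (_+ 2) j≡))
          (trans d≡ (cong₂ (λ j t → j + 2 + t) j≡ t≡))
          (trans m≡ (cong₂ (λ a t → a + t) (cong₂ (λ j s → 2 * j + 2 + s) j≡ s≡) t≡))
        impossible (inj₁ bound) = threeLevel c γ β 1≤c
          (subst₂ (λ k m → (c + γ + β) * k ≤ m * c) (sym k≡) (sym m≡) (≤-reflexive (W= j s t)))
          (subst₂ (λ (k , d) m → (c + γ) * d + β * k ≤ m * (c + γ)) (sym (cong₂ _,_ k≡ d≡)) (sym m≡) (≤-reflexive (R= j s t)))
          (subst₂ (λ (n , k) (m , w) → n * (c + γ) + β * k ≤ m * (c + γ + β) + (c + γ + β) + γ * w)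
            (sym (cong₂ _,_ (trans n≡4+m (cong (4 +_) m≡)) k≡)) (sym (cong₂ _,_ m≡ w≡))
            -- Up to terms common to both sides, the total-weight condition is the inequality of
            -- `gap-bound`.
            (+-cancelʳ-≤ ((2 * j + 2 + s + t) * (2 * j + 6)) _ _
              (≤-trans (+-monoʳ-≤ ((4 + (2 * j + 2 + s + t)) * (c + γ) + β * (j + 2)) bound) (≤-reflexive (D= j s t)))))
          where
          c γ β : ℕ
          -- With k = deg u the three weights are c = k (m - t), c + γ = k m and c + γ + β = m (m -
          -- t). They are determined up to scaling by equality in the first two conditions of
          -- `threeLevel`, since deg v + j + s = m.
          c = (j + 2) * (2 * j + 2 + s)
          γ = (j + 2) * t
          β = (2 * j + 2 + s + t) * (j + s)
          1≤c : 1 ≤ c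
          1≤c = *-mono-≤ {1} {j + 2} (≤-trans 1≤j (m≤m+n j 2)) (≤-trans (s≤s z≤n) (≤-trans (m≤n+m 2 (2 * j)) (m≤m+n _ s)))
          W= : ∀ j s t → ((j + 2) * (2 * j + 2 + s) + (j + 2) * t + (2 * j + 2 + s + t) * (j + s)) * (j + 2) ≡
            (2 * j + 2 + s + t) * ((j + 2) * (2 * j + 2 + s))
          W= = solve-∀
          R= : ∀ j s t → ((j + 2) * (2 * j + 2 + s) + (j + 2) * t) * (j + 2 + t) + (2 * j + 2 + s + t) * (j + s) * (j + 2) ≡
            (2 * j + 2 + s + t) * ((j + 2) * (2 * j + 2 + s) + (j + 2) * t)
          R= = solve-∀
          D= : ∀ j s t →
            ((4 + (2 * j + 2 + s + t)) * ((j + 2) * (2 * j + 2 + s) + (j + 2) * t) + (2 * j + 2 + s + t) * (j + s) * (j + 2))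
              + ((2 * j + 2 + s + t) * ((j + s + t) * (j + s) + s) + (j + 3 + s) * (j + 2) * t) ≡
            ((2 * j + 2 + s + t) * ((j + 2) * (2 * j + 2 + s) + (j + 2) * t + (2 * j + 2 + s + t) * (j + s))
              + ((j + 2) * (2 * j + 2 + s) + (j + 2) * t + (2 * j + 2 + s + t) * (j + s))
              + (j + 2) * t * (j + 3 + s)) + (2 * j + 2 + s + t) * (2 * j + 6)
          D= = solve-∀

-- Graphs in which all but three vertices form a clique.

module Cases where

  open Defs hiding (_+_; _*_; _≤_; _≈_; sum)
  open Counting
  open Paths
  open TestVectors
  open import Data.Bool.Base using () renaming (_∨_ to _or_)
  open import Data.List.Membership.Propositional using (_∈_; _∉_)
  open import Data.List.Membership.Propositional.Properties using (∈-allFin; ∈-++⁺ˡ; ∈-++⁺ʳ; ∈-filter⁺; ∈-filter⁻; ∈-lookup)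
  open import Data.List.Membership.Propositional.Properties.WithK using (unique∧set⇒bag)
  open import Data.List.Relation.Binary.BagAndSetEquality using (∼bag⇒↭)
  open import Data.Nat.Base
  open import Data.Nat.Properties
  open import Function.Bundles using (mk⇔)

  lookup-injective : ∀ {A : Set} {xs : List A} → Unique xs → ∀ i j → lookup xs i ≡ lookup xs j → i ≡ j
  lookup-injective {xs = _ ∷ _} _ zero zero _ = refl
  lookup-injective (x∉ ∷ _) zero (suc j) eq = contradiction eq (All.lookup x∉ (∈-lookup j))
  lookup-injective (x∉ ∷ _) (suc i) zero eq = contradiction (sym eq) (All.lookup x∉ (∈-lookup i))
  lookup-injective (_ ∷ uniq) (suc i) (suc j) eq = cong suc (lookup-injective uniq i j eq)

  module _ {n : ℕ} where

    open import Data.List.Membership.DecPropositional (Fin._≟_ {n}) using (_∈?_; _∉?_)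

    mem : List (Fin n) → Fin n → Bool
    mem []       j = false
    mem (x ∷ xs) j = (x == j) or mem xs j

    mem⇒∈ : ∀ xs {j} → mem xs j ≡ true → j ∈ xs
    mem⇒∈ (x ∷ xs) {j} eq with x Fin.≟ j
    ... | yes refl = here refl
    ... | no  _    = there (mem⇒∈ xs eq)

    ∈⇒mem : ∀ {xs j} → j ∈ xs → mem xs j ≡ true
    ∈⇒mem {x ∷ xs} (here refl) rewrite ==-refl x = refl
    ∈⇒mem {x ∷ xs} {j} (there j∈) with x == j
    ... | true  = refl
    ... | false = ∈⇒mem j∈

    ∉⇒mem : ∀ {xs j} → j ∉ xs → mem xs j ≡ false
    ∉⇒mem {xs} {j} j∉ with mem xs j in eq
    ... | false = refl
    ... | true  = contradiction (mem⇒∈ xs eq) j∉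

    mem⇒∉ : ∀ {xs j} → mem xs j ≡ false → j ∉ xs
    mem⇒∉ eq j∈ with () ← trans (sym (∈⇒mem j∈)) eq

    ∑mem≤ : ∀ xs → ∑ (𝟙 ∘ mem xs) ≤ length xs
    ∑mem≤ [] = ≤-reflexive (trans (∑-const n 0) (*-zeroʳ n))
    ∑mem≤ (x ∷ xs) = begin
      ∑ (λ j → 𝟙 ((x == j) or mem xs j))      ≤⟨ ∑-mono-≤ (λ j → or≤ (x == j) (mem xs j)) ⟩
      ∑ (λ j → 𝟙 (x == j) + 𝟙 (mem xs j))     ≡⟨ ∑-distrib-+ (λ j → 𝟙 (x == j)) _ ⟩
      ∑ (λ j → 𝟙 (x == j)) + ∑ (𝟙 ∘ mem xs)   ≤⟨ +-mono-≤ (≤-reflexive (∑-𝟙== x)) (∑mem≤ xs) ⟩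
      suc (length xs)                         ∎
      where
      open ≤-Reasoning
      or≤ : ∀ a b → 𝟙 (a or b) ≤ 𝟙 a + 𝟙 b
      or≤ true  b = s≤s z≤n
      or≤ false b = ≤-refl

    ∑mem≥ : ∀ {xs} → Unique xs → length xs ≤ ∑ (𝟙 ∘ mem xs)
    ∑mem≥ [] = z≤n
    ∑mem≥ {x ∷ xs} (x∉ ∷ uniq) = begin
      suc (length xs)                         ≤⟨ +-mono-≤ (≤-reflexive (sym (∑-𝟙== x))) (∑mem≥ uniq) ⟩
      ∑ (λ j → 𝟙 (x == j)) + ∑ (𝟙 ∘ mem xs)   ≡⟨ ∑-distrib-+ (λ j → 𝟙 (x == j)) _ ⟨
      ∑ (λ j → 𝟙 (x == j) + 𝟙 (mem xs j))     ≡⟨ sum-cong-≗ disjoint ⟩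
      ∑ (λ j → 𝟙 ((x == j) or mem xs j))      ∎
      where
      open ≤-Reasoning
      disjoint : ∀ j → 𝟙 (x == j) + 𝟙 (mem xs j) ≡ 𝟙 ((x == j) or mem xs j)
      disjoint j with x Fin.≟ j
      ... | no  _ = refl
      ... | yes refl rewrite ∉⇒mem {xs} {x} (λ x∈ → All.lookup x∉ x∈ refl) = refl

    abstract
      fresh : ∀ (xs : List (Fin n)) → length xs < n → ∃[ x ] x ∉ xs
      fresh xs lt with ∑<∑⇒∃< (𝟙 ∘ mem xs) (λ _ → 1)
        (≤-trans {j = suc (length xs)} (s≤s (∑mem≤ xs)) (≤-trans lt (≤-reflexive (sym (trans (∑-const n 1) (*-identityʳ n))))))
      ... | x , lt′ with mem xs x in eq
      ...   | false = x , mem⇒∉ {xs} {x} eq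
      ...   | true with s≤s () ← lt′

    joinAt : ∀ (G : Graph n) {x xs ys} → Linked (Adj G) (x ∷ xs) → Linked (Adj G) (x ∷ ys) →
      Linked (Adj G) ((x ∷ xs) ʳ++ ys)
    joinAt G [-]       ys = ys
    joinAt G (xz ∷ zs) ys = joinAt G zs (Adj-sym G xz ∷ ys)

    module _ (G : Graph n) (c : Fin n) (fs B : List (Fin n)) where

      private
        S : List (Fin n)
        S = c ∷ fs ++ B

      Free : Fin n → Set
      Free z = z ≡ c ⊎ z ∉ S

      -- Only the vertices of S are placed by hand: the path runs through fs backwards to c, then
      -- through all vertices outside S in any order, then through B. The vertex c counts as free
      -- because the clique stretch starts with it.
      hamThroughClique : Unique S → (∀ {x y} → Free x → Free y → x ≢ y → Adj G x y) →
        Linked (Adj G) (c ∷ fs) → (∀ {z} → Free z → Linked (Adj G) (z ∷ B)) → HamPath G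
      hamThroughClique uniq clique front back =
        (c ∷ fs) ʳ++ (rest ++ B) , joinAt G front (chain c rest c-rest (inj₁ refl) all-free) , perm
        where
        rest : List (Fin n)
        rest = filter (_∉? S) (allFin n)
        rest⇒∉ : ∀ {x} → x ∈ rest → x ∉ S
        rest⇒∉ x∈ = proj₂ (∈-filter⁻ (_∉? S) {xs = allFin n} x∈)
        uniq-rest : Unique rest
        uniq-rest = Unique.filter⁺ (_∉? S) (Unique.allFin⁺ n)
        c-rest : Unique (c ∷ rest)
        c-rest = All.tabulate (λ x∈ c≡x → rest⇒∉ x∈ (here (sym c≡x))) ∷ uniq-rest
        all-free : All Free rest
        all-free = All.tabulate (λ x∈ → inj₂ (rest⇒∉ x∈))
        chain : ∀ z R → Unique (z ∷ R) → Free z → All Free R → Linked (Adj G) (z ∷ R ++ B)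
        chain z []      _                    fz []        = back fz
        chain z (r ∷ R) ((z≢r ∷ _) ∷ uniqR) fz (fr ∷ fR) = clique fz fr z≢r ∷ chain r R uniqR fr fR
        all-in : ∀ {x} → x ∈ S ++ rest
        all-in {x} with x ∈? S
        ... | yes x∈ = ∈-++⁺ˡ x∈
        ... | no  x∉ = ∈-++⁺ʳ S (∈-filter⁺ (_∉? S) (∈-allFin x) x∉)
        S++rest : S ++ rest ↭ allFin n
        S++rest = ∼bag⇒↭ (unique∧set⇒bag
          (Unique.++⁺ uniq uniq-rest (λ (x∈S , x∈rest) → rest⇒∉ x∈rest x∈S))
          (Unique.allFin⁺ n) (mk⇔ (λ _ → ∈-allFin _) (λ _ → all-in)))
        perm : (c ∷ fs) ʳ++ (rest ++ B) ↭ allFin n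
        perm = ↭-trans (↭-sym (Perm.++↭ʳ++ (c ∷ fs) (rest ++ B)))
          (↭-trans (Perm.++⁺ˡ (c ∷ fs) (Perm.++-comm rest B))
            (↭-trans (subst (_↭ S ++ rest) (List.++-assoc (c ∷ fs) B rest) ↭-refl) S++rest))

  module _ {n m} {G : Graph n} (good : Good m G) (3<n : 3 < n) where

    open Good good

    abstract
      hallList : ∀ {xs} ys → Unique xs → length ys < length xs →
        ∃[ s ] ∃[ x ] (s ∈ xs × x ∉ ys × Adj G s x)
      hallList {xs} ys uniq lt with hall (mem xs) (mem ys) (≤-trans (s≤s (∑mem≤ ys)) (≤-trans lt (∑mem≥ uniq)))
      ... | s , x , s∈ , x∉ , sx = s , x , mem⇒∈ xs s∈ , mem⇒∉ {xs = ys} {x} x∉ , sx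

      escapeList : ∀ {xs s t} → s ∈ xs → t ∉ xs → ∃[ s ] ∃[ t ] (s ∈ xs × t ∉ xs × Adj G s t)
      escapeList {xs} s∈ t∉ with escape (mem xs) (∈⇒mem s∈) (∉⇒mem t∉)
      ... | s , t , s∈ , t∉ , st = s , t , mem⇒∈ xs s∈ , mem⇒∉ {xs = xs} {t} t∉ , st

    Out : Fin n → Fin n → Fin n → Fin n → Set
    Out x y z w = w ≢ x × w ≢ y × w ≢ z

    out? : ∀ x y z w → Dec (Out x y z w)
    out? x y z w = ¬? (w Fin.≟ x) ×-dec ¬? (w Fin.≟ y) ×-dec ¬? (w Fin.≟ z)

    record Outside (x y z : Fin n) : Set where
      constructor outside
      field
        x≢y : x ≢ y
        x≢z : x ≢ z
        y≢z : y ≢ z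
        clique : ∀ {v w} → Out x y z v → Out x y z w → v ≢ w → Adj G v w

    swap₁₂ : ∀ {x y z} → Outside x y z → Outside y x z
    swap₁₂ (outside xy xz yz cl) = outside (≢-sym xy) yz xz (λ (a , b , c) (a′ , b′ , c′) → cl (b , a , c) (b′ , a′ , c′))

    swap₂₃ : ∀ {x y z} → Outside x y z → Outside x z y
    swap₂₃ (outside xy xz yz cl) = outside xz xy (≢-sym yz) (λ (a , b , c) (a′ , b′ , c′) → cl (a , c , b) (a′ , c′ , b′))

    module _ {x y z : Fin n} (O : Outside x y z) where

      open Outside O

      free⇒out : ∀ {c fs B} → Out x y z c → x ∈ c ∷ fs ++ B → y ∈ c ∷ fs ++ B → z ∈ c ∷ fs ++ B →
        ∀ {w} → Free G c fs B w → Out x y z w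
      free⇒out oc _ _ _ (inj₁ refl) = oc
      free⇒out oc x∈ y∈ z∈ (inj₂ w∉) = (λ { refl → w∉ x∈ }) , (λ { refl → w∉ y∈ }) , (λ { refl → w∉ z∈ })

      closedPath : ∀ c fs → Out x y z c → Unique (c ∷ fs ++ []) → x ∈ c ∷ fs ++ [] → y ∈ c ∷ fs ++ [] → z ∈ c ∷ fs ++ [] →
        Linked (Adj G) (c ∷ fs) → HamPath G
      closedPath c fs oc uniq x∈ y∈ z∈ front = hamThroughClique G c fs [] uniq
        (λ fv fw → clique (free⇒out {c} {fs} {[]} oc x∈ y∈ z∈ fv) (free⇒out {c} {fs} {[]} oc x∈ y∈ z∈ fw)) front (λ _ → [-])

      -- Listing e in S reserves it as the last clique vertex, so that the path can end in l.
      twoEnded : ∀ c fs e l → Out x y z c → Out x y z e → c ≢ e → Unique (c ∷ fs ++ e ∷ l ∷ []) →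
        x ∈ c ∷ fs ++ e ∷ l ∷ [] → y ∈ c ∷ fs ++ e ∷ l ∷ [] → z ∈ c ∷ fs ++ e ∷ l ∷ [] →
        Linked (Adj G) (c ∷ fs) → Adj G l e → HamPath G
      twoEnded c fs e l oc oe c≢e uniq x∈ y∈ z∈ front le = hamThroughClique G c fs (e ∷ l ∷ []) uniq
        (λ fv fw → clique (out fv) (out fw)) front
        (λ fw → clique (out fw) oe (λ { refl → notIn fw }) ∷ Adj-sym G le ∷ [-])
        where
        out : ∀ {w} → Free G c fs (e ∷ l ∷ []) w → Out x y z w
        out = free⇒out {c} {fs} {e ∷ l ∷ []} oc x∈ y∈ z∈
        notIn : ¬ Free G c fs (e ∷ l ∷ []) e
        notIn (inj₁ e≡c) = c≢e (sym e≡c)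
        notIn (inj₂ e∉)  = e∉ (there (∈-++⁺ʳ fs (here refl)))

      endOut : Adj G x y → Adj G y z → ∀ {c} → Out x y z c → Adj G x c → HamPath G
      endOut xy yz {c} oc@(c≢x , c≢y , c≢z) xc = closedPath c (x ∷ y ∷ z ∷ []) oc
        ((c≢x ∷ c≢y ∷ c≢z ∷ []) ∷ (x≢y ∷ x≢z ∷ []) ∷ (y≢z ∷ []) ∷ [] ∷ [])
        (there (here refl)) (there (there (here refl))) (there (there (there (here refl))))
        (Adj-sym G xc ∷ xy ∷ yz ∷ [-])

    abstract
      outNeighbour? : ∀ x y z v → Dec (∃[ c ] (Adj G v c × Out x y z c))
      outNeighbour? x y z v = Fin.any? (λ c → (adj G v c Bool.≟ true) ×-dec out? x y z c)

    -- It is enough that an end of the path x, y, z has a neighbour in the clique. If neither end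
    -- has one and x, z are not adjacent, then x and z have only y as a neighbour, against Hall. If
    -- they are adjacent, the triangle can be traversed from any vertex, and connectedness gives an
    -- edge that leaves it.
    connectedTriple : ∀ {x y z} → Outside x y z → Adj G x y → Adj G y z → HamPath G
    connectedTriple {x} {y} {z} O xy yz with outNeighbour? x y z x | outNeighbour? x y z z
    ... | yes (c , xc , oc) | _ = endOut O xy yz oc xc
    ... | no _ | yes (c , zc , (c≢x , c≢y , c≢z)) =
      endOut (swap₁₂ (swap₂₃ (swap₁₂ O))) (Adj-sym G yz) (Adj-sym G xy) (c≢z , c≢y , c≢x) zc
    ... | no x-in | no z-in with adj G x z Bool.≟ true
    ...   | no xz∉ with hallList (y ∷ []) ((Outside.x≢z O ∷ []) ∷ [] ∷ []) ≤-refl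
    ...     | _ , w , here refl , w∉ , xw =
      contradiction (w , xw , (≢-sym (Adj⇒≢ G xw) , (λ { refl → w∉ (here refl) }) , (λ { refl → xz∉ xw }))) x-in
    ...     | _ , w , there (here refl) , w∉ , zw =
      contradiction (w , zw , ((λ { refl → xz∉ (Adj-sym G zw) }) , (λ { refl → w∉ (here refl) }) , ≢-sym (Adj⇒≢ G zw))) z-in
    connectedTriple {x} {y} {z} O xy yz | no x-in | no z-in | yes xz
      with escapeList {x ∷ y ∷ z ∷ []} (here refl) (proj₂ (fresh (x ∷ y ∷ z ∷ []) 3<n))
    ... | s , t , s∈ , t∉ , st = leave s∈ st
      where
      ot : Out x y z t
      ot = (λ { refl → t∉ (here refl) }) , (λ { refl → t∉ (there (here refl)) }) , (λ { refl → t∉ (there (there (here refl))) })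
      leave : ∀ {s} → s ∈ x ∷ y ∷ z ∷ [] → Adj G s t → HamPath G
      leave (here refl) st = contradiction (t , st , ot) x-in
      leave (there (there (here refl))) st = contradiction (t , st , ot) z-in
      leave (there (here refl)) st = endOut (swap₁₂ O) (Adj-sym G xy) xz (proj₁ (proj₂ ot) , proj₁ ot , proj₂ (proj₂ ot)) st

    -- A path exists as soon as the edge x y and the vertex z reach the clique at two different
    -- vertices. Otherwise all exits are one vertex e, and x, y form a pair and z a leaf attached to
    -- e, which is what `notExtremal` forbids.
    edgeAndVertex : ∀ {x y z} → Outside x y z → Adj G x y → ¬ Adj G x z → ¬ Adj G y z → HamPath G
    edgeAndVertex {x} {y} {z} O xy xz∉ yz∉
      with Fin.any? (λ c → Fin.any? (λ e → out? x y z c ×-dec out? x y z e ×-dec ¬? (c Fin.≟ e) ×-dec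
        (adj G z e Bool.≟ true) ×-dec ((adj G x c Bool.≟ true) ⊎-dec (adj G y c Bool.≟ true))))
    ... | yes (c , e , oc@(c≢x , c≢y , c≢z) , oe@(e≢x , e≢y , e≢z) , c≢e , ze , inj₁ xc) =
      twoEnded O c (x ∷ y ∷ []) e z oc oe c≢e
        ((c≢x ∷ c≢y ∷ c≢e ∷ c≢z ∷ []) ∷ (x≢y ∷ ≢-sym e≢x ∷ x≢z ∷ []) ∷ (≢-sym e≢y ∷ y≢z ∷ []) ∷ (e≢z ∷ []) ∷ [] ∷ [])
        (there (here refl)) (there (there (here refl))) (there (there (there (there (here refl)))))
        (Adj-sym G xc ∷ xy ∷ [-]) ze
      where open Outside O
    ... | yes (c , e , oc@(c≢x , c≢y , c≢z) , oe@(e≢x , e≢y , e≢z) , c≢e , ze , inj₂ yc) =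
      twoEnded O c (y ∷ x ∷ []) e z oc oe c≢e
        ((c≢y ∷ c≢x ∷ c≢e ∷ c≢z ∷ []) ∷ (≢-sym x≢y ∷ ≢-sym e≢y ∷ y≢z ∷ []) ∷ (≢-sym e≢x ∷ x≢z ∷ []) ∷ (e≢z ∷ []) ∷ [] ∷ [])
        (there (there (here refl))) (there (here refl)) (there (there (there (there (here refl)))))
        (Adj-sym G yc ∷ Adj-sym G xy ∷ [-]) ze
      where open Outside O
    ... | no none = ⊥-elim (extremal
        (escapeList {z ∷ []} {z} {x} (here refl) (λ { (here x≡z) → x≢z x≡z }))
        (escapeList {x ∷ y ∷ []} {x} {z} (here refl) (λ { (here z≡x) → x≢z (sym z≡x) ; (there (here z≡y)) → y≢z (sym z≡y) })))
      where
      open Outside O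
      out-z : ∀ {w} → Adj G z w → Out x y z w
      out-z zw = (λ { refl → xz∉ (Adj-sym G zw) }) , (λ { refl → yz∉ (Adj-sym G zw) }) , ≢-sym (Adj⇒≢ G zw)
      out-x : ∀ {w} → Adj G x w → w ≢ y → Out x y z w
      out-x xw w≢y = ≢-sym (Adj⇒≢ G xw) , w≢y , λ { refl → xz∉ xw }
      out-y : ∀ {w} → Adj G y w → w ≢ x → Out x y z w
      out-y yw w≢x = w≢x , ≢-sym (Adj⇒≢ G yw) , λ { refl → yz∉ yw }
      meet : ∀ {c e} → Out x y z c → Adj G z e → Adj G x c ⊎ Adj G y c → c ≡ e
      meet {c} {e} oc ze xyc with c Fin.≟ e
      ... | yes c≡e = c≡e
      ... | no  c≢e = contradiction (c , e , oc , out-z ze , c≢e , ze , xyc) none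
      extremal : ∃[ s ] ∃[ t ] (s ∈ z ∷ [] × t ∉ z ∷ [] × Adj G s t) →
        ∃[ s ] ∃[ t ] (s ∈ x ∷ y ∷ [] × t ∉ x ∷ y ∷ [] × Adj G s t) → ⊥
      extremal (_ , e , here refl , _ , ze) (_ , c , s∈ , c∉ , sc) =
        notExtremal e≢x e≢y e≢z x≢y x≢z y≢z
          (λ zw → trans (sym (meet oc zw xyc)) (meet oc ze xyc))
          (λ {w} xw → ends (w Fin.≟ y) (λ w≢y → meet (out-x xw w≢y) ze (inj₁ xw)))
          (λ {w} yw → ends (w Fin.≟ x) (λ w≢x → meet (out-y yw w≢x) ze (inj₂ yw)))
        where
        oe = out-z ze
        e≢x = proj₁ oe
        e≢y = proj₁ (proj₂ oe)
        e≢z = proj₂ (proj₂ oe)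
        choose : ∀ {s} → s ∈ x ∷ y ∷ [] → Adj G s c → Adj G x c ⊎ Adj G y c
        choose (here refl) sc = inj₁ sc
        choose (there (here refl)) sc = inj₂ sc
        xyc : Adj G x c ⊎ Adj G y c
        xyc = choose s∈ sc
        oc : Out x y z c
        oc = (λ { refl → c∉ (here refl) }) , (λ { refl → c∉ (there (here refl)) }) ,
          λ { refl → absurd xyc }
          where
          absurd : Adj G x z ⊎ Adj G y z → ⊥
          absurd (inj₁ xz) = xz∉ xz
          absurd (inj₂ yz) = yz∉ yz
        ends : ∀ {w v} → Dec (w ≡ v) → (w ≢ v → w ≡ e) → w ≡ v ⊎ w ≡ e
        ends (yes w≡v) _ = inj₁ w≡v
        ends (no w≢v)  f = inj₂ (f w≢v)

    record Matching (x y z : Fin n) : Set where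
      constructor matching
      field
        {cx cy cz} : Fin n
        x~ : Adj G x cx
        y~ : Adj G y cy
        z~ : Adj G z cz
        cx≢cy : cx ≢ cy
        cx≢cz : cx ≢ cz
        cy≢cz : cy ≢ cz

    flip₁₂ : ∀ {x y z} → Matching x y z → Matching y x z
    flip₁₂ (matching x y z xy xz yz) = matching y x z (≢-sym xy) yz xz

    flip₂₃ : ∀ {x y z} → Matching x y z → Matching x z y
    flip₂₃ (matching x y z xy xz yz) = matching x z y xz xy (≢-sym yz)

    hasNeighbour : ∀ x → ∃[ c ] Adj G x c
    hasNeighbour x with hallList {x ∷ []} [] ([] ∷ []) ≤-refl
    ... | _ , c , here refl , _ , xc = c , xc

    -- The augmentation step of Hall's theorem. If z has only cy to offer, Hall for y and z against
    -- cy gives one of them a new neighbour v; should v be cx, then x moves over to its spare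
    -- neighbour e.
    matchSpare : ∀ {x y z cx e cy} → y ≢ z → Adj G x cx → Adj G x e → Adj G y cy → cx ≢ e → e ≢ cy → cx ≢ cy → Matching x y z
    matchSpare {x} {y} {z} {cx} {e} {cy} y≢z xcx xe ycy cx≢e e≢cy cx≢cy with hasNeighbour z
    ... | w , zw with w Fin.≟ cx | w Fin.≟ cy
    ...   | yes refl | _      = matching xe ycy zw e≢cy (≢-sym cx≢e) (≢-sym cx≢cy)
    ...   | no w≢cx | no w≢cy = matching xcx ycy zw cx≢cy (≢-sym w≢cx) (≢-sym w≢cy)
    ...   | no _    | yes refl with hallList {y ∷ z ∷ []} (cy ∷ []) ((y≢z ∷ []) ∷ [] ∷ []) ≤-refl
    ...     | _ , v , there (here refl) , v∉ , zv with v Fin.≟ cx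
    ...       | yes refl = matching xe ycy zv e≢cy (≢-sym cx≢e) (≢-sym cx≢cy)
    ...       | no v≢cx  = matching xcx ycy zv cx≢cy (≢-sym v≢cx) (λ eq → v∉ (here (sym eq)))
    matchSpare {x} {y} {z} {cx} {e} {cy} y≢z xcx xe ycy cx≢e e≢cy cx≢cy
          | w , zw | no _ | yes refl | _ , v , here refl , v∉ , yv with v Fin.≟ cx
    ...       | yes refl = matching xe yv zw (≢-sym cx≢e) e≢cy cx≢cy
    ...       | no v≢cx  = matching xcx yv zw (≢-sym v≢cx) cx≢cy (λ eq → v∉ (here eq))

    matchPair : ∀ {x y} → x ≢ y → ∃[ cx ] ∃[ cy ] (Adj G x cx × Adj G y cy × cx ≢ cy)
    matchPair {x} {y} x≢y with hasNeighbour x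
    ... | cx , xcx with hallList {x ∷ y ∷ []} (cx ∷ []) ((x≢y ∷ []) ∷ [] ∷ []) ≤-refl
    ...   | _ , e , there (here refl) , e∉ , ye = cx , e , xcx , ye , λ eq → e∉ (here (sym eq))
    ...   | _ , e , here refl , e∉ , xe with hasNeighbour y
    ...     | cy , ycy with cy Fin.≟ cx
    ...       | yes refl = e , cy , xe , ycy , λ eq → e∉ (here eq)
    ...       | no cy≢cx = cx , cy , xcx , ycy , ≢-sym cy≢cx

    -- Once x and y are matched, Hall against {cx, cy} gives a new neighbour e: either z takes it,
    -- or it is the spare neighbour from which `matchSpare` augments.
    matchTriple : ∀ {x y z} → x ≢ y → x ≢ z → y ≢ z → Matching x y z
    matchTriple {x} {y} {z} x≢y x≢z y≢z with matchPair x≢y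
    ... | cx , cy , xcx , ycy , cx≢cy
      with hallList {x ∷ y ∷ z ∷ []} (cx ∷ cy ∷ []) ((x≢y ∷ x≢z ∷ []) ∷ (y≢z ∷ []) ∷ [] ∷ []) ≤-refl
    ...   | _ , e , there (there (here refl)) , e∉ , ze =
      matching xcx ycy ze cx≢cy (λ eq → e∉ (here (sym eq))) (λ eq → e∉ (there (here (sym eq))))
    ...   | _ , e , here refl , e∉ , xe =
      matchSpare y≢z xcx xe ycy (λ eq → e∉ (here (sym eq))) (λ eq → e∉ (there (here eq))) cx≢cy
    ...   | _ , e , there (here refl) , e∉ , ye =
      flip₁₂ (matchSpare x≢z ycy ye xcx (λ eq → e∉ (there (here (sym eq)))) (λ eq → e∉ (here eq)) (≢-sym cx≢cy))

    Independent : Fin n → Fin n → Fin n → Set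
    Independent x y z = ∀ {v w} → v ∈ x ∷ y ∷ z ∷ [] → w ∈ x ∷ y ∷ z ∷ [] → ¬ Adj G v w

    independent-out : ∀ {x y z v w} → Independent x y z → v ∈ x ∷ y ∷ z ∷ [] → Adj G v w → Out x y z w
    independent-out ind v∈ vw = (λ { refl → ind v∈ (here refl) vw }) , (λ { refl → ind v∈ (there (here refl)) vw }) ,
      λ { refl → ind v∈ (there (there (here refl))) vw }

    -- A path has two ends, so one of three independent vertices must lie inside it. A second
    -- neighbour e of x makes this possible: the path is y, cy, e, x, cx, the rest of the clique,
    -- cz, z, with e and cy merged when they coincide.
    extraNeighbour : ∀ {x y z} → Outside x y z → Independent x y z → (M : Matching x y z) →
      ∀ {e} → Adj G x e → e ≢ Matching.cx M → e ≢ Matching.cz M → HamPath G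
    extraNeighbour {x} {y} {z} O ind M {e} xe e≢cx e≢cz with e Fin.≟ Matching.cy M
    ... | yes refl = twoEnded O cx (x ∷ cy ∷ y ∷ []) cz z ocx ocz cx≢cz
        ((proj₁ ocx ∷ cx≢cy ∷ proj₁ (proj₂ ocx) ∷ cx≢cz ∷ proj₂ (proj₂ ocx) ∷ []) ∷
         (≢-sym (proj₁ ocy) ∷ x≢y ∷ ≢-sym (proj₁ ocz) ∷ x≢z ∷ []) ∷
         (proj₁ (proj₂ ocy) ∷ cy≢cz ∷ proj₂ (proj₂ ocy) ∷ []) ∷
         (≢-sym (proj₁ (proj₂ ocz)) ∷ y≢z ∷ []) ∷ (proj₂ (proj₂ ocz) ∷ []) ∷ [] ∷ [])
        (there (here refl)) (there (there (there (here refl)))) (there (there (there (there (there (here refl))))))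
        (Adj-sym G x~ ∷ xe ∷ Adj-sym G y~ ∷ [-]) z~
      where
      open Outside O
      open Matching M
      ocx = independent-out ind (here refl) x~
      ocy = independent-out ind (there (here refl)) y~
      ocz = independent-out ind (there (there (here refl))) z~
    ... | no e≢cy = twoEnded O cx (x ∷ e ∷ cy ∷ y ∷ []) cz z ocx ocz cx≢cz
        ((proj₁ ocx ∷ ≢-sym e≢cx ∷ cx≢cy ∷ proj₁ (proj₂ ocx) ∷ cx≢cz ∷ proj₂ (proj₂ ocx) ∷ []) ∷
         (≢-sym (proj₁ oe) ∷ ≢-sym (proj₁ ocy) ∷ x≢y ∷ ≢-sym (proj₁ ocz) ∷ x≢z ∷ []) ∷
         (e≢cy ∷ proj₁ (proj₂ oe) ∷ e≢cz ∷ proj₂ (proj₂ oe) ∷ []) ∷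
         (proj₁ (proj₂ ocy) ∷ cy≢cz ∷ proj₂ (proj₂ ocy) ∷ []) ∷
         (≢-sym (proj₁ (proj₂ ocz)) ∷ y≢z ∷ []) ∷ (proj₂ (proj₂ ocz) ∷ []) ∷ [] ∷ [])
        (there (here refl)) (there (there (there (there (here refl))))) (there (there (there (there (there (there (here refl)))))))
        (Adj-sym G x~ ∷ xe ∷ clique oe ocy e≢cy ∷ Adj-sym G y~ ∷ [-]) z~
      where
      open Outside O
      open Matching M
      ocx = independent-out ind (here refl) x~
      ocy = independent-out ind (there (here refl)) y~
      ocz = independent-out ind (there (there (here refl))) z~
      oe  = independent-out ind (here refl) xe

    -- The vertex cz is reserved for the exit to z. If e = cz, exchanging y and z reserves cy
    -- instead, which differs from e.
    manyNeighbours : ∀ {x y z} → Outside x y z → Independent x y z → (M : Matching x y z) →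
      ∀ {e} → Adj G x e → e ≢ Matching.cx M → HamPath G
    manyNeighbours O ind M {e} xe e≢cx with e Fin.≟ Matching.cz M
    ... | no e≢cz = extraNeighbour O ind M xe e≢cx e≢cz
    ... | yes refl = extraNeighbour (swap₂₃ O) (λ v∈ w∈ → ind (back v∈) (back w∈)) (flip₂₃ M) xe e≢cx (≢-sym (Matching.cy≢cz M))
      where
      back : ∀ {a b c v : Fin n} → v ∈ a ∷ c ∷ b ∷ [] → v ∈ a ∷ b ∷ c ∷ []
      back (here refl) = here refl
      back (there (here refl)) = there (there (here refl))
      back (there (there (here refl))) = there (here refl)

    independentTriple : ∀ {x y z} → Outside x y z → Independent x y z → HamPath G
    independentTriple {x} {y} {z} O ind = decide (spare x cx) (spare y cy) (spare z cz)
      where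
      open Outside O
      M : Matching x y z
      M = matchTriple x≢y x≢z y≢z
      open Matching M
      spare : ∀ v c → Dec (∃[ e ] (Adj G v e × e ≢ c))
      spare v c = Fin.any? (λ e → (adj G v e Bool.≟ true) ×-dec ¬? (e Fin.≟ c))
      rot₁ : ∀ {v} → v ∈ y ∷ x ∷ z ∷ [] → v ∈ x ∷ y ∷ z ∷ []
      rot₁ (here refl) = there (here refl)
      rot₁ (there (here refl)) = here refl
      rot₁ (there (there v∈)) = there (there v∈)
      rot₂ : ∀ {v} → v ∈ z ∷ x ∷ y ∷ [] → v ∈ x ∷ y ∷ z ∷ []
      rot₂ (here refl) = there (there (here refl))
      rot₂ (there (here refl)) = here refl
      rot₂ (there (there (here refl))) = there (here refl)
      only : ∀ {v c} → ¬ (∃[ e ] (Adj G v e × e ≢ c)) → ∀ {w} → Adj G v w → w ≡ c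
      only {v} {c} none {w} vw with w Fin.≟ c
      ... | yes w≡c = w≡c
      ... | no  w≢c = contradiction (w , vw , w≢c) none
      matched : ∀ l → Adj G (lookup (x ∷ y ∷ z ∷ []) l) (lookup (cx ∷ cy ∷ cz ∷ []) l)
      matched zero             = x~
      matched (suc zero)       = y~
      matched (suc (suc zero)) = z~
      decide : Dec (∃[ e ] (Adj G x e × e ≢ cx)) → Dec (∃[ e ] (Adj G y e × e ≢ cy)) → Dec (∃[ e ] (Adj G z e × e ≢ cz)) → HamPath G
      decide (yes (e , xe , e≢)) _ _ = manyNeighbours O ind M xe e≢
      decide _ (yes (e , ye , e≢)) _ = manyNeighbours (swap₁₂ O) (λ v∈ w∈ → ind (rot₁ v∈) (rot₁ w∈)) (flip₁₂ M) ye e≢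
      decide _ _ (yes (e , ze , e≢)) =
        manyNeighbours (swap₁₂ (swap₂₃ O)) (λ v∈ w∈ → ind (rot₂ v∈) (rot₂ w∈)) (flip₁₂ (flip₂₃ M)) ze e≢
      decide (no x-only) (no y-only) (no z-only) = ⊥-elim (noThreePendants
        (lookup (x ∷ y ∷ z ∷ [])) (lookup (cx ∷ cy ∷ cz ∷ []))
        (lookup-injective ((x≢y ∷ x≢z ∷ []) ∷ (y≢z ∷ []) ∷ [] ∷ []) _ _)
        (lookup-injective ((cx≢cy ∷ cx≢cz ∷ []) ∷ (cy≢cz ∷ []) ∷ [] ∷ []) _ _)
        (λ l l′ eq → ind (∈-lookup l′) (subst (_∈ x ∷ y ∷ z ∷ []) eq (∈-lookup l)) (matched l′)) leafOnly)
        where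
        leafOnly : ∀ l {w} → Adj G (lookup (x ∷ y ∷ z ∷ []) l) w → w ≡ lookup (cx ∷ cy ∷ cz ∷ []) l
        leafOnly zero             = only x-only
        leafOnly (suc zero)       = only y-only
        leafOnly (suc (suc zero)) = only z-only

    threeOutside : ∀ {x y z} → Outside x y z → HamPath G
    threeOutside {x} {y} {z} O with adj G x y in xy | adj G x z in xz | adj G y z in yz
    ... | true  | _     | true  = connectedTriple O xy yz
    ... | true  | true  | false = connectedTriple (swap₁₂ O) (Adj-sym G xy) xz
    ... | false | true  | true  = connectedTriple (swap₂₃ O) xz (Adj-sym G yz)
    ... | true  | false | false = edgeAndVertex O xy (Bool.not-¬ xz) (Bool.not-¬ yz)
    ... | false | true  | false = edgeAndVertex (swap₂₃ O) xz (Bool.not-¬ xy) (Bool.not-¬ yz ∘ Adj-sym G)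
    ... | false | false | true  = edgeAndVertex (swap₂₃ (swap₁₂ O)) yz (Bool.not-¬ xy ∘ Adj-sym G) (Bool.not-¬ xz ∘ Adj-sym G)
    ... | false | false | false = independentTriple O ind
      where
      ind : Independent x y z
      ind (here refl) (here refl) = λ e → Adj⇒≢ G e refl
      ind (here refl) (there (here refl)) = Bool.not-¬ xy
      ind (here refl) (there (there (here refl))) = Bool.not-¬ xz
      ind (there (here refl)) (here refl) = Bool.not-¬ xy ∘ Adj-sym G
      ind (there (here refl)) (there (here refl)) = λ e → Adj⇒≢ G e refl
      ind (there (here refl)) (there (there (here refl))) = Bool.not-¬ yz
      ind (there (there (here refl))) (here refl) = Bool.not-¬ xz ∘ Adj-sym G
      ind (there (there (here refl))) (there (here refl)) = Bool.not-¬ yz ∘ Adj-sym G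
      ind (there (there (here refl))) (there (there (here refl))) = λ e → Adj⇒≢ G e refl

-- Closed graphs and the passage to the closure.

module Closure where

  open Defs hiding (_+_; _*_; _≤_; _≈_; sum)
  open Counting
  open Paths
  open TestVectors
  open Cases
  open import Data.List.Membership.Propositional using (_∉_)
  open import Data.List.Membership.Propositional.Properties using (∈-lookup)
  open import Data.Nat.Base
  open import Data.Nat.Properties
  open import Relation.Unary using (Decidable)

  -- This stands in for a maximum: failure at k + 1 is the only form in which maximality is used.
  lastTrue : ∀ {P : ℕ → Set} → Decidable P → ∀ {a} f → P a → ¬ P (f + a) → ∃[ k ] (a ≤ k × P k × ¬ P (suc k))
  lastTrue P? zero Pa ¬Pa = contradiction Pa ¬Pa
  lastTrue {P} P? {a} (suc f) Pa ¬Pf with P? (suc a)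
  ... | no  ¬Pa+ = a , ≤-refl , Pa , ¬Pa+
  ... | yes Pa+ with lastTrue P? f Pa+ (subst (λ x → ¬ P x) (sym (+-suc f a)) ¬Pf)
  ...   | k , a<k , Pk , ¬Pk+ = k , <⇒≤ a<k , Pk , ¬Pk+

  deg≤n : ∀ {n} (G : Graph n) x → deg G x ≤ n
  deg≤n {n} G x = ≤-trans (∑-≤ 1 (λ y → 𝟙≤1 (adj G x y))) (≤-reflexive (*-identityʳ n))

  Closed : ∀ {n} → Graph n → Set
  Closed {n} G = ∀ {x y} → x ≢ y → adj G x y ≡ false → 2 + (deg G x + deg G y) ≤ n

  module _ {n m} (n≡4+m : n ≡ 4 + m) (7≤m : 7 ≤ m) {G : Graph n} (good : Good m G) where

    private
      3<n : 3 < n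
      3<n = subst (3 <_) (sym n≡4+m) (m≤m+n 4 m)

      FarPair : ℕ → ℕ → Fin n → Fin n → Set
      FarPair k d u v = u ≢ v × adj G u v ≡ false × k ≤ deg G u × d ≤ deg G v

      farPair? : ∀ k d → Dec (∃[ u ] ∃[ v ] FarPair k d u v)
      farPair? k d = Fin.any? (λ u → Fin.any? (λ v →
        ¬? (u Fin.≟ v) ×-dec (adj G u v Bool.≟ false) ×-dec (k ≤? deg G u) ×-dec (d ≤? deg G v)))

    module _ (closed : Closed G) where

      -- A far pair (u, v) with min (deg u) (deg v) largest, and then deg v largest.
      noFarPair : ¬ (∃[ u ] ∃[ v ] FarPair 3 3 u v)
      noFarPair pair
        -- The search ends within `suc n` steps because no degree exceeds n.
        with lastTrue (λ k → farPair? k k) (suc n) pair (λ (u , _ , _ , _ , big , _) →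
          contradiction (≤-trans (≤-trans (s≤s (m≤m+n n 3)) big) (deg≤n G u)) (<⇒≱ ≤-refl))
      ... | k , 3≤k , kPair , ¬kPair
        with lastTrue (farPair? k) (suc n) kPair (λ (_ , v , _ , _ , _ , big) →
          contradiction (≤-trans (≤-trans (s≤s (m≤m+n n k)) big) (deg≤n G v)) (<⇒≱ ≤-refl))
      ...   | d , k≤d , (u , v , u≢v , uv , k≤u , d≤v) , ¬dPair =
        noHighPair n≡4+m 7≤m good u≢v uv v-far u-far closed (≤-trans 3≤k k≤u) u≤v
        where
        vu : adj G v u ≡ false
        vu = trans (adj-sym G v u) uv
        u≤k : deg G u ≤ k
        u≤k = ≮⇒≥ λ k<u → case k<u (k <? deg G v)
          where
          case : k < deg G u → Dec (k < deg G v) → ⊥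
          case k<u (yes k<v) = ¬kPair (u , v , u≢v , uv , k<u , k<v)
          -- Here d ≤ deg v ≤ k < deg u, so the pair (v, u) would improve on d.
          case k<u (no  k≮v) = ¬dPair (v , u , ≢-sym u≢v , vu , ≤-trans k≤d d≤v ,
            ≤-trans (s≤s (≤-trans d≤v (≮⇒≥ k≮v))) k<u)
        u≤v : deg G u ≤ deg G v
        u≤v = ≤-trans u≤k (≤-trans k≤d d≤v)
        u-far : ∀ {w} → adj G u w ≡ false → u ≢ w → deg G w ≤ deg G v
        u-far {w} uw u≢w = ≤-trans (≮⇒≥ (λ d<w → ¬dPair (u , w , u≢w , uw , k≤u , d<w))) d≤v
        v-far : ∀ {w} → adj G v w ≡ false → v ≢ w → deg G w ≤ deg G u
        v-far {w} vw v≢w = ≤-trans (≮⇒≥ λ k<w → case k<w (k <? deg G v)) k≤u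
          where
          case : k < deg G w → Dec (k < deg G v) → ⊥
          case k<w (yes k<v) = ¬kPair (v , w , v≢w , vw , k<v , k<w)
          case k<w (no  k≮v) = ¬dPair (v , w , v≢w , vw , ≤-trans k≤d d≤v ,
            ≤-trans (s≤s (≤-trans d≤v (≮⇒≥ k≮v))) k<w)

      private
        Low : Fin n → Set
        Low x = deg G x ≤ 2

      -- Low vertices are preferred, so if a low vertex is left after three picks, then the three
      -- picks are low as well and `noFourLow` applies.
      pickLow : ∀ (xs : List (Fin n)) → length xs < n → ∃[ x ] (x ∉ xs × (∀ {y} → y ∉ xs → Low y → Low x))
      pickLow xs lt with Fin.any? (λ x → ¬? (x ∈? xs) ×-dec (deg G x ≤? 2))
        where open import Data.List.Membership.DecPropositional (Fin._≟_ {n}) using (_∈?_)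
      ... | yes (x , x∉ , low) = x , x∉ , λ _ _ → low
      ... | no  none = let x , x∉ = fresh xs lt in x , x∉ , λ y∉ low → contradiction (_ , y∉ , low) none

      hamPath-closed : HamPath G
      hamPath-closed with pickLow [] (<-trans (s≤s z≤n) 3<n)
      ... | a , _ , a-low with pickLow (a ∷ []) (<-trans (s≤s (s≤s z≤n)) 3<n)
      ...   | b , b∉ , b-low with pickLow (b ∷ a ∷ []) (<-trans (s≤s (s≤s (s≤s z≤n))) 3<n)
      ...     | c , c∉ , c-low = threeOutside good 3<n (outside
          (λ { refl → b∉ (here refl) }) (λ { refl → c∉ (there (here refl)) }) (λ { refl → c∉ (here refl) }) clique)
        where
        high : ∀ {w} → Out good 3<n a b c w → 3 ≤ deg G w
        high {w} (w≢a , w≢b , w≢c) = ≰⇒> λ low → noFourLow n≡4+m 7≤m good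
            (lookup (a ∷ b ∷ c ∷ w ∷ [])) (lookup-injective distinct _ _) (λ i → All.lookup (all-low low) (∈-lookup i))
          where
          distinct : Unique (a ∷ b ∷ c ∷ w ∷ [])
          distinct = ((λ { refl → b∉ (here refl) }) ∷ (λ { refl → c∉ (there (here refl)) }) ∷ ≢-sym w≢a ∷ [])
            ∷ ((λ { refl → c∉ (here refl) }) ∷ ≢-sym w≢b ∷ []) ∷ (≢-sym w≢c ∷ []) ∷ [] ∷ []
          all-low : Low w → All Low (a ∷ b ∷ c ∷ w ∷ [])
          all-low low = a-low (λ ()) low ∷ b-low (λ { (here w≡a) → w≢a w≡a }) low
            ∷ c-low (λ { (here w≡b) → w≢b w≡b ; (there (here w≡a)) → w≢a w≡a }) low ∷ low ∷ []
        clique : ∀ {x y} → Out good 3<n a b c x → Out good 3<n a b c y → x ≢ y → Adj G x y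
        clique {x} {y} ox oy x≢y with adj G x y in xy
        ... | true  = refl
        ... | false = contradiction (x , y , x≢y , xy , high ox , high oy) noFarPair

  ∑deg-addEdge : ∀ {n} (G : Graph n) {u v} (u≢v : u ≢ v) → adj G u v ≡ false →
    ∑ (deg (addEdge G u≢v)) ≡ ∑ (deg G) + 2
  ∑deg-addEdge G {u} {v} u≢v uv = begin
    ∑ (deg (addEdge G u≢v))
      ≡⟨ sum-cong-≗ (deg-addEdge G u≢v uv) ⟩
    ∑ (λ x → deg G x + (𝟙 (u == x) + 𝟙 (v == x)))
      ≡⟨ ∑-distrib-+ (deg G) _ ⟩
    ∑ (deg G) + ∑ (λ x → 𝟙 (u == x) + 𝟙 (v == x))
      ≡⟨ cong (∑ (deg G) +_) (trans (∑-distrib-+ (λ x → 𝟙 (u == x)) _) (cong₂ _+_ (∑-𝟙== u) (∑-𝟙== v))) ⟩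
    ∑ (deg G) + 2 ∎
    where open ≡-Reasoning

  good⇒hamPath : ∀ {n m} → n ≡ 4 + m → 7 ≤ m → (G : Graph n) → Good m G → HamPath G
  good⇒hamPath {n} {m} n≡4+m 7≤m G good = go (n * n) G good (m≤n+m (n * n) _)
    where
    -- The fuel bounds what the degree sum lacks to n * n; each added edge raises the degree sum by
    -- 2.
    go : ∀ f (G : Graph n) → Good m G → n * n ≤ ∑ (deg G) + f → HamPath G
    go f G good bound with Fin.any? (λ u → Fin.any? (λ v →
      ¬? (u Fin.≟ v) ×-dec (adj G u v Bool.≟ false) ×-dec (n ≤? suc (deg G u + deg G v))))
    ... | no none = hamPath-closed n≡4+m 7≤m good
          (λ {x} {y} x≢y xy → ≰⇒> (λ big → none (x , y , x≢y , xy , big)))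
    go zero G good bound | yes (u , v , u≢v , uv , _) = contradiction
      (≤-trans (≤-reflexive (sym (trans (∑deg-addEdge G u≢v uv) (+-comm _ 2)))) (∑-≤ n (deg≤n (addEdge G u≢v))))
      (<⇒≱ (s≤s (m≤n⇒m≤1+n (subst (n * n ≤_) (+-identityʳ _) bound))))
    go (suc f) G good bound | yes (u , v , u≢v , uv , big) =
      bondyChvátal G u≢v uv big (go f (addEdge G u≢v) (Good-mono (⊆addEdge G u≢v) good)
        (≤-trans bound (subst (∑ (deg G) + suc f ≤_) (sym (trans (cong (_+ f) (∑deg-addEdge G u≢v uv)) (+-assoc (∑ (deg G)) 2 f)))
          (+-monoʳ-≤ (∑ (deg G)) (n≤1+n (suc f))))))

-- The pairing inequality for rational approximations.

module Rationals where

  open Defs using (Graph; adj; adj-sym)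
  open import Algebra.Bundles using (CommutativeRing)
  import Algebra.Properties.Semiring.Sum as SemiringSum
  import Data.Integer.Base
  open import Data.Rational.Base
  open import Data.Rational.Properties
  open import Level using (0ℓ)
  open import Tactic.RingSolver using (solve-∀)
  open import Tactic.RingSolver.Core.AlmostCommutativeRing using (AlmostCommutativeRing; fromCommutativeRing)

  open SemiringSum (CommutativeRing.semiring +-*-commutativeRing) public
    using (sum-cong-≗; ∑-distrib-+; ∑-comm; *-distribˡ-sum; *-distribʳ-sum; ∑-permute) renaming (sum to ∑)

  ℚ-ring : AlmostCommutativeRing 0ℓ 0ℓ
  ℚ-ring = fromCommutativeRing +-*-commutativeRing (λ x → dec⇒maybe (0ℚ ≟ x))

  0≤+ : ∀ {p q} → 0ℚ ≤ p → 0ℚ ≤ q → 0ℚ ≤ p + q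
  0≤+ = +-mono-≤

  *-mono-≤ˡ : ∀ {p q r} → 0ℚ ≤ r → p ≤ q → r * p ≤ r * q
  *-mono-≤ˡ {r = r} 0≤r = *-monoˡ-≤-nonNeg r {{nonNegative 0≤r}}

  *-mono-≤ʳ : ∀ {p q r} → 0ℚ ≤ r → p ≤ q → p * r ≤ q * r
  *-mono-≤ʳ {r = r} 0≤r = *-monoʳ-≤-nonNeg r {{nonNegative 0≤r}}

  0≤* : ∀ {p q} → 0ℚ ≤ p → 0ℚ ≤ q → 0ℚ ≤ p * q
  0≤* {p} {q} 0≤p 0≤q = subst (_≤ p * q) (*-zeroʳ p) (*-mono-≤ˡ 0≤p 0≤q)

  *-mono-≤ : ∀ {p q r s} → 0ℚ ≤ q → 0ℚ ≤ r → p ≤ q → r ≤ s → p * r ≤ q * s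
  *-mono-≤ 0≤q 0≤r p≤q r≤s = ≤-trans (*-mono-≤ʳ 0≤r p≤q) (*-mono-≤ˡ 0≤q r≤s)

  ≤-by : ∀ {p q r} → 0ℚ ≤ r → q ≡ p + r → p ≤ q
  ≤-by {p} {q} {r} 0≤r q≡p+r = subst₂ _≤_ (+-identityʳ p) (sym q≡p+r) (+-monoʳ-≤ p 0≤r)

  p≤q⇒0≤q-p : ∀ {p q} → p ≤ q → 0ℚ ≤ q - p
  p≤q⇒0≤q-p {p} {q} p≤q = subst (_≤ q - p) (+-inverseʳ p) (+-monoˡ-≤ (- p) p≤q)

  p≤p+q : ∀ {p q} → 0ℚ ≤ q → p ≤ p + q
  p≤p+q 0≤q = ≤-by 0≤q refl

  p≤q+p : ∀ {p q} → 0ℚ ≤ q → p ≤ q + p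
  p≤q+p {p} {q} 0≤q = ≤-by 0≤q (+-comm q p)

  p≤∣p∣ : ∀ p → p ≤ ∣ p ∣
  p≤∣p∣ (mkℚ (Data.Integer.Base.+ _) _ _) = ≤-refl
  p≤∣p∣ p@(mkℚ Data.Integer.Base.-[1+ _ ] _ _) = ≤-trans (<⇒≤ (negative⁻¹ p)) (0≤∣p∣ p)

  0≤1 : 0ℚ ≤ 1ℚ
  0≤1 = nonNegative⁻¹ 1ℚ

  ∑-mono-≤ : ∀ {n} {f g : Fin n → ℚ} → (∀ i → f i ≤ g i) → ∑ f ≤ ∑ g
  ∑-mono-≤ {zero}  f≤g = ≤-refl
  ∑-mono-≤ {suc n} f≤g = +-mono-≤ (f≤g zero) (∑-mono-≤ (f≤g ∘ suc))

  0≤∑ : ∀ {n} {f : Fin n → ℚ} → (∀ i → 0ℚ ≤ f i) → 0ℚ ≤ ∑ f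
  0≤∑ {zero}  0≤f = ≤-refl
  0≤∑ {suc n} 0≤f = 0≤+ (0≤f zero) (0≤∑ (0≤f ∘ suc))

  term≤∑ : ∀ {n} {f : Fin n → ℚ} → (∀ i → 0ℚ ≤ f i) → ∀ i → f i ≤ ∑ f
  term≤∑ 0≤f zero    = p≤p+q (0≤∑ (0≤f ∘ suc))
  term≤∑ 0≤f (suc i) = ≤-trans (term≤∑ (0≤f ∘ suc) i) (p≤q+p (0≤f zero))

  ∣∑∣≤∑∣∣ : ∀ {n} (f : Fin n → ℚ) → ∣ ∑ f ∣ ≤ ∑ (∣_∣ ∘ f)
  ∣∑∣≤∑∣∣ {zero}  f = ≤-refl
  ∣∑∣≤∑∣∣ {suc n} f = ≤-trans (∣p+q∣≤∣p∣+∣q∣ (f zero) _) (+-monoʳ-≤ ∣ f zero ∣ (∣∑∣≤∑∣∣ (f ∘ suc)))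

  fromBool : Bool → ℚ
  fromBool b = if b then 1ℚ else 0ℚ

  0≤fromBool : ∀ b → 0ℚ ≤ fromBool b
  0≤fromBool true  = 0≤1
  0≤fromBool false = ≤-refl

  Aℚ : ∀ {n} → Graph n → Fin n → Fin n → ℚ
  Aℚ G i j = fromBool (adj G i j)

  module _ {n} (G : Graph n) (R u : ℚ) (y X Δ : Fin n → ℚ) where

    private
      A : Fin n → Fin n → ℚ
      A = Aℚ G

      Y e s : Fin n → ℚ
      Y i = ∣ y i ∣
      e i = ∣ ∑ (λ j → A i j * y j) - R * y i ∣
      s i = (∑ (λ j → A i j * Y j) + e i) - R * Y i

    -- Triangle inequality, with nonnegative A. Here R and y are terms of the sequences for ρ and
    -- its eigenvector and e is the residual of the eigenvalue equation, so |y| satisfies R |y| ≤ A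
    -- |y| + e.
    slack≥0 : ∀ i → 0ℚ ≤ s i
    slack≥0 i = p≤q⇒0≤q-p (begin
      R * Y i                                    ≤⟨ *-mono-≤ʳ (0≤∣p∣ (y i)) (p≤∣p∣ R) ⟩
      ∣ R ∣ * Y i                                ≡⟨ ∣p*q∣≡∣p∣*∣q∣ R (y i) ⟨
      ∣ R * y i ∣                                ≡⟨ cong ∣_∣ (split (∑ (λ j → A i j * y j)) (R * y i)) ⟩
      ∣ ∑ (λ j → A i j * y j) - (∑ (λ j → A i j * y j) - R * y i) ∣
                                                 ≤⟨ ∣p-q∣≤∣p∣+∣q∣ (∑ (λ j → A i j * y j)) _ ⟩
      ∣ ∑ (λ j → A i j * y j) ∣ + e i            ≤⟨ +-monoˡ-≤ (e i) (∣∑∣≤∑∣∣ (λ j → A i j * y j)) ⟩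
      ∑ (λ j → ∣ A i j * y j ∣) + e i            ≡⟨ cong (_+ e i) (sum-cong-≗ (λ j → trans (∣p*q∣≡∣p∣*∣q∣ (A i j) (y j)) (cong (_* Y j) (0≤p⇒∣p∣≡p (0≤fromBool (adj G i j)))))) ⟩
      ∑ (λ j → A i j * Y j) + e i                ∎)
      where
      open ≤-Reasoning
      split : ∀ a b → b ≡ a - (a - b)
      split = solve-∀ ℚ-ring

    module _ (1≤X : ∀ i → 1ℚ ≤ X i) (0≤Δ : ∀ i → 0ℚ ≤ Δ i)
      (AX≤uX : ∀ i → ∑ (λ j → A i j * X j) + Δ i ≤ u * X i) where

      private
        XY AYX : ℚ
        XY  = ∑ (λ i → X i * Y i)
        AYX = ∑ (λ i → X i * ∑ (λ j → A i j * Y j))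

        0≤X : ∀ i → 0ℚ ≤ X i
        0≤X i = ≤-trans 0≤1 (1≤X i)

        AYX≡ : AYX ≡ ∑ (λ j → Y j * ∑ (λ i → A j i * X i))
        AYX≡ = begin
          ∑ (λ i → X i * ∑ (λ j → A i j * Y j))
            ≡⟨ sum-cong-≗ (λ i → *-distribˡ-sum (X i) (λ j → A i j * Y j)) ⟩
          ∑ (λ i → ∑ (λ j → X i * (A i j * Y j)))
            ≡⟨ ∑-comm (λ i j → X i * (A i j * Y j)) ⟩
          ∑ (λ j → ∑ (λ i → X i * (A i j * Y j)))
            ≡⟨ sum-cong-≗ (λ j → sum-cong-≗ (λ i →
                 trans (rearrange (X i) (A i j) (Y j)) (cong (λ b → Y j * (fromBool b * X i)) (adj-sym G i j)))) ⟩
          ∑ (λ j → ∑ (λ i → Y j * (A j i * X i)))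
            ≡⟨ sum-cong-≗ (λ j → *-distribˡ-sum (Y j) (λ i → A j i * X i)) ⟨
          ∑ (λ j → Y j * ∑ (λ i → A j i * X i)) ∎
          where
          open ≡-Reasoning
          rearrange : ∀ x a y → x * (a * y) ≡ y * (a * x)
          rearrange = solve-∀ ℚ-ring

        AYX≤ : AYX + ∑ (λ j → Δ j * Y j) ≤ u * XY
        AYX≤ = begin
          AYX + ∑ (λ j → Δ j * Y j)
            ≡⟨ cong (_+ ∑ (λ j → Δ j * Y j)) AYX≡ ⟩
          ∑ (λ j → Y j * ∑ (λ i → A j i * X i)) + ∑ (λ j → Δ j * Y j)
            ≡⟨ ∑-distrib-+ (λ j → Y j * ∑ (λ i → A j i * X i)) _ ⟨
          ∑ (λ j → Y j * ∑ (λ i → A j i * X i) + Δ j * Y j)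
            ≡⟨ sum-cong-≗ (λ j → factor (Y j) _ (Δ j)) ⟩
          ∑ (λ j → Y j * (∑ (λ i → A j i * X i) + Δ j))
            ≤⟨ ∑-mono-≤ (λ j → *-mono-≤ˡ (0≤∣p∣ (y j)) (AX≤uX j)) ⟩
          ∑ (λ j → Y j * (u * X j))
            ≡⟨ sum-cong-≗ (λ j → rearrange (Y j) u (X j)) ⟩
          ∑ (λ j → u * (X j * Y j))
            ≡⟨ *-distribˡ-sum u (λ j → X j * Y j) ⟨
          u * XY ∎
          where
          open ≤-Reasoning
          factor : ∀ y a d → y * a + d * y ≡ y * (a + d)
          factor = solve-∀ ℚ-ring
          rearrange : ∀ y u x → y * (u * x) ≡ u * (x * y)
          rearrange = solve-∀ ℚ-ring

        Xs≡ : ∑ (λ i → X i * s i) ≡ (AYX + ∑ (λ i → X i * e i)) - R * XY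
        Xs≡ = begin
          ∑ (λ i → X i * s i)
            ≡⟨ sum-cong-≗ (λ i → expand (X i) _ (e i) R (Y i)) ⟩
          ∑ (λ i → (X i * ∑ (λ j → A i j * Y j) + X i * e i) + (- R) * (X i * Y i))
            ≡⟨ ∑-distrib-+ (λ i → X i * ∑ (λ j → A i j * Y j) + X i * e i) _ ⟩
          ∑ (λ i → X i * ∑ (λ j → A i j * Y j) + X i * e i) + ∑ (λ i → (- R) * (X i * Y i))
            ≡⟨ cong₂ _+_ (∑-distrib-+ (λ i → X i * ∑ (λ j → A i j * Y j)) _)
                         (trans (sym (*-distribˡ-sum (- R) (λ i → X i * Y i))) (sym (neg-distribˡ-* R XY))) ⟩
          (AYX + ∑ (λ i → X i * e i)) - R * XY ∎
          where
          open ≡-Reasoning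
          expand : ∀ x a e r y → x * ((a + e) - r * y) ≡ (x * a + x * e) + (- r) * (x * y)
          expand = solve-∀ ℚ-ring

      -- Everything that the approximation spoils. The first part tends to 0 because the limit of u
      -- is at most ρ, the second because the residuals do.
      defect : ℚ
      defect = ((u - R) ⊔ 0ℚ) * XY + ∑ (λ i → X i * e i)

      -- Symmetry moves A from |y| to X, where A X + Δ ≤ u X bounds it. What remains are two sums of
      -- nonnegative terms, so a small defect makes every slack s and every product Δ |y| small.
      pairing : ∑ (λ i → X i * s i) + ∑ (λ i → Δ i * Y i) ≤ defect
      pairing = begin
        ∑ (λ i → X i * s i) + ∑ (λ i → Δ i * Y i)
          ≡⟨ cong (_+ ∑ (λ i → Δ i * Y i)) Xs≡ ⟩
        ((AYX + E) - R * XY) + ∑ (λ i → Δ i * Y i)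
          ≡⟨ regroup AYX E (R * XY) _ ⟩
        (AYX + ∑ (λ i → Δ i * Y i)) + (E - R * XY)
          ≤⟨ +-monoˡ-≤ (E - R * XY) AYX≤ ⟩
        u * XY + (E - R * XY)
          ≡⟨ factor u XY E R ⟩
        (u - R) * XY + E
          ≤⟨ +-monoˡ-≤ E (*-mono-≤ʳ (0≤∑ (λ i → 0≤* (0≤X i) (0≤∣p∣ (y i)))) (p≤p⊔q (u - R) 0ℚ)) ⟩
        defect ∎
        where
        open ≤-Reasoning
        E : ℚ
        E = ∑ (λ i → X i * e i)
        regroup : ∀ a b c d → ((a + b) - c) + d ≡ (a + d) + (b - c)
        regroup = solve-∀ ℚ-ring
        factor : ∀ u x e r → u * x + (e - r * x) ≡ (u - r) * x + e
        factor = solve-∀ ℚ-ring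

      0≤Xs : ∀ i → 0ℚ ≤ X i * s i
      0≤Xs i = 0≤* (0≤X i) (slack≥0 i)

      0≤ΔY : ∀ i → 0ℚ ≤ Δ i * Y i
      0≤ΔY i = 0≤* (0≤Δ i) (0≤∣p∣ (y i))

      s≤defect : ∀ i → s i ≤ defect
      s≤defect i = begin
        s i                                        ≡⟨ *-identityˡ (s i) ⟨
        1ℚ * s i                                   ≤⟨ *-mono-≤ʳ (slack≥0 i) (1≤X i) ⟩
        X i * s i                                  ≤⟨ term≤∑ 0≤Xs i ⟩
        ∑ (λ i → X i * s i)                        ≤⟨ p≤p+q (0≤∑ 0≤ΔY) ⟩
        ∑ (λ i → X i * s i) + ∑ (λ i → Δ i * Y i)  ≤⟨ pairing ⟩
        defect                                     ∎
        where open ≤-Reasoning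

      ΔY≤defect : ∀ i → Δ i * Y i ≤ defect
      ΔY≤defect i = ≤-trans (term≤∑ 0≤ΔY i) (≤-trans (p≤q+p (0≤∑ 0≤Xs)) pairing)

      -- A single term of row i is at most the whole row, which the slack ties to R |y i|. This is
      -- how zeros of y spread.
      neighbour≤ : ∀ {i j} → adj G i j ≡ true → Y j ≤ defect + ∣ R ∣ * Y i
      neighbour≤ {i} {j} ij = begin
        Y j                                 ≡⟨ trans (cong (λ b → fromBool b * Y j) ij) (*-identityˡ (Y j)) ⟨
        A i j * Y j                         ≤⟨ term≤∑ (λ j → 0≤* (0≤fromBool (adj G i j)) (0≤∣p∣ (y j))) j ⟩
        ∑ (λ j → A i j * Y j)               ≤⟨ p≤p+q (0≤∣p∣ (∑ (λ j → A i j * y j) - R * y i)) ⟩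
        ∑ (λ j → A i j * Y j) + e i         ≡⟨ split _ (R * Y i) ⟩
        s i + R * Y i                       ≤⟨ +-mono-≤ (s≤defect i) (*-mono-≤ʳ (0≤∣p∣ (y i)) (p≤∣p∣ R)) ⟩
        defect + ∣ R ∣ * Y i                ∎
        where
        open ≤-Reasoning
        split : ∀ a b → a ≡ (a - b) + b
        split = solve-∀ ℚ-ring

-- Null sequences and the passage to the limit.

module Perron where

  open Defs using (ℝ; seq; Graph; adj; Adj; Connected; adjacencyMatrix; IsEigenvalue; eventuallyBounded; 0ℝ; 1ℝ)
  open Rationals
  open import Data.Rational.Base
  open import Data.Rational.Properties
  open import Relation.Binary.Construct.Closure.ReflexiveTransitive using (Star; _◅_) renaming (ε to [])
  open import Tactic.RingSolver using (solve-∀)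

  Null : (ℕ → ℚ) → Set
  Null s = ∀ ε → 0ℚ < ε → ∃[ N ] (∀ k → N ℕ.≤ k → ∣ s k ∣ ≤ ε)

  Bounded : (ℕ → ℚ) → Set
  Bounded s = ∃[ B ] Positive B × ∃[ N ] (∀ k → N ℕ.≤ k → ∣ s k ∣ ≤ B)

  half : ∀ {ε} → 0ℚ < ε → 0ℚ < ½ * ε
  half {ε} 0<ε = subst (_< ½ * ε) (*-zeroʳ ½) (*-monoʳ-<-pos ½ 0<ε)

  halves : ∀ ε → ½ * ε + ½ * ε ≡ ε
  halves ε = trans (sym (*-distribʳ-+ ε ½ ½)) (*-identityˡ ε)

  null-cong : ∀ {s t} → (∀ k → s k ≡ t k) → Null s → Null t
  null-cong s≗t null ε 0<ε with null ε 0<ε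
  ... | N , close = N , λ k N≤k → subst (λ x → ∣ x ∣ ≤ ε) (s≗t k) (close k N≤k)

  null-squeeze : ∀ {s t} → (∀ k → ∣ s k ∣ ≤ t k) → Null t → Null s
  null-squeeze s≤t null ε 0<ε with null ε 0<ε
  ... | N , close = N , λ k N≤k → ≤-trans (s≤t k) (≤-trans (p≤∣p∣ _) (close k N≤k))

  null-∣∣ : ∀ {s} → Null s → Null (λ k → ∣ s k ∣)
  null-∣∣ {s} null ε 0<ε with null ε 0<ε
  ... | N , close = N , λ k N≤k → subst (_≤ ε) (sym (∣∣p∣∣≡∣p∣ (s k))) (close k N≤k)

  null-0 : Null (λ _ → 0ℚ)
  null-0 ε 0<ε = 0 , λ _ _ → <⇒≤ 0<ε

  null-+ : ∀ {s t} → Null s → Null t → Null (λ k → s k + t k)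
  null-+ {s} {t} sNull tNull ε 0<ε with sNull (½ * ε) (half 0<ε) | tNull (½ * ε) (half 0<ε)
  ... | M , s≤ | N , t≤ = M ℕ.⊔ N , λ k le → begin
    ∣ s k + t k ∣      ≤⟨ ∣p+q∣≤∣p∣+∣q∣ (s k) (t k) ⟩
    ∣ s k ∣ + ∣ t k ∣  ≤⟨ +-mono-≤ (s≤ k (ℕ.m⊔n≤o⇒m≤o M N le)) (t≤ k (ℕ.m⊔n≤o⇒n≤o M N le)) ⟩
    ½ * ε + ½ * ε      ≡⟨ halves ε ⟩
    ε                  ∎
    where open ≤-Reasoning

  null-* : ∀ {s t} → Null s → Bounded t → Null (λ k → s k * t k)
  null-* {s} {t} sNull (B , B>0 , M , t≤) ε 0<ε with sNull (ε * 1/ B) 0<ε/B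
    where
    instance
      _ = B>0
      _ = pos⇒nonZero B
      _ = 1/pos⇒pos B
    0<ε/B : 0ℚ < ε * 1/ B
    0<ε/B = subst (_< ε * 1/ B) (*-zeroˡ (1/ B)) (*-monoˡ-<-pos (1/ B) 0<ε)
  ... | N , s≤ = M ℕ.⊔ N , λ k le → begin
    ∣ s k * t k ∣        ≡⟨ ∣p*q∣≡∣p∣*∣q∣ (s k) (t k) ⟩
    ∣ s k ∣ * ∣ t k ∣    ≤⟨ *-mono-≤ˡ (0≤∣p∣ (s k)) (t≤ k (ℕ.m⊔n≤o⇒m≤o M N le)) ⟩
    ∣ s k ∣ * B          ≤⟨ *-mono-≤ʳ (<⇒≤ (positive⁻¹ B)) (s≤ k (ℕ.m⊔n≤o⇒n≤o M N le)) ⟩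
    ε * 1/ B * B         ≡⟨ *-assoc ε (1/ B) B ⟩
    ε * (1/ B * B)       ≡⟨ cong (ε *_) (*-inverseˡ B) ⟩
    ε * 1ℚ               ≡⟨ *-identityʳ ε ⟩
    ε                    ∎
    where
    open ≤-Reasoning
    instance
      _ = B>0
      _ = pos⇒nonZero B

  null-∑ : ∀ {n} {f : ℕ → Fin n → ℚ} → (∀ i → Null (λ k → f k i)) → Null (λ k → ∑ (f k))
  null-∑ {zero}  null = null-0
  null-∑ {suc n} null = null-+ (null zero) (null-∑ (null ∘ suc))

  bounded-const : ∀ c → Bounded (λ _ → c)
  bounded-const c = 1ℚ + ∣ c ∣ , pos+nonNeg⇒pos 1ℚ ∣ c ∣ {{∣-∣-nonNeg c}} , 0 , λ _ _ → p≤q+p 0≤1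

  bounded-+ : ∀ {s t} → Bounded s → Bounded t → Bounded (λ k → s k + t k)
  bounded-+ {s} {t} (B , B>0 , M , s≤) (C , C>0 , N , t≤) =
    B + C , pos+pos⇒pos B {{B>0}} C {{C>0}} , M ℕ.⊔ N , λ k le →
    ≤-trans (∣p+q∣≤∣p∣+∣q∣ (s k) (t k)) (+-mono-≤ (s≤ k (ℕ.m⊔n≤o⇒m≤o M N le)) (t≤ k (ℕ.m⊔n≤o⇒n≤o M N le)))

  bounded-* : ∀ {s t} → Bounded s → Bounded t → Bounded (λ k → s k * t k)
  bounded-* {s} {t} (B , B>0 , M , s≤) (C , C>0 , N , t≤) =
    B * C , pos*pos⇒pos B {{B>0}} C {{C>0}} , M ℕ.⊔ N , λ k le →
    ≤-trans (≤-reflexive (∣p*q∣≡∣p∣*∣q∣ (s k) (t k)))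
      (*-mono-≤ (<⇒≤ (positive⁻¹ B {{B>0}})) (0≤∣p∣ (t k))
        (s≤ k (ℕ.m⊔n≤o⇒m≤o M N le)) (t≤ k (ℕ.m⊔n≤o⇒n≤o M N le)))

  bounded-∣∣ : ∀ {s} → Bounded s → Bounded (λ k → ∣ s k ∣)
  bounded-∣∣ {s} (B , B>0 , M , s≤) = B , B>0 , M , λ k le → subst (_≤ B) (sym (∣∣p∣∣≡∣p∣ (s k))) (s≤ k le)

  bounded-∑ : ∀ {n} {f : ℕ → Fin n → ℚ} → (∀ i → Bounded (λ k → f k i)) → Bounded (λ k → ∑ (f k))
  bounded-∑ {zero}  bdd = bounded-const 0ℚ
  bounded-∑ {suc n} bdd = bounded-+ (bdd zero) (bounded-∑ (bdd ∘ suc))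

  bounded-seq : ∀ x → Bounded (seq x)
  bounded-seq = eventuallyBounded

  seq-sum : ∀ {n} (f : Fin n → ℝ) k → seq (Defs.sum f) k ≡ ∑ (λ i → seq (f i) k)
  seq-sum {zero}  f k = refl
  seq-sum {suc n} f k = cong (seq (f zero) k +_) (seq-sum (f ∘ suc) k)

  seq-if : ∀ b k → seq (if b then 1ℝ else 0ℝ) k ≡ fromBool b
  seq-if true  _ = refl
  seq-if false _ = refl

  seq-·ᵥ : ∀ {n} (M : Defs.Matrix n) (x : Fin n → ℝ) i k (a : Fin n → ℚ) →
    (∀ j → seq (M i j) k ≡ a j) → seq ((M Defs.·ᵥ x) i) k ≡ ∑ (λ j → a j * seq (x j) k)
  seq-·ᵥ M x i k a eq = trans (seq-sum (λ j → M i j Defs.* x j) k) (sum-cong-≗ (λ j → cong (_* seq (x j) k) (eq j)))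

  eigen⇒null : ∀ {n} (M : Defs.Matrix n) (x : Fin n → ℝ) μ i (a : Fin n → ℚ) →
    (∀ j k → seq (M i j) k ≡ a j) → (M Defs.·ᵥ x) i Defs.≈ (μ Defs.* x i) →
    Null (λ k → ∑ (λ j → a j * seq (x j) k) - seq μ k * seq (x i) k)
  eigen⇒null M x μ i a eq Mx≈μx = null-cong
    {λ k → seq ((M Defs.·ᵥ x) i) k - seq μ k * seq (x i) k}
    (λ k → cong (_- seq μ k * seq (x i) k) (seq-·ᵥ M x i k a (λ j → eq j k))) Mx≈μx

  null⇒eigen : ∀ {n} (M : Defs.Matrix n) (x : Fin n → ℝ) μ i (a : Fin n → ℚ) →
    (∀ j k → seq (M i j) k ≡ a j) →
    Null (λ k → ∑ (λ j → a j * seq (x j) k) - seq μ k * seq (x i) k) → (M Defs.·ᵥ x) i Defs.≈ (μ Defs.* x i)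
  null⇒eigen M x μ i a eq null = null-cong
    {t = λ k → seq ((M Defs.·ᵥ x) i) k - seq μ k * seq (x i) k}
    (λ k → cong (_- seq μ k * seq (x i) k) (sym (seq-·ᵥ M x i k a (λ j → eq j k)))) null

  seq-adjacency : ∀ {n} (G : Graph n) i j k → seq (adjacencyMatrix G i j) k ≡ Aℚ G i j
  seq-adjacency G i j k = seq-if (adj G i j) k

  ≤⇒null : ∀ {x y} → x Defs.≤ y → Null (λ k → (seq x k - seq y k) ⊔ 0ℚ)
  ≤⇒null {x} {y} x≤y ε 0<ε with x≤y ε 0<ε
  ... | N , le = N , λ k N≤k → ≤-trans (≤-reflexive (0≤p⇒∣p∣≡p (p≤q⊔p (seq x k - seq y k) 0ℚ)))
    (⊔-lub (≤-trans (+-monoˡ-≤ (- seq y k) (le k N≤k)) (≤-reflexive (cancel (seq y k) ε))) (<⇒≤ 0<ε))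
    where
    cancel : ∀ a e → (a + e) - a ≡ e
    cancel = solve-∀ ℚ-ring

  -- Pairing |y| with X: where A X < u X strictly, the eigenvector y vanishes,
  -- and zeros of y spread along edges.
  perron : ∀ {n} (G : Graph n) → Connected G → ∀ ρ → IsEigenvalue (adjacencyMatrix G) ρ →
    (u : ℝ) → u Defs.≤ ρ → (X : ℕ → Fin n → ℚ) (Δ : Fin n → ℚ) →
    (∀ i → Bounded (λ k → X k i)) → (∀ k i → 1ℚ ≤ X k i) → (∀ i → 0ℚ ≤ Δ i) →
    (∀ k i → ∑ (λ j → Aℚ G i j * X k j) + Δ i ≤ seq u k * X k i) →
    ∀ i → ¬ (0ℚ < Δ i)
  perron {n} G conn ρ (y , y≉0 , eig) u u≤ρ X Δ X-bdd 1≤X 0≤Δ AX≤uX i₀ 0<Δ =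
    y≉0 (λ i → null-cong (λ k → sym (+-identityʳ (seq (y i) k))) (λ ε 0<ε → let N , c = vanish i ε 0<ε in
      N , λ k N≤k → subst (_≤ ε) (∣∣p∣∣≡∣p∣ (seq (y i) k)) (c k N≤k)))
    where
    Y : Fin n → ℕ → ℚ
    Y i k = ∣ seq (y i) k ∣

    def : ℕ → ℚ
    def k = defect G (seq ρ k) (seq u k) (λ i → seq (y i) k) (X k) Δ (1≤X k) 0≤Δ (AX≤uX k)

    excess : ℕ → ℚ
    excess k = (seq u k - seq ρ k) ⊔ 0ℚ

    residual : Fin n → ℕ → ℚ
    residual i k = ∣ ∑ (λ j → Aℚ G i j * seq (y j) k) - seq ρ k * seq (y i) k ∣

    residual-null : ∀ i → Null (residual i)
    residual-null i = null-∣∣ (eigen⇒null (adjacencyMatrix G) y ρ i (Aℚ G i) (seq-adjacency G i) (eig i))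

    def-null : Null def
    def-null = null-+ {λ k → excess k * ∑ (λ i → X k i * Y i k)} {λ k → ∑ (λ i → X k i * residual i k)}
      (null-* {excess} (≤⇒null {u} {ρ} u≤ρ)
        (bounded-∑ {f = λ k i → X k i * Y i k} (λ i → bounded-* (X-bdd i) (bounded-∣∣ (bounded-seq (y i))))))
      (null-∑ {f = λ k i → X k i * residual i k}
        (λ i → null-cong (λ k → *-comm (residual i k) (X k i)) (null-* (residual-null i) (X-bdd i))))

    -- Δ i₀ is a positive rational that does not vary with the index, so dividing by it keeps the
    -- sequence null.
    vanish₀ : Null (Y i₀)
    vanish₀ = null-cong (λ k → trans (sym (*-assoc (1/ Δ i₀) (Δ i₀) (Y i₀ k)))
                                (trans (cong (_* Y i₀ k) (*-inverseˡ (Δ i₀))) (*-identityˡ _)))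
      (null-cong (λ k → *-comm _ (1/ Δ i₀)) (null-* ΔY-null (bounded-const (1/ Δ i₀))))
      where
      instance
        _ = pos⇒nonZero (Δ i₀) {{positive 0<Δ}}
      ΔY-null : Null (λ k → Δ i₀ * Y i₀ k)
      ΔY-null = null-squeeze (λ k → ≤-trans
          (≤-reflexive (0≤p⇒∣p∣≡p (0≤* (0≤Δ i₀) (0≤∣p∣ (seq (y i₀) k)))))
          (ΔY≤defect G (seq ρ k) (seq u k) (λ i → seq (y i) k) (X k) Δ (1≤X k) 0≤Δ (AX≤uX k) i₀))
        def-null

    spread : ∀ {i j} → Adj G i j → Null (Y i) → Null (Y j)
    spread {i} {j} ij null = null-squeeze (λ k → ≤-trans (≤-reflexive (∣∣p∣∣≡∣p∣ (seq (y j) k)))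
        (neighbour≤ G (seq ρ k) (seq u k) (λ i → seq (y i) k) (X k) Δ (1≤X k) 0≤Δ (AX≤uX k) ij))
      (null-+ def-null (null-cong (λ k → *-comm (Y i k) _) (null-* null (bounded-∣∣ (bounded-seq ρ)))))

    along : ∀ {i j} → Star (Adj G) i j → Null (Y i) → Null (Y j)
    along []        null = null
    along (ij ◅ jk) null = along jk (spread ij null)

    vanish : ∀ i → Null (Y i)
    vanish i = along (conn i₀ i) vanish₀

-- The excess δ of μ over n - 4, by bisection.

module Root where

  open Defs using (ℝ; mkℝ; CauchySeq)
  open Rationals
  open Perron
  import Data.Integer.Base as ℤ
  import Data.Integer.Properties as ℤ
  open import Data.Rational.Base
  open import Data.Rational.Properties
  import Data.Rational.Unnormalised.Base as ℚᵘ
  import Data.Rational.Unnormalised.Properties as ℚᵘ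
  open import Tactic.RingSolver using (solve-∀)

  ι : ℕ → ℚ
  ι zero    = 0ℚ
  ι (suc n) = 1ℚ + ι n

  ι-+ : ∀ m n → ι (m ℕ.+ n) ≡ ι m + ι n
  ι-+ zero    n = sym (+-identityˡ (ι n))
  ι-+ (suc m) n = trans (cong (1ℚ +_) (ι-+ m n)) (sym (+-assoc 1ℚ (ι m) (ι n)))

  ι-* : ∀ m n → ι (m ℕ.* n) ≡ ι m * ι n
  ι-* zero    n = sym (*-zeroˡ (ι n))
  ι-* (suc m) n = trans (ι-+ n (m ℕ.* n)) (trans (cong (ι n +_) (ι-* m n)) (factor (ι m) (ι n)))
    where
    factor : ∀ a b → b + a * b ≡ (1ℚ + a) * b
    factor = solve-∀ ℚ-ring

  0≤ι : ∀ n → 0ℚ ≤ ι n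
  0≤ι zero    = ≤-refl
  0≤ι (suc n) = 0≤+ 0≤1 (0≤ι n)

  ι-mono : ∀ {m n} → m ℕ.≤ n → ι m ≤ ι n
  ι-mono {n = n} ℕ.z≤n = 0≤ι n
  ι-mono (ℕ.s≤s m≤n)   = +-monoʳ-≤ 1ℚ (ι-mono m≤n)

  toℚᵘ-ι : ∀ n → toℚᵘ (ι n) ℚᵘ.≃ ℚᵘ.mkℚᵘ (ℤ.+ n) 0
  toℚᵘ-ι zero    = ℚᵘ.≃-refl
  toℚᵘ-ι (suc n) = ℚᵘ.≃-trans (toℚᵘ-homo-+ 1ℚ (ι n))
    (ℚᵘ.≃-trans (ℚᵘ.+-congʳ ℚᵘ.1ℚᵘ (toℚᵘ-ι n)) (ℚᵘ.*≡* (cong (λ z → (ℤ.+ 1 ℤ.+ z) ℤ.* ℤ.+ 1) (ℤ.*-identityʳ (ℤ.+ n)))))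

  -- The witness is the denominator of ε: multiplied by it, ε becomes its numerator, which is a
  -- positive integer.
  archimedean : ∀ ε → 0ℚ < ε → ∃[ N ] (1ℚ ≤ ι N * ε)
  archimedean ε@(mkℚ ℤ.+[1+ a ] d _) _ = suc d , toℚᵘ-cancel-≤ (ℚᵘ.≤-respʳ-≃
    (ℚᵘ.≃-sym (ℚᵘ.≃-trans (toℚᵘ-homo-* (ι (suc d)) ε) (ℚᵘ.*-congʳ {toℚᵘ ε} (toℚᵘ-ι (suc d)))))
    (ℚᵘ.*≤* (ℤ.+≤+ (ℕ.≤-trans (ℕ.≤-reflexive (eq d)) (le a d)))))
    where
    eq : ∀ d → 1 ℕ.* (1 ℕ.* suc d) ≡ suc d
    eq d = trans (ℕ.*-identityˡ _) (ℕ.*-identityˡ _)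
    le : ∀ a d → suc d ℕ.≤ (suc d ℕ.* suc a) ℕ.* 1
    le a d = ℕ.≤-trans (ℕ.m≤m*n (suc d) (suc a)) (ℕ.≤-reflexive (sym (ℕ.*-identityʳ _)))
  archimedean (mkℚ (ℤ.+ 0) _ _) (*<* (ℤ.+<+ ()))
  archimedean (mkℚ ℤ.-[1+ _ ] _ _) (*<* ())

  ∣-∣≤width : ∀ {l h a b} → l ≤ a → a ≤ h → l ≤ b → b ≤ h → ∣ a - b ∣ ≤ h - l
  ∣-∣≤width {l} {h} {a} {b} l≤a a≤h l≤b b≤h with ∣p∣≡p∨∣p∣≡-p (a - b)
  ... | inj₁ eq = subst (_≤ h - l) (sym eq) (+-mono-≤ a≤h (neg-antimono-≤ l≤b))
  ... | inj₂ eq = subst (_≤ h - l) (sym (trans eq (flip a b))) (+-mono-≤ b≤h (neg-antimono-≤ l≤a))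
    where
    flip : ∀ a b → - (a - b) ≡ b - a
    flip = solve-∀ ℚ-ring

  2ℚ 3ℚ : ℚ
  2ℚ = 1ℚ + 1ℚ
  3ℚ = 1ℚ + 1ℚ + 1ℚ

  module _ (q : ℚ) (2≤q : 2ℚ ≤ q) where

    -- With μ = q + δ and q = n - 4, the centre of K₁ ∨ (K_{n-4} ∪ K₂ ∪ K₁)
    -- satisfies the eigenvalue equation iff f δ = 0.
    f : ℚ → ℚ
    f δ = δ * ((q + δ) * (q + δ) * (q + δ) - (q + δ)) - (1ℚ + δ) * (3ℚ * (q + δ) - 1ℚ)

    record Bracket : Set where
      field
        lo hi : ℚ
        0≤lo  : 0ℚ ≤ lo
        lo≤hi : lo ≤ hi
        hi≤1  : hi ≤ 1ℚ
        f-lo  : f lo ≤ 0ℚ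
        f-hi  : 0ℚ ≤ f hi

    open Bracket

    private
      0≤q : 0ℚ ≤ q
      0≤q = ≤-trans (nonNegative⁻¹ 2ℚ) 2≤q

      0≤q-2 : 0ℚ ≤ q - 2ℚ
      0≤q-2 = p≤q⇒0≤q-p 2≤q

    -- The signs come from f 0 = 1 - 3 q and f 1 = (q - 2) (q² + 5 q + 6) + 8, together with q ≥ 2.
    start : Bracket
    start .lo    = 0ℚ
    start .hi    = 1ℚ
    start .0≤lo  = ≤-refl
    start .lo≤hi = 0≤1
    start .hi≤1  = ≤-refl
    start .f-lo  = ≤-by {r = 3ℚ * (q - 2ℚ) + (3ℚ + 2ℚ)} (0≤+ (0≤* (nonNegative⁻¹ 3ℚ) 0≤q-2) (nonNegative⁻¹ (3ℚ + 2ℚ))) (eq q)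
      where
      eq : ∀ q → let t = 1ℚ + 1ℚ + 1ℚ in
        0ℚ ≡ (0ℚ * ((q + 0ℚ) * (q + 0ℚ) * (q + 0ℚ) - (q + 0ℚ)) - (1ℚ + 0ℚ) * (t * (q + 0ℚ) - 1ℚ))
        + (t * (q - (1ℚ + 1ℚ)) + (t + (1ℚ + 1ℚ)))
      eq = solve-∀ ℚ-ring
    start .f-hi  = subst (0ℚ ≤_) (sym (eq q)) (0≤+ (0≤* 0≤q-2 (0≤+ (0≤+ (0≤* 0≤q 0≤q) (0≤* (nonNegative⁻¹ (3ℚ + 2ℚ)) 0≤q)) (nonNegative⁻¹ (3ℚ + 3ℚ)))) (nonNegative⁻¹ (3ℚ + 3ℚ + 2ℚ)))
      where
      eq : ∀ q → let t = 1ℚ + 1ℚ + 1ℚ in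
        1ℚ * ((q + 1ℚ) * (q + 1ℚ) * (q + 1ℚ) - (q + 1ℚ)) - (1ℚ + 1ℚ) * (t * (q + 1ℚ) - 1ℚ)
        ≡ (q - (1ℚ + 1ℚ)) * ((q * q + (t + (1ℚ + 1ℚ)) * q) + (t + t)) + (t + t + (1ℚ + 1ℚ))
      eq = solve-∀ ℚ-ring

    mid : Bracket → ℚ
    mid b = ½ * (lo b + hi b)

    lo≤mid : ∀ b → lo b ≤ mid b
    lo≤mid b = subst (_≤ mid b) (trans (*-distribˡ-+ ½ (lo b) (lo b)) (halves (lo b)))
      (*-mono-≤ˡ (nonNegative⁻¹ ½) (+-monoʳ-≤ (lo b) (lo≤hi b)))

    mid≤hi : ∀ b → mid b ≤ hi b
    mid≤hi b = subst (mid b ≤_) (trans (*-distribˡ-+ ½ (hi b) (hi b)) (halves (hi b)))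
      (*-mono-≤ˡ (nonNegative⁻¹ ½) (+-monoˡ-≤ (hi b) (lo≤hi b)))

    -- The midpoint and the value of f there are rational, so the sign can be decided.
    refine : (b : Bracket) → ∃[ c ] (lo b ≤ lo c × hi c ≤ hi b × hi c - lo c ≡ ½ * (hi b - lo b))
    refine b with 0ℚ ≤? f (mid b)
    ... | yes 0≤f = record { lo = lo b ; hi = mid b ; 0≤lo = 0≤lo b ; lo≤hi = lo≤mid b
        ; hi≤1 = ≤-trans (mid≤hi b) (hi≤1 b) ; f-lo = f-lo b ; f-hi = 0≤f }
      , ≤-refl , mid≤hi b , trans (cong (λ l → mid b - l) (sym (halves (lo b)))) (eq ½ (lo b) (hi b))
      where
      eq : ∀ a l h → a * (l + h) - (a * l + a * l) ≡ a * (h - l)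
      eq = solve-∀ ℚ-ring
    ... | no 0≰f = record { lo = mid b ; hi = hi b ; 0≤lo = ≤-trans (0≤lo b) (lo≤mid b) ; lo≤hi = mid≤hi b
        ; hi≤1 = hi≤1 b ; f-lo = <⇒≤ (≰⇒> 0≰f) ; f-hi = f-hi b }
      , lo≤mid b , ≤-refl , trans (cong (λ h → h - mid b) (sym (halves (hi b)))) (eq ½ (lo b) (hi b))
      where
      eq : ∀ a l h → (a * h + a * h) - a * (l + h) ≡ a * (h - l)
      eq = solve-∀ ℚ-ring

    bracket : ℕ → Bracket
    bracket zero    = start
    bracket (suc k) = proj₁ (refine (bracket k))

    nested : ∀ {m n} → m ℕ.≤ n → lo (bracket m) ≤ lo (bracket n) × hi (bracket n) ≤ hi (bracket m)
    nested m≤n = go (ℕ.≤⇒≤′ m≤n)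
      where
      go : ∀ {m n} → m ℕ.≤′ n → lo (bracket m) ≤ lo (bracket n) × hi (bracket n) ≤ hi (bracket m)
      go (ℕ.≤′-reflexive refl) = ≤-refl , ≤-refl
      go {n = suc n} (ℕ.≤′-step m≤n) = let l , h = go m≤n ; l′ , h′ , _ = proj₂ (refine (bracket n))
        in ≤-trans l l′ , ≤-trans h′ h

    width : ℕ → ℚ
    width k = hi (bracket k) - lo (bracket k)

    0≤width : ∀ k → 0ℚ ≤ width k
    0≤width k = p≤q⇒0≤q-p (lo≤hi (bracket k))

    -- The width is halved each time, but this harmonic bound closes by induction without powers of
    -- ½ and is the form that `archimedean` meets.
    width≤ : ∀ k → ι (suc k) * width k ≤ 1ℚ
    width≤ zero    = ≤-refl
    width≤ (suc k) = begin
      ι (suc (suc k)) * width (suc k)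
        ≡⟨ cong (ι (suc (suc k)) *_) (proj₂ (proj₂ (proj₂ (refine (bracket k))))) ⟩
      (1ℚ + ι (suc k)) * (½ * width k)
        ≡⟨ eq (ι (suc k)) ½ (width k) ⟩
      ½ * width k + ½ * (ι (suc k) * width k)
        ≤⟨ +-mono-≤ (*-mono-≤ˡ (nonNegative⁻¹ ½) width≤1) (*-mono-≤ˡ (nonNegative⁻¹ ½) (width≤ k)) ⟩
      ½ * 1ℚ + ½ * 1ℚ
        ≡⟨ halves 1ℚ ⟩
      1ℚ ∎
      where
      open ≤-Reasoning
      eq : ∀ a b w → (1ℚ + a) * (b * w) ≡ b * w + b * (a * w)
      eq = solve-∀ ℚ-ring
      width≤1 : width k ≤ 1ℚ
      width≤1 = subst₂ _≤_ (*-identityˡ (width k)) refl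
        (≤-trans (*-mono-≤ʳ (0≤width k) (p≤p+q {1ℚ} (0≤ι k))) (width≤ k))

    width-small : ∀ ε → 0ℚ < ε → ∃[ N ] (width N ≤ ε)
    width-small ε 0<ε with archimedean ε 0<ε
    ... | N , 1≤Nε = N , (begin
      width N                       ≡⟨ *-identityˡ (width N) ⟨
      1ℚ * width N                  ≤⟨ *-mono-≤ʳ (0≤width N) (≤-trans 1≤Nε (*-mono-≤ʳ (<⇒≤ 0<ε) (p≤q+p {ι N} 0≤1))) ⟩
      ι (suc N) * ε * width N       ≡⟨ eq (ι (suc N)) ε (width N) ⟩
      ε * (ι (suc N) * width N)     ≤⟨ *-mono-≤ˡ (<⇒≤ 0<ε) (width≤ N) ⟩
      ε * 1ℚ                        ≡⟨ *-identityʳ ε ⟩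
      ε                             ∎)
      where
      open ≤-Reasoning
      eq : ∀ a e w → a * e * w ≡ e * (a * w)
      eq = solve-∀ ℚ-ring

    -- Upper end points are taken so that f is nonnegative at every index. Then the approximate
    -- eigenvector satisfies A X ≤ μ X at every index and not just in the limit.
    δ : ℕ → ℚ
    δ k = hi (bracket k)

    δ-cauchy : CauchySeq δ
    δ-cauchy ε 0<ε = N , λ m n N≤m N≤n → ≤-trans
      (∣-∣≤width {lo (bracket N)} {hi (bracket N)} {δ m} {δ n}
        (≤-trans (proj₁ (nested N≤m)) (lo≤hi (bracket m))) (proj₂ (nested N≤m))
        (≤-trans (proj₁ (nested N≤n)) (lo≤hi (bracket n))) (proj₂ (nested N≤n)))
      (proj₂ (width-small ε 0<ε))
      where
      N : ℕ
      N = proj₁ (width-small ε 0<ε)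

    δℝ : ℝ
    δℝ = mkℝ δ δ-cauchy

    0≤δ : ∀ k → 0ℚ ≤ δ k
    0≤δ k = ≤-trans (0≤lo (bracket k)) (lo≤hi (bracket k))

    δ≤1 : ∀ k → δ k ≤ 1ℚ
    δ≤1 k = hi≤1 (bracket k)

    0≤fδ : ∀ k → 0ℚ ≤ f (δ k)
    0≤fδ k = f-hi (bracket k)

    width-null : Null width
    width-null ε 0<ε = N , λ k N≤k → ≤-trans (≤-reflexive (0≤p⇒∣p∣≡p (0≤width k)))
      (≤-trans (+-mono-≤ (proj₂ (nested N≤k)) (neg-antimono-≤ (proj₁ (nested N≤k)))) (proj₂ (width-small ε 0<ε)))
      where
      N : ℕ
      N = proj₁ (width-small ε 0<ε)

    lo-bounded : Bounded (λ k → lo (bracket k))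
    lo-bounded = 1ℚ , _ , 0 , λ k _ → ≤-trans (≤-reflexive (0≤p⇒∣p∣≡p (0≤lo (bracket k)))) (≤-trans (lo≤hi (bracket k)) (δ≤1 k))

    δ-bounded : Bounded δ
    δ-bounded = 1ℚ , _ , 0 , λ k _ → ≤-trans (≤-reflexive (0≤p⇒∣p∣≡p (0≤δ k))) (δ≤1 k)

    private
      -- The divided difference of f, whose boundedness replaces continuity. It is written with
      -- factors - 1 instead of subtractions so that `bounded-+` and `bounded-*` follow its shape.
      slope : ℚ → ℚ → ℚ
      slope h l = (q + h) * ((q + h) * (q + h))
        + (l * ((q + h) * (q + h) + (q + h) * (q + l) + (q + l) * (q + l)) + ((- 1ℚ) * (q + h) + ((- 1ℚ) * l
        + ((- 1ℚ) * (3ℚ * (q + h) + (- 1ℚ)) + (- 1ℚ) * (3ℚ * (1ℚ + l))))))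

      f-diff : ∀ h l → f h ≡ f l + (h - l) * slope h l
      f-diff h l = eq q h l 3ℚ
        where
        eq : ∀ q h l t → h * ((q + h) * (q + h) * (q + h) - (q + h)) - (1ℚ + h) * (t * (q + h) - 1ℚ) ≡
          (l * ((q + l) * (q + l) * (q + l) - (q + l)) - (1ℚ + l) * (t * (q + l) - 1ℚ)) +
          (h - l) * ((q + h) * ((q + h) * (q + h))
          + (l * ((q + h) * (q + h) + (q + h) * (q + l) + (q + l) * (q + l)) + ((- 1ℚ) * (q + h) + ((- 1ℚ) * l
          + ((- 1ℚ) * (t * (q + h) + (- 1ℚ)) + (- 1ℚ) * (t * (1ℚ + l)))))))
        eq = solve-∀ ℚ-ring

      slope-bounded : Bounded (λ k → slope (δ k) (lo (bracket k)))
      slope-bounded = bounded-+ (bounded-* μ (bounded-* μ μ)) (bounded-+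
          (bounded-* l (bounded-+ (bounded-+ (bounded-* μ μ) (bounded-* μ λ′)) (bounded-* λ′ λ′)))
          (bounded-+ (bounded-* c μ) (bounded-+ (bounded-* c l) (bounded-+
            (bounded-* c (bounded-+ (bounded-* t μ) c)) (bounded-* c (bounded-* t (bounded-+ (bounded-const 1ℚ) l)))))))
        where
        l  = lo-bounded
        μ  = bounded-+ (bounded-const q) δ-bounded
        λ′ = bounded-+ (bounded-const q) lo-bounded
        c  = bounded-const (- 1ℚ)
        t  = bounded-const 3ℚ

    -- As f is at most 0 at the lower end point, f δ lies between 0 and the increase of f over the
    -- bracket, which is the width times a bounded slope.
    fδ-null : Null (λ k → f (δ k))
    fδ-null = null-squeeze (λ k → begin
        ∣ f (δ k) ∣                                       ≡⟨ 0≤p⇒∣p∣≡p (0≤fδ k) ⟩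
        f (δ k)                                           ≡⟨ f-diff (δ k) (lo (bracket k)) ⟩
        f (lo (bracket k)) + width k * slope (δ k) (lo (bracket k))
                                                          ≤⟨ +-monoˡ-≤ _ (f-lo (bracket k)) ⟩
        0ℚ + width k * slope (δ k) (lo (bracket k))       ≡⟨ +-identityˡ _ ⟩
        width k * slope (δ k) (lo (bracket k))            ∎)
      (null-* width-null slope-bounded)
      where open ≤-Reasoning

    -- 0 ≤ f δ forces δ (μ³ - μ) ≥ 3μ - 1 ≥ μ.
    1≤δ[q+1]² : ∀ k → 1ℚ ≤ δ k * ((q + 1ℚ) * (q + 1ℚ))
    1≤δ[q+1]² k = ≤-trans (*-cancelʳ-≤-pos μ {{positive 0<μ}} (begin
        1ℚ * μ
          ≤⟨ ≤-by {r = f d + (d * μ + d * (3ℚ * μ - 1ℚ) + (μ + (μ - 1ℚ)))}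
               (0≤+ (0≤fδ k) (0≤+ (0≤+ (0≤* 0≤d 0≤μ) (0≤* 0≤d 0≤3μ-1)) (0≤+ 0≤μ 0≤μ-1))) (eq q d) ⟩
        d * (μ * μ) * μ ∎))
      (*-mono-≤ˡ 0≤d (*-mono-≤ (0≤+ 0≤q 0≤1) 0≤μ μ≤q+1 μ≤q+1))
      where
      open ≤-Reasoning
      d = δ k
      μ = q + d
      0≤d = 0≤δ k
      0≤μ : 0ℚ ≤ μ
      0≤μ = 0≤+ 0≤q 0≤d
      1≤q : 1ℚ ≤ q
      1≤q = ≤-trans (p≤p+q 0≤1) 2≤q
      0≤μ-1 : 0ℚ ≤ μ - 1ℚ
      0≤μ-1 = p≤q⇒0≤q-p (≤-trans 1≤q (p≤p+q 0≤d))
      0<μ : 0ℚ < μ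
      0<μ = <-≤-trans (positive⁻¹ 1ℚ) (≤-trans 1≤q (p≤p+q 0≤d))
      0≤3μ-1 : 0ℚ ≤ 3ℚ * μ - 1ℚ
      0≤3μ-1 = subst (0ℚ ≤_) (e μ) (0≤+ (0≤+ 0≤μ 0≤μ) 0≤μ-1)
        where
        e : ∀ m → (m + m) + (m - 1ℚ) ≡ (1ℚ + 1ℚ + 1ℚ) * m - 1ℚ
        e = solve-∀ ℚ-ring
      μ≤q+1 : μ ≤ q + 1ℚ
      μ≤q+1 = +-monoʳ-≤ q (δ≤1 k)
      eq : ∀ q d → let t = 1ℚ + 1ℚ + 1ℚ; μ = q + d in
        d * (μ * μ) * μ ≡ 1ℚ * μ +
        ((d * (μ * μ * μ - μ) - (1ℚ + d) * (t * μ - 1ℚ))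
         + ((d * μ + d * (t * μ - 1ℚ)) + (μ + (μ - 1ℚ))))
      eq = solve-∀ ℚ-ring

-- The eigenvalue μ of the extremal graph, and what ρ ≥ μ excludes.

module Extremal where

  open Defs using (ℝ; seq; Graph; adj; K; _∪_; _∨_; combine; edge; fromℚ; 1ℝ; adjacencyMatrix; IsEigenvalue; IsSpectralRadius; Connected; _≅_)
  open Rationals
  open Perron
  open Root
  import Data.Integer.Base as ℤ
  open import Data.Rational.Base hiding (truncate)
  open import Data.Rational.Properties
  open import Data.Sum.Base using ([_,_])
  open import Function.Bundles using (_↔_; Inverse)
  open import Tactic.RingSolver using (solve-∀)

  ∑-splitAt : ∀ m {n} (F : Fin m ⊎ Fin n → ℚ) →
    ∑ (λ j → F (splitAt m {n} j)) ≡ ∑ (F ∘ inj₁) + ∑ (F ∘ inj₂)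
  ∑-splitAt zero    F = sym (+-identityˡ _)
  ∑-splitAt (suc m) F = trans (cong (F (inj₁ zero) +_) (∑-splitAt m (F ∘ Sum.map₁ suc)))
                              (sym (+-assoc (F (inj₁ zero)) _ _))

  ∑-const : ∀ n a → ∑ {n} (λ _ → a) ≡ ι n * a
  ∑-const zero    a = sym (*-zeroˡ a)
  ∑-const (suc n) a = trans (cong (a +_) (∑-const n a)) (eq a (ι n))
    where
    eq : ∀ a b → a + b * a ≡ (1ℚ + b) * a
    eq = solve-∀ ℚ-ring

  ∑-zero : ∀ n → ∑ {n} (λ _ → 0ℚ) ≡ 0ℚ
  ∑-zero n = trans (∑-const n 0ℚ) (*-zeroʳ (ι n))

  row : ∀ {n} → Graph n → (Fin n → ℚ) → Fin n → ℚ
  row G x i = ∑ (λ j → Aℚ G i j * x j)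

  module _ {m n} (b : Bool) (G₁ : Graph m) (G₂ : Graph n) (x : Fin m → ℚ) (y : Fin n → ℚ) where

    row-combineˡ : ∀ {i u} → splitAt m i ≡ inj₁ u →
      row (combine b G₁ G₂) ([ x , y ] ∘ splitAt m) i ≡ row G₁ x u + fromBool b * ∑ y
    row-combineˡ {i} {u} eq rewrite eq = trans
      (∑-splitAt m (λ t → fromBool (edge b G₁ G₂ (inj₁ u) t) * [ x , y ] t))
      (cong (row G₁ x u +_) (sym (*-distribˡ-sum (fromBool b) y)))

    row-combineʳ : ∀ {i v} → splitAt m i ≡ inj₂ v →
      row (combine b G₁ G₂) ([ x , y ] ∘ splitAt m) i ≡ fromBool b * ∑ x + row G₂ y v
    row-combineʳ {i} {v} eq rewrite eq = trans
      (∑-splitAt m (λ t → fromBool (edge b G₁ G₂ (inj₂ v) t) * [ x , y ] t))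
      (cong (_+ row G₂ y v) (sym (*-distribˡ-sum (fromBool b) x)))

  -- The extra a on the left avoids the number n - 1 of constant entries.
  ∑-δ : ∀ {n} (i : Fin n) a (x : Fin n → ℚ) → (∀ j → i ≢ j → x j ≡ a) → ∑ x + a ≡ ι n * a + x i
  ∑-δ {suc n} zero a x x≡a = trans
    (cong (λ s → x zero + s + a) (trans (sum-cong-≗ (λ j → x≡a (suc j) λ ())) (∑-const n a))) (eq (x zero) (ι n) a)
    where
    eq : ∀ x n a → x + n * a + a ≡ (1ℚ + n) * a + x
    eq = solve-∀ ℚ-ring
  ∑-δ {suc n} (suc i) a x x≡a = trans (eq (x zero) (∑ (x ∘ suc)) a)
    (trans (cong₂ _+_ (x≡a zero λ ()) (∑-δ i a (x ∘ suc) (λ j i≢j → x≡a (suc j) (i≢j ∘ Fin.suc-injective))))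
           (eq′ (ι n) a (x (suc i))))
    where
    eq : ∀ x s a → x + s + a ≡ x + (s + a)
    eq = solve-∀ ℚ-ring
    eq′ : ∀ n a y → a + (n * a + y) ≡ (1ℚ + n) * a + y
    eq′ = solve-∀ ℚ-ring

  row-K : ∀ n a u → row (K n) (λ _ → a) u + a ≡ ι n * a
  row-K n a u = trans (∑-δ u a _ off) (trans (cong (ι n * a +_) diag) (+-identityʳ _))
    where
    off : ∀ j → u ≢ j → Aℚ (K n) u j * a ≡ a
    off j u≢j with u Fin.≟ j
    ... | yes u≡j = contradiction u≡j u≢j
    ... | no  _   = *-identityˡ a
    diag : Aℚ (K n) u u * a ≡ 0ℚ
    diag rewrite Defs.no-loop (K n) u = *-zeroˡ a

  module _ {A : Set} where

    -- The values c, a, b, d belong to the parts K₁, K_m, K₂, K₁ in this order.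
    weights : ∀ m → A → A → A → A → Fin (1 ℕ.+ (m ℕ.+ (2 ℕ.+ 1))) → A
    weights m c a b d = [ const c , [ const a , [ const b , const d ] ∘ splitAt 2 ] ∘ splitAt m ] ∘ splitAt 1

    weights-all : ∀ m {c a b d} {P : A → Set} → P c → P a → P b → P d → ∀ i → P (weights m c a b d i)
    weights-all m Pc Pa Pb Pd zero = Pc
    weights-all m Pc Pa Pb Pd (suc i) with splitAt m i
    ... | inj₁ _ = Pa
    ... | inj₂ j with splitAt 2 j
    ...   | inj₁ _ = Pb
    ...   | inj₂ _ = Pd

  weights-map : ∀ {A B : Set} (g : A → B) m {c a b d} i →
    g (weights m c a b d i) ≡ weights m (g c) (g a) (g b) (g d) i
  weights-map g m zero = refl
  weights-map g m (suc i) with splitAt m i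
  ... | inj₁ _ = refl
  ... | inj₂ j with splitAt 2 j
  ...   | inj₁ _ = refl
  ...   | inj₂ _ = refl

  G₀ : ∀ m → Graph (1 ℕ.+ (m ℕ.+ (2 ℕ.+ 1)))
  G₀ m = K 1 ∨ (K m ∪ K 2 ∪ K 1)

  module _ (m : ℕ) (2≤m : 2ℚ ≤ ι m) where

    private
      q : ℚ
      q = ι m

    -- For the centre value c, the rows of the other parts force c / (1 + δ) on the clique, c / (μ -
    -- 1) on the pair and c / μ at the leaf. Taking c = (1 + δ) (μ - 1) μ clears the denominators,
    -- and the row of the centre becomes f δ = 0.
    cen cor pai lea : ℚ → ℚ
    cen δ = (1ℚ + δ) * (((q + δ) - 1ℚ) * (q + δ))
    cor δ = ((q + δ) - 1ℚ) * (q + δ)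
    pai δ = (1ℚ + δ) * (q + δ)
    lea δ = (1ℚ + δ) * ((q + δ) - 1ℚ)

    X₀ : ℚ → Fin (1 ℕ.+ (m ℕ.+ (2 ℕ.+ 1))) → ℚ
    X₀ δ = weights m (cen δ) (cor δ) (pai δ) (lea δ)

    private
      pairLeaf : ℚ → Fin (2 ℕ.+ 1) → ℚ
      pairLeaf δ = [ const (pai δ) , const (lea δ) ] ∘ splitAt 2

      tailX : ℚ → Fin (m ℕ.+ (2 ℕ.+ 1)) → ℚ
      tailX δ = [ const (cor δ) , pairLeaf δ ] ∘ splitAt m

    -- The zero terms in the polynomial identities are the unfolded sums over K₂ and K₁.
    row-G₀ : ∀ δ i → row (G₀ m) (X₀ δ) i - (q + δ) * X₀ δ i ≡ weights m (- f q 2≤m δ) 0ℚ 0ℚ 0ℚ i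
    row-G₀ δ zero = trans
      (cong (_- (q + δ) * cen δ) (trans (row-combineˡ true (K 1) (K m ∪ K 2 ∪ K 1) (const (cen δ)) (tailX δ) {zero} refl)
        (cong₂ _+_ (trans (+-identityʳ _) (*-zeroˡ (cen δ))) (cong (1ℚ *_) ∑tailX))))
      (eq q δ)
      where
      ∑tailX : ∑ (tailX δ) ≡ q * cor δ + ((pai δ + (pai δ + 0ℚ)) + (lea δ + 0ℚ))
      ∑tailX = trans (∑-splitAt m [ const (cor δ) , pairLeaf δ ])
        (cong₂ _+_ (∑-const m (cor δ)) (∑-splitAt 2 {1} [ const (pai δ) , const (lea δ) ]))
      eq : ∀ q δ → let t = 1ℚ + 1ℚ + 1ℚ; μ = q + δ in
        (0ℚ + 1ℚ * (q * ((μ - 1ℚ) * μ) + (((1ℚ + δ) * μ + ((1ℚ + δ) * μ + 0ℚ)) + ((1ℚ + δ) * (μ - 1ℚ) + 0ℚ))))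
        - μ * ((1ℚ + δ) * ((μ - 1ℚ) * μ)) ≡
        - (δ * (μ * μ * μ - μ) - (1ℚ + δ) * (t * μ - 1ℚ))
      eq = solve-∀ ℚ-ring
    row-G₀ δ (suc i) = trans (cong (_- (q + δ) * X₀ δ (suc i)) step) (rest i)
      where
      step : row (G₀ m) (X₀ δ) (suc i) ≡ 1ℚ * (cen δ + 0ℚ) + row (K m ∪ K 2 ∪ K 1) (tailX δ) i
      step = row-combineʳ true (K 1) (K m ∪ K 2 ∪ K 1) (const (cen δ)) (tailX δ) {suc i} refl
      rest : ∀ i → (1ℚ * (cen δ + 0ℚ) + row (K m ∪ K 2 ∪ K 1) (tailX δ) i) - (q + δ) * X₀ δ (suc i)
        ≡ weights m (- f q 2≤m δ) 0ℚ 0ℚ 0ℚ (suc i)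
      rest i = byPart (splitAt m i) refl
        where
        byPart : ∀ s → splitAt m i ≡ s → (1ℚ * (cen δ + 0ℚ) + row (K m ∪ K 2 ∪ K 1) (tailX δ) i) - (q + δ) * [ const (cor δ) , pairLeaf δ ] s
          ≡ [ const 0ℚ , [ const 0ℚ , const 0ℚ ] ∘ splitAt 2 ] s
        byPart (inj₁ u) split = trans (cong (λ r → (1ℚ * (cen δ + 0ℚ) + r) - (q + δ) * cor δ)
            (trans (row-combineˡ false (K m) (K 2 ∪ K 1) (const (cor δ)) (pairLeaf δ) {i} split)
                   (cong₂ _+_ (move {row (K m) (const (cor δ)) u} {cor δ} (row-K m (cor δ) u)) (*-zeroˡ (∑ (pairLeaf δ))))))
          (eq q δ)
          where
          move : ∀ {x y z} → x + y ≡ z → x ≡ z - y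
          move {x} {y} refl = e x y
            where
            e : ∀ x y → x ≡ (x + y) - y
            e = solve-∀ ℚ-ring
          eq : ∀ q δ → let μ = q + δ in
            (1ℚ * ((1ℚ + δ) * ((μ - 1ℚ) * μ) + 0ℚ) +
            ((q * ((μ - 1ℚ) * μ) - (μ - 1ℚ) * μ) + 0ℚ)) - μ * ((μ - 1ℚ) * μ) ≡ 0ℚ
          eq = solve-∀ ℚ-ring
        byPart (inj₂ j) split = trans (cong (λ r → (1ℚ * (cen δ + 0ℚ) + r) - (q + δ) * pairLeaf δ j)
            (trans (row-combineʳ false (K m) (K 2 ∪ K 1) (const (cor δ)) (pairLeaf δ) {i} split)
                   (cong₂ _+_ (*-zeroˡ (∑ {m} (const (cor δ)))) refl)))
            (last j)
          where
          pairEq : ∀ q δ z → let μ = q + δ in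
            (1ℚ * ((1ℚ + δ) * ((μ - 1ℚ) * μ) + 0ℚ) +
            (0ℚ + (0ℚ * ((1ℚ + δ) * μ) + (1ℚ * ((1ℚ + δ) * μ) + (0ℚ * z + 0ℚ))))) - μ * ((1ℚ + δ) * μ) ≡ 0ℚ
          pairEq = solve-∀ ℚ-ring
          pairEq′ : ∀ q δ z → let μ = q + δ in
            (1ℚ * ((1ℚ + δ) * ((μ - 1ℚ) * μ) + 0ℚ) +
            (0ℚ + (1ℚ * ((1ℚ + δ) * μ) + (0ℚ * ((1ℚ + δ) * μ) + (0ℚ * z + 0ℚ))))) - μ * ((1ℚ + δ) * μ) ≡ 0ℚ
          pairEq′ = solve-∀ ℚ-ring
          leafEq : ∀ q δ b → let μ = q + δ in
            (1ℚ * ((1ℚ + δ) * ((μ - 1ℚ) * μ) + 0ℚ) +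
            (0ℚ + (0ℚ * b + (0ℚ * b + (0ℚ * ((1ℚ + δ) * (μ - 1ℚ)) + 0ℚ))))) - μ * ((1ℚ + δ) * (μ - 1ℚ)) ≡ 0ℚ
          leafEq = solve-∀ ℚ-ring
          last : ∀ j → (1ℚ * (cen δ + 0ℚ) + (0ℚ + row (K 2 ∪ K 1) (pairLeaf δ) j))
            - (q + δ) * pairLeaf δ j ≡ [ const 0ℚ , const 0ℚ ] (splitAt 2 j)
          last zero             = pairEq q δ (lea δ)
          last (suc zero)       = pairEq′ q δ (lea δ)
          last (suc (suc zero)) = leafEq q δ (pai δ)

  null-neg : ∀ {s} → Null s → Null (λ k → - s k)
  null-neg {s} null ε 0<ε = proj₁ (null ε 0<ε) , λ k N≤k → subst (_≤ ε) (sym (∣-p∣≡∣p∣ (s k))) (proj₂ (null ε 0<ε) k N≤k)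

  1≤* : ∀ {p q} → 1ℚ ≤ p → 1ℚ ≤ q → 1ℚ ≤ p * q
  1≤* {p} {q} 1≤p 1≤q = ≤-trans 1≤p (subst (_≤ p * q) (*-identityʳ p) (*-mono-≤ˡ (≤-trans 0≤1 1≤p) 1≤q))

  ≤ℝ-trans : ∀ {x y z} → x Defs.≤ y → y Defs.≤ z → x Defs.≤ z
  ≤ℝ-trans {x} {y} {z} x≤y y≤z ε 0<ε = N₁ ℕ.⊔ N₂ , λ k N≤k → begin
    seq x k                          ≤⟨ proj₂ (x≤y (½ * ε) (half 0<ε)) k (ℕ.m⊔n≤o⇒m≤o N₁ N₂ N≤k) ⟩
    seq y k + ½ * ε                  ≤⟨ +-monoˡ-≤ (½ * ε) (proj₂ (y≤z (½ * ε) (half 0<ε)) k (ℕ.m⊔n≤o⇒n≤o N₁ N₂ N≤k)) ⟩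
    (seq z k + ½ * ε) + ½ * ε        ≡⟨ trans (+-assoc (seq z k) _ _) (cong (seq z k +_) (halves ε)) ⟩
    seq z k + ε                      ∎
    where
    open ≤-Reasoning
    N₁ N₂ : ℕ
    N₁ = proj₁ (x≤y (½ * ε) (half 0<ε))
    N₂ = proj₁ (y≤z (½ * ε) (half 0<ε))

  ∑-gain : ∀ {n} {g h : Fin n → ℚ} j → (∀ i → g i ≤ h i) → g j + 1ℚ ≤ h j → ∑ g + 1ℚ ≤ ∑ h
  ∑-gain {g = g} zero g≤h gain = subst (_≤ _) (eq (g zero) _) (+-mono-≤ gain (∑-mono-≤ (g≤h ∘ suc)))
    where
    eq : ∀ a b → (a + 1ℚ) + b ≡ (a + b) + 1ℚ
    eq = solve-∀ ℚ-ring
  ∑-gain {g = g} (suc j) g≤h gain =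
    subst (_≤ _) (sym (+-assoc (g zero) _ 1ℚ)) (+-mono-≤ (g≤h zero) (∑-gain j (g≤h ∘ suc) gain))

  ι-∑ : ∀ {n} (g : Fin n → ℕ) → ι (Counting.∑ g) ≡ ∑ (ι ∘ g)
  ι-∑ {zero}  g = refl
  ι-∑ {suc n} g = trans (ι-+ (g zero) _) (cong (ι (g zero) +_) (ι-∑ (g ∘ suc)))

  ι-𝟙 : ∀ b → ι (Counting.𝟙 b) ≡ fromBool b
  ι-𝟙 true  = refl
  ι-𝟙 false = refl

  fromBool-mono : ∀ b b′ → (b ≡ true → b′ ≡ true) → fromBool b ≤ fromBool b′
  fromBool-mono false b′ _ = 0≤fromBool b′
  fromBool-mono true  b′ b⇒b′ rewrite b⇒b′ refl = ≤-refl

  strictly-below : ∀ b b′ → (b ≡ true → b′ ≡ true) → b ≢ b′ → fromBool b ≡ 0ℚ × fromBool b′ ≡ 1ℚ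
  strictly-below false true  _    _ = refl , refl
  strictly-below false false _    ≢ = contradiction refl ≢
  strictly-below true  b′    b⇒b′ ≢ = contradiction (sym (b⇒b′ refl)) ≢

  module _ (m : ℕ) (2≤m : 2ℚ ≤ ι m) where

    private
      q : ℚ
      q = ι m

      d : ℕ → ℚ
      d = δ q 2≤m

      0≤d : ∀ k → 0ℚ ≤ d k
      0≤d = 0≤δ q 2≤m

      N : ℕ
      N = 1 ℕ.+ (m ℕ.+ (2 ℕ.+ 1))

      X : ℕ → Fin N → ℚ
      X k = X₀ m 2≤m (d k)

    μℝ : ℝ
    μℝ = fromℚ q Defs.+ δℝ q 2≤m

    private
      -- Real arithmetic supplies the Cauchy property and boundedness, and the k-th terms are the
      -- entries of `X₀` at the k-th approximation of δ.
      eigenvector : Fin N → ℝ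
      eigenvector = weights m (1+δ Defs.* (μ-1 Defs.* μℝ)) (μ-1 Defs.* μℝ) (1+δ Defs.* μℝ) (1+δ Defs.* μ-1)
        where
        1+δ μ-1 : ℝ
        1+δ = 1ℝ Defs.+ δℝ q 2≤m
        μ-1 = μℝ Defs.+ fromℚ (- 1ℚ)

      seq-eigenvector : ∀ k i → seq (eigenvector i) k ≡ X k i
      seq-eigenvector k i = weights-map (λ x → seq x k) m i

      X-bounded : ∀ i → Bounded (λ k → X k i)
      X-bounded i = bounded-cong (λ k → seq-eigenvector k i) (bounded-seq (eigenvector i))
        where
        bounded-cong : ∀ {s t} → (∀ k → s k ≡ t k) → Bounded s → Bounded t
        bounded-cong eq (B , B>0 , M , s≤) = B , B>0 , M , λ k M≤k → subst (λ x → ∣ x ∣ ≤ B) (eq k) (s≤ k M≤k)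

      1≤q : 1ℚ ≤ q
      1≤q = ≤-trans (p≤p+q 0≤1) 2≤m

      1≤μ-1 : ∀ k → 1ℚ ≤ (q + d k) - 1ℚ
      1≤μ-1 k = +-monoˡ-≤ (- 1ℚ) (≤-trans 2≤m (p≤p+q (0≤d k)))

      1≤μ : ∀ k → 1ℚ ≤ q + d k
      1≤μ k = ≤-trans 1≤q (p≤p+q (0≤d k))

      1≤1+δ : ∀ k → 1ℚ ≤ 1ℚ + d k
      1≤1+δ k = p≤p+q (0≤d k)

      1≤X : ∀ k i → 1ℚ ≤ X k i
      1≤X k = weights-all m {P = 1ℚ ≤_} (1≤* (1≤1+δ k) (1≤* (1≤μ-1 k) (1≤μ k))) (1≤* (1≤μ-1 k) (1≤μ k))
                            (1≤* (1≤1+δ k) (1≤μ k)) (1≤* (1≤1+δ k) (1≤μ-1 k))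

      eigenvector≉0 : ¬ (∀ i → eigenvector i Defs.≈ Defs.0ℝ)
      eigenvector≉0 ≈0 = <-irrefl refl (<-≤-trans ½<1
          (≤-trans (1≤X (proj₁ small) zero) (subst (_≤ ½) eq (proj₂ small (proj₁ small) ℕ.≤-refl))))
        where
        ½<1 : ½ < 1ℚ
        ½<1 = *<* (ℤ.+<+ (ℕ.s≤s (ℕ.s≤s ℕ.z≤n)))
        small : ∃[ M ] (∀ k → M ℕ.≤ k → ∣ seq (eigenvector zero) k - 0ℚ ∣ ≤ ½)
        small = ≈0 zero ½ (positive⁻¹ ½)
        eq : ∣ X (proj₁ small) zero - 0ℚ ∣ ≡ X (proj₁ small) zero
        eq = trans (cong ∣_∣ (+-identityʳ (X (proj₁ small) zero))) (0≤p⇒∣p∣≡p (≤-trans 0≤1 (1≤X (proj₁ small) zero)))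

      error-null : ∀ i → Null (λ k → weights m (- f q 2≤m (d k)) 0ℚ 0ℚ 0ℚ i)
      error-null zero = null-neg (fδ-null q 2≤m)
      error-null (suc i) with splitAt m i
      ... | inj₁ _ = null-0
      ... | inj₂ j with splitAt 2 j
      ...   | inj₁ _ = null-0
      ...   | inj₂ _ = null-0

      isEigenvalue : IsEigenvalue (adjacencyMatrix (G₀ m)) μℝ
      isEigenvalue = eigenvector , eigenvector≉0 , λ i →
        null⇒eigen (adjacencyMatrix (G₀ m)) eigenvector μℝ i (Aℚ (G₀ m) i) (seq-adjacency (G₀ m) i)
          (null-cong (λ k → trans (sym (row-G₀ m 2≤m (d k) i)) (sym (cong₂ (λ r x → r - (q + d k) * x)
            (sum-cong-≗ (λ j → cong (Aℚ (G₀ m) i j *_) (seq-eigenvector k j))) (seq-eigenvector k i))))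
            (error-null i))

    μ≤ρ₀ : ∀ {ρ₀} → IsSpectralRadius (G₀ m) ρ₀ → μℝ Defs.≤ ρ₀
    μ≤ρ₀ ρ₀-radius = IsSpectralRadius.isLargest ρ₀-radius μℝ isEigenvalue

    -- The bound 1 / (q + 1)² serves all indices at once. It is the fixed rational that `perron`
    -- takes as strictness.
    δ-lower : ∃[ b ] (0ℚ < b × (∀ k → b ≤ d k))
    δ-lower = 1/ B , positive⁻¹ (1/ B) {{1/pos⇒pos B}} , λ k → *-cancelʳ-≤-pos B
        (subst (_≤ d k * B) (sym (*-inverseˡ B)) (1≤δ[q+1]² q 2≤m k))
      where
      B : ℚ
      B = (q + 1ℚ) * (q + 1ℚ)
      instance
        B>0 : Positive B
        B>0 = positive (<-≤-trans (positive⁻¹ 1ℚ) (1≤* (p≤q+p (≤-trans 0≤1 1≤q)) (p≤q+p (≤-trans 0≤1 1≤q))))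
        B≢0 : NonZero B
        B≢0 = pos⇒nonZero B

    module _ {n} (G : Graph n) (conn : Connected G) (ρ : ℝ)
      (ρ-eig : IsEigenvalue (adjacencyMatrix G) ρ) (μ≤ρ : μℝ Defs.≤ ρ) where

      -- The strictness comes from μ > m and not from x: as the entries are at least 1, (m + δ) x
      -- exceeds m x by at least b in every row.
      noTestVector : Fin n → (x : Fin n → ℕ) → (∀ i → 1 ℕ.≤ x i) →
        (∀ i → Counting.∑ (λ j → Paths.A G i j ℕ.* x j) ℕ.≤ m ℕ.* x i) → ⊥
      noTestVector i₀ x 1≤x Ax≤mx = perron G conn ρ ρ-eig μℝ μ≤ρ (λ _ i → ι (x i)) (λ _ → b)
        (λ i → bounded-const (ι (x i))) (λ _ i → 1≤ιx i) (λ _ → <⇒≤ 0<b) bound i₀ 0<b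
        where
        b = proj₁ δ-lower
        0<b = proj₁ (proj₂ δ-lower)
        1≤ιx : ∀ i → 1ℚ ≤ ι (x i)
        1≤ιx i = ι-mono (1≤x i)
        bound : ∀ k i → ∑ (λ j → Aℚ G i j * ι (x j)) + b ≤ (q + d k) * ι (x i)
        bound k i = begin
          ∑ (λ j → Aℚ G i j * ι (x j)) + b
            ≡⟨ cong (_+ b) (trans (sum-cong-≗ (λ j → trans (cong (_* ι (x j)) (sym (ι-𝟙 (adj G i j)))) (sym (ι-* (Paths.A G i j) (x j)))))
                                  (sym (ι-∑ (λ j → Paths.A G i j ℕ.* x j)))) ⟩
          ι (Counting.∑ (λ j → Paths.A G i j ℕ.* x j)) + b
            ≤⟨ +-mono-≤ (ι-mono (Ax≤mx i)) (proj₂ (proj₂ δ-lower) k) ⟩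
          ι (m ℕ.* x i) + d k
            ≡⟨ cong₂ _+_ (ι-* m (x i)) (sym (*-identityʳ (d k))) ⟩
          q * ι (x i) + d k * 1ℚ
            ≤⟨ +-monoʳ-≤ (q * ι (x i)) (*-mono-≤ˡ (0≤d k) (1≤ιx i)) ⟩
          q * ι (x i) + d k * ι (x i)
            ≡⟨ *-distribʳ-+ (ι (x i)) q (d k) ⟨
          (q + d k) * ι (x i) ∎
          where open ≤-Reasoning

      -- Pulled back along π, the vector of the extremal graph still satisfies A X ≤ μ X. The
      -- missing edge takes X v ≥ 1 away from row u, so the indicator of u can serve as Δ.
      noMissingEdge : (π : Fin n ↔ Fin N) →
        (∀ u v → adj G u v ≡ true → adj (G₀ m) (Inverse.to π u) (Inverse.to π v) ≡ true) →
        ∀ u v → adj G u v ≢ adj (G₀ m) (Inverse.to π u) (Inverse.to π v) → ⊥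
      noMissingEdge π hom u v ≢ = perron G conn ρ ρ-eig μℝ μ≤ρ X′ Δ X′-bounded 1≤X′ 0≤Δ bound u 0<Δ
        where
        to : Fin n → Fin N
        to = Inverse.to π
        X′ : ℕ → Fin n → ℚ
        X′ k i = X k (to i)
        X′-bounded : ∀ i → Bounded (λ k → X′ k i)
        X′-bounded i = X-bounded (to i)
        1≤X′ : ∀ k i → 1ℚ ≤ X′ k i
        1≤X′ k i = 1≤X k (to i)
        Δ : Fin n → ℚ
        Δ i = fromBool (u Counting.== i)
        0≤Δ : ∀ i → 0ℚ ≤ Δ i
        0≤Δ i = 0≤fromBool (u Counting.== i)
        0<Δ : 0ℚ < Δ u
        0<Δ = subst (λ b → 0ℚ < fromBool b) (sym (Counting.==-refl u)) (positive⁻¹ 1ℚ)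
        mono : ∀ i j → Aℚ G i j ≤ Aℚ (G₀ m) (to i) (to j)
        mono i j = fromBool-mono (adj G i j) (adj (G₀ m) (to i) (to j)) (hom i j)
        missing : Aℚ G u v ≡ 0ℚ × Aℚ (G₀ m) (to u) (to v) ≡ 1ℚ
        missing = strictly-below (adj G u v) (adj (G₀ m) (to u) (to v)) (hom u v) ≢
        0≤X : ∀ k i → 0ℚ ≤ X k i
        0≤X k i = ≤-trans 0≤1 (1≤X k i)
        compareAt : ∀ k i → Dec (u ≡ i) →
          ∑ (λ j → Aℚ G i j * X k (to j)) + Δ i ≤ ∑ (λ j → Aℚ (G₀ m) (to i) (to j) * X k (to j))
        compareAt k i (no u≢i) = ≤-trans
          (≤-reflexive (trans (cong (λ b → ∑ (λ j → Aℚ G i j * X k (to j)) + fromBool b) (Counting.==-≢ u≢i))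
                              (+-identityʳ (∑ (λ j → Aℚ G i j * X k (to j))))))
          (∑-mono-≤ (λ j → *-mono-≤ʳ (0≤X k (to j)) (mono i j)))
        compareAt k i (yes refl) = ≤-trans
          (≤-reflexive (cong (λ b → ∑ (λ j → Aℚ G u j * X k (to j)) + fromBool b) (Counting.==-refl u)))
          (∑-gain {g = λ j → Aℚ G u j * X k (to j)} {λ j → Aℚ (G₀ m) (to u) (to j) * X k (to j)} v
            (λ j → *-mono-≤ʳ (0≤X k (to j)) (mono u j))
            (gain (X k (to v)) (1≤X k (to v)) missing))
          where
          gain : ∀ {a a₀} x → 1ℚ ≤ x → a ≡ 0ℚ × a₀ ≡ 1ℚ → a * x + 1ℚ ≤ a₀ * x
          gain x 1≤x (refl , refl) = subst₂ _≤_ (sym (cong (_+ 1ℚ) (*-zeroˡ x))) (sym (*-identityˡ x)) 1≤x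
        bound : ∀ k i → ∑ (λ j → Aℚ G i j * X k (to j)) + Δ i ≤ (q + d k) * X k (to i)
        bound k i = begin
          ∑ (λ j → Aℚ G i j * X k (to j)) + Δ i
            ≤⟨ compareAt k i (u Fin.≟ i) ⟩
          ∑ (λ j → Aℚ (G₀ m) (to i) (to j) * X k (to j))
            ≡⟨ ∑-permute (λ j → Aℚ (G₀ m) (to i) j * X k j) π ⟨
          row (G₀ m) (X k) (to i)
            ≡⟨ split (row (G₀ m) (X k) (to i)) ((q + d k) * X k (to i)) ⟩
          (row (G₀ m) (X k) (to i) - (q + d k) * X k (to i)) + (q + d k) * X k (to i)
            ≤⟨ +-monoˡ-≤ _ (subst (_≤ 0ℚ) (sym (row-G₀ m 2≤m (d k) (to i)))
                 (weights-all m {P = _≤ 0ℚ} (neg-antimono-≤ (0≤fδ q 2≤m k)) ≤-refl ≤-refl ≤-refl (to i))) ⟩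
          0ℚ + (q + d k) * X k (to i)
            ≡⟨ +-identityˡ _ ⟩
          (q + d k) * X k (to i) ∎
          where
          open ≤-Reasoning
          split : ∀ a b → a ≡ (a - b) + b
          split = solve-∀ ℚ-ring

      noProperEmbedding : (π : Fin n ↔ Fin N) →
        (∀ u v → adj G u v ≡ true → adj (G₀ m) (Inverse.to π u) (Inverse.to π v) ≡ true) →
        ¬ (G ≅ G₀ m) → ⊥
      noProperEmbedding π hom G≇G₀ with Fin.any? (λ u → Fin.any? (λ v → ¬? (adj G u v Bool.≟ adj (G₀ m) (Inverse.to π u) (Inverse.to π v))))
      ... | no  none          = G≇G₀ (π , λ u v → decidable-stable (_ Bool.≟ _) (λ ≢ → none (u , v , ≢)))
      ... | yes (u , v , ≢) = noMissingEdge π hom u v ≢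

-- Three pendant vertices with distinct neighbours.

module Pendants where

  open Defs using (Graph; adj; Adj; Connected; adjacencyMatrix; IsEigenvalue)
  open Rationals
  open Perron
  open Root
  open Extremal
  open Counting using (_==_)
  open import Data.Rational.Base hiding (truncate)
  open import Data.Rational.Properties
  open import Tactic.RingSolver using (solve-∀)

  ⟦_≡_⟧ : ∀ {n} → Fin n → Fin n → ℚ
  ⟦ i ≡ j ⟧ = fromBool (i == j)

  ⟦≡⟧-refl : ∀ {n} (i : Fin n) → ⟦ i ≡ i ⟧ ≡ 1ℚ
  ⟦≡⟧-refl i = cong fromBool (Counting.==-refl i)

  ⟦≡⟧-≢ : ∀ {n} {i j : Fin n} → i ≢ j → ⟦ i ≡ j ⟧ ≡ 0ℚ
  ⟦≡⟧-≢ i≢j = cong fromBool (Counting.==-≢ i≢j)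

  0≤⟦≡⟧ : ∀ {n} (i j : Fin n) → 0ℚ ≤ ⟦ i ≡ j ⟧
  0≤⟦≡⟧ i j = 0≤fromBool (i == j)

  ∑-pick : ∀ {n} (i : Fin n) (x : Fin n → ℚ) → ∑ (λ j → ⟦ i ≡ j ⟧ * x j) ≡ x i
  ∑-pick {suc n} zero x = trans (cong₂ _+_ (*-identityˡ (x zero))
    (trans (sum-cong-≗ (λ j → *-zeroˡ (x (suc j)))) (∑-zero n))) (+-identityʳ (x zero))
  ∑-pick {suc n} (suc i) x = trans (cong₂ _+_ (*-zeroˡ (x zero)) (∑-pick i (λ j → x (suc j)))) (+-identityˡ _)

  module _ {k n} (g : Fin k → Fin n) where

    -- For injective g this is the indicator of its image; as a sum over the domain of g it lets
    -- double sums be exchanged.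
    hits : Fin n → ℚ
    hits i = ∑ (λ l → ⟦ g l ≡ i ⟧)

    hits-∉ : ∀ {i} → (∀ l → g l ≢ i) → hits i ≡ 0ℚ
    hits-∉ g≢i = trans (sum-cong-≗ (λ l → ⟦≡⟧-≢ (g≢i l))) (∑-zero k)

    hits-∈ : (∀ {l l′} → g l ≡ g l′ → l ≡ l′) → ∀ l → hits (g l) ≡ 1ℚ
    hits-∈ inj l = trans (sum-cong-≗ same) (∑-pick l (λ _ → 1ℚ))
      where
      same : ∀ l′ → ⟦ g l′ ≡ g l ⟧ ≡ ⟦ l ≡ l′ ⟧ * 1ℚ
      same l′ with l Fin.≟ l′
      ... | yes refl = ⟦≡⟧-refl (g l)
      ... | no  l≢l′ = ⟦≡⟧-≢ (λ eq → l≢l′ (sym (inj eq)))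

    ∑-hits : ∀ x → ∑ (λ j → hits j * x j) ≡ ∑ (λ l → x (g l))
    ∑-hits x = begin
      ∑ (λ j → hits j * x j)
        ≡⟨ sum-cong-≗ (λ j → *-distribʳ-sum (x j) (λ l → ⟦ g l ≡ j ⟧)) ⟩
      ∑ (λ j → ∑ (λ l → ⟦ g l ≡ j ⟧ * x j))
        ≡⟨ ∑-comm (λ j l → ⟦ g l ≡ j ⟧ * x j) ⟩
      ∑ (λ l → ∑ (λ j → ⟦ g l ≡ j ⟧ * x j))
        ≡⟨ sum-cong-≗ (λ l → ∑-pick (g l) x) ⟩
      ∑ (λ l → x (g l)) ∎
      where open ≡-Reasoning

  module _ (m : ℕ) (2≤m : 2ℚ ≤ ι m) {n} (n≡ : ι n ≡ ι m + (3ℚ + 1ℚ)) (G : Graph n)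
    (p c : Fin 3 → Fin n)
    (p-inj : ∀ {l l′} → p l ≡ p l′ → l ≡ l′) (c-inj : ∀ {l l′} → c l ≡ c l′ → l ≡ l′)
    (p≢c : ∀ l l′ → p l ≢ c l′) (pendant : ∀ l {y} → Adj G (p l) y → y ≡ c l) where

    private
      q : ℚ
      q = ι m

    module _ (d b : ℚ) (0≤d : 0ℚ ≤ d) (b≤d : b ≤ d) (0≤b : 0ℚ ≤ b) (0≤fd : 0ℚ ≤ f q 2≤m d) where

      private
        -- Let y, z and a be the weights at pendants, at their neighbours and elsewhere. When the n
        -- - 3 = m + 1 other vertices form a clique, the row of a pendant asks for z = μ y, and the
        -- row of one of the m - 2 remaining vertices asks for 3 z = (3 + d) a. The choice a = 3 μ
        -- solves both; γ is the drop from a to y = 3 + d.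
        μ α β γ : ℚ
        μ = q + d
        α = 3ℚ * μ
        β = d * μ
        γ = 3ℚ * μ - (3ℚ + d)

        1≤q : 1ℚ ≤ q
        1≤q = ≤-trans (p≤p+q 0≤1) 2≤m

        2≤μ : 2ℚ ≤ μ
        2≤μ = ≤-trans 2≤m (p≤p+q 0≤d)

      -- 3 + d at pendants, (3 + d) μ at their neighbours, 3 μ elsewhere.
      Xp : Fin n → ℚ
      Xp i = (α + β * hits c i) - γ * hits p i

      Xp-p : ∀ l → Xp (p l) ≡ 3ℚ + d
      Xp-p l = trans (cong₂ (λ h h′ → (α + β * h) - γ * h′) (hits-∉ c (λ l′ e → p≢c l l′ (sym e))) (hits-∈ p p-inj l)) (eq α β d 3ℚ)
        where
        eq : ∀ a b d t → (a + b * 0ℚ) - (a - (t + d)) * 1ℚ ≡ t + d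
        eq = solve-∀ ℚ-ring

      Xp-c : ∀ l → Xp (c l) ≡ α + β
      Xp-c l = trans (cong₂ (λ h h′ → (α + β * h) - γ * h′) (hits-∈ c c-inj l) (hits-∉ p (λ l′ e → p≢c l′ l e))) (eq α β γ)
        where
        eq : ∀ a b g → (a + b * 1ℚ) - g * 0ℚ ≡ a + b
        eq = solve-∀ ℚ-ring

      Xp-other : ∀ {i} → (∀ l → c l ≢ i) → (∀ l → p l ≢ i) → Xp i ≡ α
      Xp-other c≢ p≢ = trans (cong₂ (λ h h′ → (α + β * h) - γ * h′) (hits-∉ c c≢) (hits-∉ p p≢)) (eq α β γ)
        where
        eq : ∀ a b g → (a + b * 0ℚ) - g * 0ℚ ≡ a
        eq = solve-∀ ℚ-ring

      data Kind (i : Fin n) : Set where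
        isP   : ∀ l → p l ≡ i → Kind i
        isC   : ∀ l → c l ≡ i → Kind i
        other : (∀ l → c l ≢ i) → (∀ l → p l ≢ i) → Kind i

      kind : ∀ i → Kind i
      kind i with Fin.any? (λ l → p l Fin.≟ i) | Fin.any? (λ l → c l Fin.≟ i)
      ... | yes (l , eq) | _            = isP l eq
      ... | no  _        | yes (l , eq) = isC l eq
      ... | no  ∉p       | no ∉c        = other (λ l eq → ∉c (l , eq)) (λ l eq → ∉p (l , eq))

      1≤α : 1ℚ ≤ α
      1≤α = 1≤* (p≤q+p (0≤+ 0≤1 0≤1)) (≤-trans (p≤p+q 0≤1) 2≤μ)

      0≤β : 0ℚ ≤ β
      0≤β = 0≤* 0≤d (≤-trans (nonNegative⁻¹ 2ℚ) 2≤μ)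

      1≤Xp : ∀ i → 1ℚ ≤ Xp i
      1≤Xp i with kind i
      ... | isP l refl = subst (1ℚ ≤_) (sym (Xp-p l)) (≤-trans (p≤q+p (0≤+ 0≤1 0≤1)) (p≤p+q {3ℚ} 0≤d))
      ... | isC l refl = subst (1ℚ ≤_) (sym (Xp-c l)) (≤-trans 1≤α (p≤p+q 0≤β))
      ... | other ∉c ∉p = subst (1ℚ ≤_) (sym (Xp-other ∉c ∉p)) 1≤α

      0≤Xp : ∀ i → 0ℚ ≤ Xp i
      0≤Xp i = ≤-trans 0≤1 (1≤Xp i)

      ∑Xp : ∑ Xp ≡ ι n * α + 3ℚ * β - 3ℚ * γ
      ∑Xp = begin
        ∑ (λ i → (α + β * hits c i) - γ * hits p i)
          ≡⟨ sum-cong-≗ (λ i → cong ((α + β * hits c i) +_) (neg-distribˡ-* γ (hits p i))) ⟩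
        ∑ (λ i → (α + β * hits c i) + (- γ) * hits p i)
          ≡⟨ ∑-distrib-+ (λ i → α + β * hits c i) _ ⟩
        ∑ (λ i → α + β * hits c i) + ∑ (λ i → (- γ) * hits p i)
          ≡⟨ cong₂ _+_ (∑-distrib-+ {n} (λ _ → α) _) (three (- γ) p) ⟩
        (∑ {n} (λ _ → α) + ∑ (λ i → β * hits c i)) + 3ℚ * (- γ)
          ≡⟨ cong₂ _+_ (cong₂ _+_ (∑-const n α) (three β c)) (sym (neg-distribʳ-* 3ℚ γ)) ⟩
        ι n * α + 3ℚ * β - 3ℚ * γ ∎
        where
        open ≡-Reasoning
        three : ∀ s (g : Fin 3 → Fin n) → ∑ (λ i → s * hits g i) ≡ 3ℚ * s
        three s g = trans (sum-cong-≗ (λ i → *-comm s (hits g i))) (trans (∑-hits g (λ _ → s)) (eq s))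
          where
          eq : ∀ s → s + (s + (s + 0ℚ)) ≡ (1ℚ + 1ℚ + 1ℚ) * s
          eq = solve-∀ ℚ-ring

      row-pendant : ∀ l → row G Xp (p l) ≤ α + β
      row-pendant l = subst (row G Xp (p l) ≤_) (trans (∑-pick (c l) Xp) (Xp-c l))
        (∑-mono-≤ (λ j → *-mono-≤ʳ (0≤Xp j) (only j)))
        where
        only : ∀ j → Aℚ G (p l) j ≤ ⟦ c l ≡ j ⟧
        only j with adj G (p l) j in eq
        ... | false = 0≤⟦≡⟧ (c l) j
        ... | true  = subst (λ z → 1ℚ ≤ ⟦ c l ≡ z ⟧) (sym (pendant l eq)) (≤-reflexive (sym (⟦≡⟧-refl (c l))))

      -- A + I is at most the all-ones matrix, and i is adjacent to a pendant only if it is the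
      -- neighbour of that pendant. So all pendant columns may be added on the left, against those
      -- with c l = i on the right.
      row-nonpendant : ∀ i → (∀ l → p l ≢ i) →
        (row G Xp i + Xp i) + 3ℚ * (3ℚ + d) ≤ ∑ Xp + hits c i * (3ℚ + d)
      row-nonpendant i ∉p = subst₂ _≤_ lhs rhs (∑-mono-≤ (λ j → *-mono-≤ʳ (0≤Xp j) (coeff j)))
        where
        joined : Fin n → ℚ
        joined j = ∑ (λ l → ⟦ c l ≡ i ⟧ * ⟦ p l ≡ j ⟧)

        coeff : ∀ j → (Aℚ G i j + ⟦ i ≡ j ⟧) + hits p j ≤ 1ℚ + joined j
        coeff j with Fin.any? (λ l → p l Fin.≟ j)
        ... | no ∉ = subst (λ h → (Aℚ G i j + ⟦ i ≡ j ⟧) + h ≤ 1ℚ + joined j) (sym (hits-∉ p (λ l eq → ∉ (l , eq))))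
              (≤-trans (≤-reflexive (+-identityʳ _)) (≤-trans at-most (p≤p+q (0≤∑ (λ l → 0≤* (0≤⟦≡⟧ (c l) i) (0≤⟦≡⟧ (p l) j))))))
          where
          at-most : Aℚ G i j + ⟦ i ≡ j ⟧ ≤ 1ℚ
          at-most with i Fin.≟ j
          ... | yes refl rewrite Defs.no-loop G i = ≤-refl
          ... | no _ with adj G i j
          ...   | true  = ≤-refl
          ...   | false = 0≤1
        ... | yes (l , refl) = subst₂ (λ h e → (Aℚ G i (p l) + e) + h ≤ 1ℚ + joined (p l))
              (sym (hits-∈ p p-inj l)) (sym (⟦≡⟧-≢ (λ e → ∉p l (sym e))))
              (subst (_≤ 1ℚ + joined (p l)) (eq (Aℚ G i (p l))) (+-monoʳ-≤ 1ℚ adjacent))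
          where
          eq : ∀ a → 1ℚ + a ≡ (a + 0ℚ) + 1ℚ
          eq = solve-∀ ℚ-ring
          adjacent : Aℚ G i (p l) ≤ joined (p l)
          adjacent with adj G i (p l) in e
          ... | false = 0≤∑ (λ l′ → 0≤* (0≤⟦≡⟧ (c l′) i) (0≤⟦≡⟧ (p l′) (p l)))
          ... | true  = subst (_≤ joined (p l)) (cong₂ _*_ ci (⟦≡⟧-refl (p l)))
                (term≤∑ (λ l′ → 0≤* (0≤⟦≡⟧ (c l′) i) (0≤⟦≡⟧ (p l′) (p l))) l)
            where
            ci : ⟦ c l ≡ i ⟧ ≡ 1ℚ
            ci = trans (cong (λ z → ⟦ c l ≡ z ⟧) (pendant l (trans (Defs.adj-sym G (p l) i) e))) (⟦≡⟧-refl (c l))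

        at-p : ∑ (λ l → Xp (p l)) ≡ 3ℚ * (3ℚ + d)
        at-p = trans (sum-cong-≗ Xp-p) (eq (3ℚ + d))
          where
          eq : ∀ s → s + (s + (s + 0ℚ)) ≡ (1ℚ + 1ℚ + 1ℚ) * s
          eq = solve-∀ ℚ-ring

        lhs : ∑ (λ j → ((Aℚ G i j + ⟦ i ≡ j ⟧) + hits p j) * Xp j) ≡ (row G Xp i + Xp i) + 3ℚ * (3ℚ + d)
        lhs = begin
          ∑ (λ j → ((Aℚ G i j + ⟦ i ≡ j ⟧) + hits p j) * Xp j)
            ≡⟨ sum-cong-≗ (λ j → expand (Aℚ G i j) ⟦ i ≡ j ⟧ (hits p j) (Xp j)) ⟩
          ∑ (λ j → (Aℚ G i j * Xp j + ⟦ i ≡ j ⟧ * Xp j) + hits p j * Xp j)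
            ≡⟨ ∑-distrib-+ (λ j → Aℚ G i j * Xp j + ⟦ i ≡ j ⟧ * Xp j) _ ⟩
          ∑ (λ j → Aℚ G i j * Xp j + ⟦ i ≡ j ⟧ * Xp j) + ∑ (λ j → hits p j * Xp j)
            ≡⟨ cong₂ _+_ (trans (∑-distrib-+ (λ j → Aℚ G i j * Xp j) _) (cong (row G Xp i +_) (∑-pick i Xp)))
                         (trans (∑-hits p Xp) at-p) ⟩
          (row G Xp i + Xp i) + 3ℚ * (3ℚ + d) ∎
          where
          open ≡-Reasoning
          expand : ∀ a e h x → ((a + e) + h) * x ≡ (a * x + e * x) + h * x
          expand = solve-∀ ℚ-ring

        rhs : ∑ (λ j → (1ℚ + joined j) * Xp j) ≡ ∑ Xp + hits c i * (3ℚ + d)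
        rhs = begin
          ∑ (λ j → (1ℚ + joined j) * Xp j)
            ≡⟨ sum-cong-≗ (λ j → trans (*-distribʳ-+ (Xp j) 1ℚ (joined j)) (cong₂ _+_ (*-identityˡ (Xp j))
                 (*-distribʳ-sum (Xp j) (λ l → ⟦ c l ≡ i ⟧ * ⟦ p l ≡ j ⟧)))) ⟩
          ∑ (λ j → Xp j + ∑ (λ l → (⟦ c l ≡ i ⟧ * ⟦ p l ≡ j ⟧) * Xp j))
            ≡⟨ ∑-distrib-+ Xp _ ⟩
          ∑ Xp + ∑ (λ j → ∑ (λ l → (⟦ c l ≡ i ⟧ * ⟦ p l ≡ j ⟧) * Xp j))
            ≡⟨ cong (∑ Xp +_) (∑-comm (λ j l → (⟦ c l ≡ i ⟧ * ⟦ p l ≡ j ⟧) * Xp j)) ⟩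
          ∑ Xp + ∑ (λ l → ∑ (λ j → (⟦ c l ≡ i ⟧ * ⟦ p l ≡ j ⟧) * Xp j))
            ≡⟨ cong (∑ Xp +_) (sum-cong-≗ (λ l → trans
                 (trans (sum-cong-≗ (λ j → *-assoc ⟦ c l ≡ i ⟧ ⟦ p l ≡ j ⟧ (Xp j)))
                        (sym (*-distribˡ-sum ⟦ c l ≡ i ⟧ (λ j → ⟦ p l ≡ j ⟧ * Xp j))))
                 (cong (⟦ c l ≡ i ⟧ *_) (trans (∑-pick (p l) Xp) (Xp-p l))))) ⟩
          ∑ Xp + ∑ (λ l → ⟦ c l ≡ i ⟧ * (3ℚ + d))
            ≡⟨ cong (∑ Xp +_) (*-distribʳ-sum (3ℚ + d) (λ l → ⟦ c l ≡ i ⟧)) ⟨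
          ∑ Xp + hits c i * (3ℚ + d) ∎
          where open ≡-Reasoning

      -- 0 ≤ f d says (μ - 1) d μ (μ + 1) ≥ (1 + d)(3μ - 1) ≥ 3 (1 + d)(μ - 1).
      slack-at-c : (3ℚ + d) + (d + d) ≤ d * (μ * (μ + 1ℚ))
      slack-at-c = *-cancelʳ-≤-pos (μ - 1ℚ) {{positive 0<μ-1}}
        (≤-by {r = f q 2≤m d + (1ℚ + d) * 2ℚ} (0≤+ 0≤fd (0≤* (0≤+ 0≤1 0≤d) (nonNegative⁻¹ 2ℚ))) (eq q d))
        where
        0<μ-1 : 0ℚ < μ - 1ℚ
        0<μ-1 = <-≤-trans (positive⁻¹ 1ℚ) (+-monoˡ-≤ (- 1ℚ) 2≤μ)
        eq : ∀ q d → let t = 1ℚ + 1ℚ + 1ℚ; μ = q + d in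
          d * (μ * (μ + 1ℚ)) * (μ - 1ℚ) ≡
          ((t + d) + (d + d)) * (μ - 1ℚ) +
          ((d * (μ * μ * μ - μ) - (1ℚ + d) * (t * μ - 1ℚ)) + (1ℚ + d) * (1ℚ + 1ℚ))
        eq = solve-∀ ℚ-ring

      Δp : Fin n → ℚ
      Δp i = b * hits c i

      -- The bounds at the pendants and at the vertices away from p and c come out equal to μ X, by
      -- the choice of weights. Strictness comes from the neighbours of the pendants alone, where
      -- `slack-at-c` leaves room for d + d ≥ b.
      supersolution : ∀ i → row G Xp i + Δp i ≤ μ * Xp i
      supersolution i with kind i
      ... | isP l refl = begin
        row G Xp (p l) + b * hits c (p l)
          ≡⟨ cong (λ h → row G Xp (p l) + b * h) (hits-∉ c (λ l′ e → p≢c l l′ (sym e))) ⟩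
        row G Xp (p l) + b * 0ℚ
          ≡⟨ trans (cong (row G Xp (p l) +_) (*-zeroʳ b)) (+-identityʳ _) ⟩
        row G Xp (p l)
          ≤⟨ row-pendant l ⟩
        α + β
          ≡⟨ eq q d 3ℚ ⟩
        μ * (3ℚ + d)
          ≡⟨ cong (μ *_) (Xp-p l) ⟨
        μ * Xp (p l) ∎
        where
        open ≤-Reasoning
        eq : ∀ q d t → t * (q + d) + d * (q + d) ≡ (q + d) * (t + d)
        eq = solve-∀ ℚ-ring
      ... | other ∉c ∉p = begin
        row G Xp i + b * hits c i
          ≡⟨ trans (cong (λ h → row G Xp i + b * h) (hits-∉ c ∉c)) (trans (cong (row G Xp i +_) (*-zeroʳ b)) (+-identityʳ _)) ⟩
        row G Xp i
          ≡⟨ isolate (row G Xp i) (Xp i) (3ℚ * (3ℚ + d)) ⟩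
        ((row G Xp i + Xp i) + 3ℚ * (3ℚ + d)) - (Xp i + 3ℚ * (3ℚ + d))
          ≤⟨ +-monoˡ-≤ _ (row-nonpendant i ∉p) ⟩
        (∑ Xp + hits c i * (3ℚ + d)) - (Xp i + 3ℚ * (3ℚ + d))
          ≡⟨ cong₂ (λ s x → s - (x + 3ℚ * (3ℚ + d)))
               (cong₂ (λ s h → s + h * (3ℚ + d)) (trans ∑Xp (cong (λ z → z * α + 3ℚ * β - 3ℚ * γ) n≡)) (hits-∉ c ∉c))
               (Xp-other ∉c ∉p) ⟩
        ((((q + (3ℚ + 1ℚ)) * α + 3ℚ * β) - 3ℚ * γ) + 0ℚ * (3ℚ + d)) - (α + 3ℚ * (3ℚ + d))
          ≡⟨ eq q d ⟩
        μ * α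
          ≡⟨ cong (μ *_) (Xp-other ∉c ∉p) ⟨
        μ * Xp i ∎
        where
        open ≤-Reasoning
        isolate : ∀ r x z → r ≡ ((r + x) + z) - (x + z)
        isolate = solve-∀ ℚ-ring
        eq : ∀ q d → let t = 1ℚ + 1ℚ + 1ℚ; μ = q + d in
          ((((q + (t + 1ℚ)) * (t * μ) + t * (d * μ))
            - t * (t * μ - (t + d))) + 0ℚ * (t + d))
            - (t * μ + t * (t + d)) ≡ μ * (t * μ)
        eq = solve-∀ ℚ-ring
      ... | isC l refl = begin
        row G Xp (c l) + b * hits c (c l)
          ≤⟨ +-monoʳ-≤ (row G Xp (c l)) (≤-trans (≤-reflexive (trans (cong (b *_) (hits-∈ c c-inj l)) (*-identityʳ b))) (≤-trans b≤d (p≤p+q 0≤d))) ⟩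
        row G Xp (c l) + (d + d)
          ≡⟨ isolate (row G Xp (c l)) (Xp (c l)) (3ℚ * (3ℚ + d)) (d + d) ⟩
        ((row G Xp (c l) + Xp (c l)) + 3ℚ * (3ℚ + d)) + ((d + d) - (Xp (c l) + 3ℚ * (3ℚ + d)))
          ≤⟨ +-monoˡ-≤ _ (row-nonpendant (c l) (λ l′ e → p≢c l′ l e)) ⟩
        (∑ Xp + hits c (c l) * (3ℚ + d)) + ((d + d) - (Xp (c l) + 3ℚ * (3ℚ + d)))
          ≡⟨ cong₂ (λ s x → s + ((d + d) - (x + 3ℚ * (3ℚ + d))))
               (cong₂ (λ s h → s + h * (3ℚ + d)) (trans ∑Xp (cong (λ z → z * α + 3ℚ * β - 3ℚ * γ) n≡)) (hits-∈ c c-inj l))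
               (Xp-c l) ⟩
        ((((q + (3ℚ + 1ℚ)) * α + 3ℚ * β) - 3ℚ * γ) + 1ℚ * (3ℚ + d)) + ((d + d) - ((α + β) + 3ℚ * (3ℚ + d)))
          ≡⟨ eq q d ⟩
        ((3ℚ + d) + (d + d)) + (μ * (α + β) - d * (μ * (μ + 1ℚ)))
          ≤⟨ +-monoˡ-≤ _ slack-at-c ⟩
        d * (μ * (μ + 1ℚ)) + (μ * (α + β) - d * (μ * (μ + 1ℚ)))
          ≡⟨ cancel (d * (μ * (μ + 1ℚ))) (μ * (α + β)) ⟩
        μ * (α + β)
          ≡⟨ cong (μ *_) (Xp-c l) ⟨
        μ * Xp (c l) ∎
        where
        open ≤-Reasoning
        isolate : ∀ r x z e → r + e ≡ ((r + x) + z) + (e - (x + z))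
        isolate = solve-∀ ℚ-ring
        cancel : ∀ a b → a + (b - a) ≡ b
        cancel = solve-∀ ℚ-ring
        eq : ∀ q d → let t = 1ℚ + 1ℚ + 1ℚ; μ = q + d in
          ((((q + (t + 1ℚ)) * (t * μ) + t * (d * μ))
            - t * (t * μ - (t + d))) + 1ℚ * (t + d))
            + ((d + d) - ((t * μ + d * μ) + t * (t + d))) ≡
            ((t + d) + (d + d)) + (μ * (t * μ + d * μ) - d * (μ * (μ + 1ℚ)))
        eq = solve-∀ ℚ-ring

    noThreePendants : Connected G → ∀ ρ → IsEigenvalue (adjacencyMatrix G) ρ → μℝ m 2≤m Defs.≤ ρ → ⊥
    noThreePendants conn ρ ρ-eig μ≤ρ = perron G conn ρ ρ-eig (μℝ m 2≤m) μ≤ρ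
        (λ k → Xp (d k) b (0≤d k) (b≤d k) 0≤b (0≤fδ q 2≤m k)) (λ i → b * hits c i)
        (λ i → bounded-+ (bounded-+ (bounded-* 3b μb) (bounded-* (bounded-* (δ-bounded q 2≤m) μb) (bounded-const (hits c i))))
          (bounded-neg (bounded-* (bounded-+ (bounded-* 3b μb) (bounded-neg (bounded-+ 3b (δ-bounded q 2≤m)))) (bounded-const (hits p i)))))
        (λ k → 1≤Xp (d k) b (0≤d k) (b≤d k) 0≤b (0≤fδ q 2≤m k))
        (λ i → 0≤* 0≤b (0≤∑ (λ l → 0≤⟦≡⟧ (c l) i)))
        (λ k → supersolution (d k) b (0≤d k) (b≤d k) 0≤b (0≤fδ q 2≤m k))
        (c zero) (subst (0ℚ <_) (sym (trans (cong (b *_) (hits-∈ c c-inj zero)) (*-identityʳ b))) (proj₁ (proj₂ (δ-lower m 2≤m))))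
      where
      d = δ q 2≤m
      0≤d = 0≤δ q 2≤m
      b = proj₁ (δ-lower m 2≤m)
      0≤b = <⇒≤ (proj₁ (proj₂ (δ-lower m 2≤m)))
      b≤d = proj₂ (proj₂ (δ-lower m 2≤m))
      3b = bounded-const 3ℚ
      μb = bounded-+ (bounded-const q) (δ-bounded q 2≤m)
      bounded-neg : ∀ {s} → Bounded s → Bounded (λ k → - s k)
      bounded-neg {s} (B , B>0 , M , s≤) = B , B>0 , M , λ k M≤k → subst (_≤ B) (sym (∣-p∣≡∣p∣ (s k))) (s≤ k M≤k)

-- Embedding a graph with a pair and a leaf at one vertex into the extremal graph.

module Embedding where

  open Defs using (Graph; adj; Adj; adj-sym; K; _∪_)
  open Extremal using (G₀)
  open import Data.Fin.Permutation using (Permutation; transpose; _∘ₚ_; _⟨$⟩ʳ_)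
  import Data.Fin.Permutation.Components as Components
  open import Data.Nat.Base using (_+_)
  open import Data.Nat.Properties using (+-comm)
  open import Function.Bundles using (_↔_; Inverse)
  open import Function.Construct.Identity using (↔-id)

  transpose-at : ∀ {n} (i j : Fin n) → Components.transpose i j i ≡ j
  transpose-at i j rewrite dec-true (i Fin.≟ i) refl = refl

  transpose-else : ∀ {n} {i j k : Fin n} → k ≢ i → k ≢ j → Components.transpose i j k ≡ k
  transpose-else {i = i} {j} {k} k≢i k≢j rewrite dec-false (k Fin.≟ i) k≢i | dec-false (k Fin.≟ j) k≢j = refl

  module _ {m n : ℕ} where

    to-injective : (π : Permutation m n) → ∀ {x y} → π ⟨$⟩ʳ x ≡ π ⟨$⟩ʳ y → x ≡ y
    to-injective π {x} {y} eq = trans (sym (Inverse.strictlyInverseʳ π x)) (trans (cong (Inverse.from π) eq) (Inverse.strictlyInverseʳ π y))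

    -- A transposition of the target sends x to y and fixes every value other than y and the old
    -- image of x. A bijection with four prescribed values thus arises one value at a time, the
    -- earlier ones surviving because the targets are distinct.
    redirect : Permutation m n → Fin m → Fin n → Permutation m n
    redirect π x y = π ∘ₚ transpose (π ⟨$⟩ʳ x) y

    redirect-at : ∀ π x y → redirect π x y ⟨$⟩ʳ x ≡ y
    redirect-at π x y = transpose-at (π ⟨$⟩ʳ x) y

    redirect-else : ∀ π {x y z} → z ≢ x → π ⟨$⟩ʳ z ≢ y → redirect π x y ⟨$⟩ʳ z ≡ π ⟨$⟩ʳ z
    redirect-else π z≢x πz≢y = transpose-else (z≢x ∘ to-injective π) πz≢y

  module _ (m : ℕ) where

    private
      N : ℕ
      N = 1 + (m + (2 + 1))

    centre pair₁ pair₂ leaf : Fin N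
    centre = zero
    pair₁  = suc (m ↑ʳ zero)
    pair₂  = suc (m ↑ʳ suc zero)
    leaf   = suc (m ↑ʳ suc (suc zero))

    private
      right≢ : ∀ {i j : Fin (2 + 1)} → i ≢ j → _≢_ {A = Fin N} (suc (m ↑ʳ i)) (suc (m ↑ʳ j))
      right≢ i≢j eq = i≢j (Fin.↑ʳ-injective m _ _ (Fin.suc-injective eq))

    pair₁≢pair₂ : pair₁ ≢ pair₂
    pair₁≢pair₂ = right≢ λ ()

    pair₁≢leaf : pair₁ ≢ leaf
    pair₁≢leaf = right≢ λ ()

    pair₂≢leaf : pair₂ ≢ leaf
    pair₂≢leaf = right≢ λ ()

    -- Adjacency in the extremal graph by its exceptions: only the leaf and the pair restrict their
    -- neighbours. The clauses speak of x alone, so an edge is described by using them in both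
    -- directions.
    record Compatible (x y : Fin N) : Set where
      field
        at-leaf  : x ≡ leaf → y ≡ centre
        at-pair₁ : x ≡ pair₁ → y ≡ pair₂ ⊎ y ≡ centre
        at-pair₂ : x ≡ pair₂ → y ≡ pair₁ ⊎ y ≡ centre

    open Compatible

    private
      core-only : ∀ {x y} → Compatible x y → (i : Fin (2 + 1)) → x ≡ suc (m ↑ʳ i) →
        y ≡ pair₂ ⊎ y ≡ pair₁ ⊎ y ≡ centre
      core-only xy zero             eq = Sum.map₂ inj₂ (at-pair₁ xy eq)
      core-only xy (suc zero)       eq = inj₂ (at-pair₂ xy eq)
      core-only xy (suc (suc zero)) eq = inj₂ (inj₂ (at-leaf xy eq))

      left≢right : ∀ {w i j} → splitAt m {2 + 1} w ≡ inj₁ i → w ≢ m ↑ʳ j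
      left≢right {j = j} eq refl with () ← trans (sym (Fin.splitAt-↑ʳ m (2 + 1) j)) eq

      mixed : ∀ {w j y i} → w ≡ m ↑ʳ j → splitAt m y ≡ inj₁ i → ¬ Compatible (suc w) (suc y)
      mixed {j = j} refl y∈ xy with core-only xy j refl
      ... | inj₁ eq        = left≢right y∈ (Fin.suc-injective eq)
      ... | inj₂ (inj₁ eq) = left≢right y∈ (Fin.suc-injective eq)

      small : ∀ i j → i ≢ j → Compatible (suc (m ↑ʳ i)) (suc (m ↑ʳ j)) → Compatible (suc (m ↑ʳ j)) (suc (m ↑ʳ i)) →
        adj (K 2 ∪ K 1) i j ≡ true
      small zero             zero             i≢j _ _ = contradiction refl i≢j
      small zero             (suc zero)       _   _ _ = refl
      small (suc zero)       zero             _   _ _ = refl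
      small (suc zero)       (suc zero)       i≢j _ _ = contradiction refl i≢j
      small (suc (suc zero)) (suc (suc zero)) i≢j _ _ = contradiction refl i≢j
      small (suc (suc zero)) zero             _ ij _ with () ← at-leaf ij refl
      small (suc (suc zero)) (suc zero)       _ ij _ with () ← at-leaf ij refl
      small zero             (suc (suc zero)) _ _ ji with () ← at-leaf ji refl
      small (suc zero)       (suc (suc zero)) _ _ ji with () ← at-leaf ji refl

      K-adj : ∀ {k} {i j : Fin k} → i ≢ j → adj (K k) i j ≡ true
      K-adj {i = i} {j} i≢j with i Fin.≟ j
      ... | yes i≡j = contradiction i≡j i≢j
      ... | no  _   = refl

    compatible⇒adj : ∀ x y → x ≢ y → Compatible x y → Compatible y x → adj (G₀ m) x y ≡ true
    compatible⇒adj zero    zero    x≢y _ _ = contradiction refl x≢y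
    compatible⇒adj zero    (suc y) _   _ _ = refl
    compatible⇒adj (suc x) zero    _   _ _ = refl
    compatible⇒adj (suc x) (suc y) x≢y xy yx with splitAt m x in x∈ | splitAt m y in y∈
    ... | inj₁ i | inj₁ j = K-adj (λ { refl → x≢y (cong suc (trans (sym (Fin.splitAt⁻¹-↑ˡ x∈)) (Fin.splitAt⁻¹-↑ˡ y∈))) })
    ... | inj₁ i | inj₂ j = ⊥-elim (mixed (sym (Fin.splitAt⁻¹-↑ʳ {m} {i = y} y∈)) x∈ yx)
    ... | inj₂ i | inj₁ j = ⊥-elim (mixed (sym (Fin.splitAt⁻¹-↑ʳ {m} {i = x} x∈)) y∈ xy)
    ... | inj₂ i | inj₂ j with Fin.splitAt⁻¹-↑ʳ {m} {i = x} x∈ | Fin.splitAt⁻¹-↑ʳ {m} {i = y} y∈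
    ...   | refl | refl = small i j (λ { refl → x≢y refl }) xy yx

    module _ {n} (n≡4+m : n ≡ 4 + m) (G : Graph n) {c a b d : Fin n}
      (c≢a : c ≢ a) (c≢b : c ≢ b) (c≢d : c ≢ d) (a≢b : a ≢ b) (a≢d : a ≢ d) (b≢d : b ≢ d)
      (N[d] : ∀ {y} → Adj G d y → y ≡ c) (N[a] : ∀ {y} → Adj G a y → y ≡ b ⊎ y ≡ c)
      (N[b] : ∀ {y} → Adj G b y → y ≡ a ⊎ y ≡ c) where

      private
        start : Permutation n N
        start = subst (λ k → Fin n ↔ Fin k) (trans n≡4+m (cong suc (+-comm 3 m))) (↔-id (Fin n))

        π₁ π₂ π₃ : Permutation n N
        π₁ = redirect start c centre
        π₂ = redirect π₁ a pair₁
        π₃ = redirect π₂ b pair₂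

      embedding : Permutation n N
      embedding = redirect π₃ d leaf

      private
        c₁ : π₁ ⟨$⟩ʳ c ≡ centre
        c₁ = redirect-at start c centre
        c₂ : π₂ ⟨$⟩ʳ c ≡ centre
        c₂ = trans (redirect-else π₁ c≢a (λ eq → contradiction (trans (sym c₁) eq) λ ())) c₁
        a₂ : π₂ ⟨$⟩ʳ a ≡ pair₁
        a₂ = redirect-at π₁ a pair₁
        c₃ : π₃ ⟨$⟩ʳ c ≡ centre
        c₃ = trans (redirect-else π₂ c≢b (λ eq → contradiction (trans (sym c₂) eq) λ ())) c₂
        a₃ : π₃ ⟨$⟩ʳ a ≡ pair₁
        a₃ = trans (redirect-else π₂ a≢b (λ eq → pair₁≢pair₂ (trans (sym a₂) eq))) a₂
        b₃ : π₃ ⟨$⟩ʳ b ≡ pair₂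
        b₃ = redirect-at π₂ b pair₂
        c₄ : embedding ⟨$⟩ʳ c ≡ centre
        c₄ = trans (redirect-else π₃ c≢d (λ eq → contradiction (trans (sym c₃) eq) λ ())) c₃
        a₄ : embedding ⟨$⟩ʳ a ≡ pair₁
        a₄ = trans (redirect-else π₃ a≢d (λ eq → pair₁≢leaf (trans (sym a₃) eq))) a₃
        b₄ : embedding ⟨$⟩ʳ b ≡ pair₂
        b₄ = trans (redirect-else π₃ b≢d (λ eq → pair₂≢leaf (trans (sym b₃) eq))) b₃
        d₄ : embedding ⟨$⟩ʳ d ≡ leaf
        d₄ = redirect-at π₃ d leaf

        to : Fin n → Fin N
        to = embedding ⟨$⟩ʳ_

        back : ∀ {x y z} → to y ≡ z → to x ≡ z → x ≡ y
        back ty tx = to-injective embedding (trans tx (sym ty))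

        compatible : ∀ {x y} → Adj G x y → Compatible (to x) (to y)
        compatible xy = record
          { at-leaf  = λ eq → trans (cong to (N[d] (from xy (back d₄ eq)))) c₄
          ; at-pair₁ = λ eq → Sum.map (λ { refl → b₄ }) (λ { refl → c₄ }) (N[a] (from xy (back a₄ eq)))
          ; at-pair₂ = λ eq → Sum.map (λ { refl → a₄ }) (λ { refl → c₄ }) (N[b] (from xy (back b₄ eq)))
          }
          where
          from : ∀ {x y z} → Adj G x y → x ≡ z → Adj G z y
          from xy refl = xy

      embedding-hom : ∀ x y → Adj G x y → adj (G₀ m) (to x) (to y) ≡ true
      embedding-hom x y xy = compatible⇒adj (to x) (to y) (λ eq → loop (to-injective embedding eq))
        (compatible xy) (compatible (trans (adj-sym G y x) xy))
        where
        loop : x ≢ y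
        loop refl with () ← trans (sym xy) (Defs.no-loop G x)

-- Connectedness and 1-binding as conditions on vertex sets.

module Binding where

  open Defs using (Graph; adj; Adj; Connected; fromℚ; 1ℝ; neighbours; neighboursOf; IsBindingNumber; _-Binding_)
  open Counting
  open import Data.Fin.Subset using (Subset; _∈_; _⊆_; ⊤; ⋃; ∣_∣)
  open import Data.Fin.Subset.Properties using (p⊆q⇒∣p∣≤∣q∣; x∈p∪q⁻; ∉⊥; ∣⊤∣≡n; _∈?_)
  import Data.Integer.Base as ℤ
  import Data.Integer.Properties as ℤ
  import Data.List.Membership.Propositional as List
  import Data.List.Membership.Propositional.Properties as List
  open import Data.Nat.Base using (_<_; _≤_; s≤s; z≤n)
  open import Data.Rational.Base as ℚ using (ℚ; 1ℚ)
  import Data.Rational.Properties as ℚ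
  import Data.Rational.Unnormalised.Base as ℚᵘ
  import Data.Rational.Unnormalised.Properties as ℚᵘ
  open import Data.Vec.Base using (tabulate)
  import Data.Vec.Properties as Vec
  open import Relation.Binary.Construct.Closure.ReflexiveTransitive using (Star; _◅_) renaming (ε to [])

  connected⇒escape : ∀ {n} {G : Graph n} → Connected G → ∀ (S : Fin n → Bool) {x y} →
    S x ≡ true → S y ≡ false → ∃[ s ] ∃[ t ] (S s ≡ true × S t ≡ false × Adj G s t)
  connected⇒escape {G = G} conn S {x} {y} = walk (conn x y)
    where
    walk : ∀ {x y} → Star (Adj G) x y → S x ≡ true → S y ≡ false → ∃[ s ] ∃[ t ] (S s ≡ true × S t ≡ false × Adj G s t)
    walk [] Sx Sy with () ← trans (sym Sx) Sy
    walk {x} (_◅_ {j = z} xz zy) Sx Sy with S z in Sz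
    ... | true  = walk zy Sz Sy
    ... | false = x , z , Sx , Sz , xz

  -- The order on reals holds only up to each positive ε. If b < 1, a rational strictly between them
  -- provides an ε that is too small.
  1≤fromℚ⇒1≤ : ∀ {b} → 1ℝ Defs.≤ fromℚ b → 1ℚ ℚ.≤ b
  1≤fromℚ⇒1≤ {b} 1≤b = ℚ.≮⇒≥ λ b<1 →
    let ε    , b<ε<1 = ℚ.<-dense b<1
        N , close = 1≤b (ε ℚ.- b) (subst (ℚ._< ε ℚ.- b) (ℚ.+-inverseʳ b) (ℚ.+-monoˡ-< (ℚ.- b) (proj₁ b<ε<1)))
    in ℚ.<-irrefl refl (ℚ.<-≤-trans (proj₂ b<ε<1) (subst (1ℚ ℚ.≤_) (cancel b ε) (close N ℕ.≤-refl)))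
    where
    cancel : ∀ b e → b ℚ.+ (e ℚ.- b) ≡ e
    cancel b e = trans (ℚ.+-comm b _) (trans (ℚ.+-assoc e (ℚ.- b) b)
      (trans (cong (e ℚ.+_) (ℚ.+-inverseˡ b)) (ℚ.+-identityʳ e)))

  1≤/⇒≤ : ∀ p s .{{_ : ℕ.NonZero s}} → 1ℚ ℚ.≤ (ℤ.+ p) ℚ./ s → s ≤ p
  1≤/⇒≤ p (suc s) le = cross (ℚᵘ.≤-respʳ-≃ (ℚ.toℚᵘ-fromℚᵘ (ℚᵘ.mkℚᵘ (ℤ.+ p) s)) (ℚ.toℚᵘ-mono-≤ le))
    where
    cross : ℚᵘ.1ℚᵘ ℚᵘ.≤ ℚᵘ.mkℚᵘ (ℤ.+ p) s → suc s ≤ p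
    cross (ℚᵘ.*≤* le) = ℤ.drop‿+≤+ (subst₂ ℤ._≤_ (ℤ.*-identityˡ (ℤ.+ suc s)) (ℤ.*-identityʳ (ℤ.+ p)) le)

  ∈-tabulate⁻ : ∀ {n} (p : Fin n → Bool) {x} → x ∈ tabulate p → p x ≡ true
  ∈-tabulate⁻ p {x} x∈ = trans (sym (Vec.lookup∘tabulate p x)) (Vec.[]=⇒lookup x∈)

  ∈-tabulate⁺ : ∀ {n} (p : Fin n → Bool) {x} → p x ≡ true → x ∈ tabulate p
  ∈-tabulate⁺ p {x} px = Vec.lookup⇒[]= x _ (trans (Vec.lookup∘tabulate p x) px)

  ∈-neighboursOf⁻ : ∀ {n} (G : Graph n) (S : Subset n) {x} → x ∈ neighboursOf G S → ∃[ s ] (s ∈ S × Adj G s x)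
  ∈-neighboursOf⁻ {n} G S x∈ with go (filter (_∈? S) (allFin n)) x∈
    where
    go : ∀ (L : List (Fin n)) {x} → x ∈ ⋃ (List.map (neighbours G) L) → ∃[ s ] (s List.∈ L × Adj G s x)
    go [] x∈ = contradiction x∈ ∉⊥
    go (s ∷ L) x∈ with x∈p∪q⁻ (neighbours G s) _ x∈
    ... | inj₁ x∈s = s , here refl , ∈-tabulate⁻ (adj G s) x∈s
    ... | inj₂ x∈L = let t , t∈ , tx = go L x∈L in t , there t∈ , tx
  ... | s , s∈ , sx = s , proj₂ (List.∈-filter⁻ (_∈? S) {xs = allFin n} s∈) , sx

  binding⇒hall : ∀ {n} {G : Graph n} → 1ℝ -Binding G → ∀ (S D : Fin n → Bool) → ∑ (𝟙 ∘ D) < ∑ (𝟙 ∘ S) →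
    ∃[ s ] ∃[ x ] (S s ≡ true × D x ≡ false × Adj G s x)
  binding⇒hall {n} {G} (b , isB , 1≤b) S D D<S
    with Fin.any? (λ s → Fin.any? (λ x → (S s Bool.≟ true) ×-dec (D x Bool.≟ false) ×-dec (adj G s x Bool.≟ true)))
  ... | yes found = found
  ... | no  none  = contradiction (ℕ.≤-trans S≤N N≤D) (ℕ.<⇒≱ D<S)
    where
    S′ : Subset n
    S′ = tabulate S
    N⊆D : neighboursOf G S′ ⊆ tabulate D
    N⊆D {x} x∈ with ∈-neighboursOf⁻ G S′ x∈
    ... | s , s∈ , sx with D x in Dx
    ...   | true  = ∈-tabulate⁺ D Dx
    ...   | false = contradiction (s , x , ∈-tabulate⁻ S s∈ , Dx , sx) none
    N≤D : ∣ neighboursOf G S′ ∣ ≤ ∑ (𝟙 ∘ D)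
    N≤D = ℕ.≤-trans (p⊆q⇒∣p∣≤∣q∣ N⊆D) (ℕ.≤-reflexive (∣tabulate∣ D))
    S≤n : ∑ (𝟙 ∘ S) ≤ n
    S≤n = ℕ.≤-trans (∑-mono-≤ (λ i → 𝟙≤1 (S i))) (ℕ.≤-reflexive (trans (∑-const n 1) (ℕ.*-identityʳ n)))
    N≢⊤ : neighboursOf G S′ ≢ ⊤
    N≢⊤ N≡⊤ = contradiction (ℕ.≤-trans (ℕ.≤-reflexive (sym (trans (cong ∣_∣ N≡⊤) (∣⊤∣≡n n)))) N≤D) (ℕ.<⇒≱ (ℕ.<-≤-trans D<S S≤n))
    s∈S : ∃[ s ] 0 < 𝟙 (S s)
    s∈S = ∑<∑⇒∃< (λ _ → 0) (𝟙 ∘ S) (ℕ.≤-trans (s≤s (ℕ.≤-trans (ℕ.≤-reflexive (trans (∑-const n 0) (ℕ.*-zeroʳ n))) z≤n)) D<S)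
    positive⇒true : ∀ {b} → 0 < 𝟙 b → b ≡ true
    positive⇒true {true} _ = refl
    S≤N : ∑ (𝟙 ∘ S) ≤ ∣ neighboursOf G S′ ∣
    S≤N = subst (_≤ ∣ neighboursOf G S′ ∣) (∣tabulate∣ S) (1≤/⇒≤ _ ∣ S′ ∣ {{ℕ.>-nonZero (subst (0 <_) (sym (∣tabulate∣ S)) (ℕ.≤-trans (s≤s z≤n) D<S))}} (ℚ.≤-trans (1≤fromℚ⇒1≤ 1≤b)
      (IsBindingNumber.lowerBound isB S′ (proj₁ s∈S , ∈-tabulate⁺ S (positive⇒true (proj₂ s∈S))) N≢⊤)))

-- Assembly of the spectral and the combinatorial half.

open import Defs
open import Data.Fin.Subset using (∣_∣)
open import Data.Nat.Base using (_∸_; _≥_)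
open import Data.Nat.Divisibility using (_∣_)
import Data.Rational.Base as ℚ
import Data.Rational.Properties as ℚ
open Root using (ι; ι-mono; 2ℚ; 3ℚ)
open Binding using (connected⇒escape; binding⇒hall)
open TestVectors using (Good)
open Closure using (good⇒hamPath)
open PathFactor using (hamPath⇒factor)

2≤ι : ∀ {m} → 7 ℕ.≤ m → 2ℚ ℚ.≤ ι m
2≤ι 7≤m = ι-mono (ℕ.≤-trans (ℕ.m≤m+n 2 5) 7≤m)

ι[4+m] : ∀ m → ι (4 ℕ.+ m) ≡ ι m ℚ.+ (3ℚ ℚ.+ ℚ.1ℚ)
ι[4+m] m = trans (Root.ι-+ 4 m) (ℚ.+-comm (ι 4) (ι m))

module _ {n m} (n≡4+m : n ≡ 4 ℕ.+ m) (2≤m : 2ℚ ℚ.≤ ι m) (G : Graph n) (conn : Connected G) where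

  module _ (ρ : ℝ) (ρ-eig : IsEigenvalue (adjacencyMatrix G) ρ) (μ≤ρ : Extremal.μℝ m 2≤m ≤ ρ) where

    large⇒good : 1ℝ -Binding G → ¬ (G ≅ Extremal.G₀ m) → Good m G
    large⇒good bind G≇G₀ = record
      { escape          = connected⇒escape {G = G} conn
      ; hall            = binding⇒hall {G = G} bind
      ; noTestVector    = Extremal.noTestVector m 2≤m G conn ρ ρ-eig μ≤ρ (subst Fin (sym n≡4+m) zero)
      ; notExtremal     = λ c≢a c≢b c≢d a≢b a≢d b≢d N[d] N[a] N[b] →
          Extremal.noProperEmbedding m 2≤m G conn ρ ρ-eig μ≤ρ
            (Embedding.embedding m n≡4+m G c≢a c≢b c≢d a≢b a≢d b≢d N[d] N[a] N[b])
            (Embedding.embedding-hom m n≡4+m G c≢a c≢b c≢d a≢b a≢d b≢d N[d] N[a] N[b]) G≇G₀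
      ; noThreePendants = λ p c p-inj c-inj p≢c pendant →
          Pendants.noThreePendants m 2≤m (trans (cong ι n≡4+m) (ι[4+m] m)) G p c p-inj c-inj p≢c pendant conn ρ ρ-eig μ≤ρ
      }

  large⇒factor : 7 ℕ.≤ m → 1ℝ -Binding G → (ρ ρ₀ : ℝ) → IsSpectralRadius G ρ → IsSpectralRadius (Extremal.G₀ m) ρ₀ →
    ρ₀ ≤ ρ → ¬ (G ≅ Extremal.G₀ m) → (H : Fin n → DegreeSet) → 2 ∣ ∣ H⁻¹⟨1⟩ H ∣ → Factor G H
  large⇒factor 7≤m bind ρ ρ₀ isρ isρ₀ ρ₀≤ρ G≇G₀ H even = hamPath⇒factor G H
    (good⇒hamPath n≡4+m 7≤m G (large⇒good ρ (IsSpectralRadius.isEigenvalue isρ)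
      (Extremal.≤ℝ-trans {Extremal.μℝ m 2≤m} {ρ₀} {ρ} (Extremal.μ≤ρ₀ m 2≤m isρ₀) ρ₀≤ρ) bind G≇G₀)) even

theorem1p2 : ∀ (n : ℕ) → n ≥ 11 →
    (G : Graph n) → Connected G → 1ℝ -Binding G →
    let G₀ = K 1 ∨ (K (n ∸ 4) ∪ K 2 ∪ K 1) in
    (ρ ρ₀ : ℝ) → IsSpectralRadius G ρ → IsSpectralRadius G₀ ρ₀ → ρ₀ ≤ ρ →
    ¬ (G ≅ G₀) →
    (H : Fin n → DegreeSet) → 2 ∣ ∣ H⁻¹⟨1⟩ H ∣ → Factor G H
theorem1p2 n n≥11 G conn = large⇒factor n≡4+m (2≤ι 7≤m) G conn 7≤m
  where
  n≡4+m : n ≡ 4 ℕ.+ (n ∸ 4)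
  n≡4+m = sym (ℕ.m+[n∸m]≡n (ℕ.≤-trans (ℕ.m≤m+n 4 7) n≥11))
  7≤m : 7 ℕ.≤ n ∸ 4
  7≤m = ℕ.∸-monoˡ-≤ 4 n≥11
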